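{- For any constant $c>0$, there is a semi-streaming algorithm for $(1-\varepsilon)$-approximate bipartite maximum weight matching that uses $O(n\cdot\varepsilon^{ -(3+c)}\cdot\log W)$ space and has a pass complexity of $O(\varepsilon^{ -2})$.
   Context: The input is an undirected bipartite graph with $n$ vertices and edge weights in $[1,W]$, $W=\mathrm{poly}(n)$. A $(1-\varepsilon)$-approximate maximum weight matching is a matching whose total weight is at least $(1-\varepsilon)$ times the maximum weight of any matching. In the streaming model, the edges (with weights) of the input graph are presented in a stream in arbitrary order. A semi-streaming algorithm makes one or a few passes over the stream (the number of passes is its pass complexity), uses limited memory, and at the end outputs a solution.
   Formalization: Edge weights, ε and c are rational instead of real (W is a natural number at least 2); space is the memory retained between stream elements, counted in words of ⌈log₂ n⌉ bits. -}

module Defs where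

open import Algebra.Definitions.RawSemiring using (_^_)
open import Data.Bool.Base using (Bool)
open import Data.Fin.Base using (Fin)
open import Data.Integer.Base as ℤ using (+_)
open import Data.List.Base using (List; foldl; foldr; map)
open import Data.List.Membership.Propositional using (_∈_)
open import Data.List.Relation.Binary.Pointwise using (Pointwise)
open import Data.List.Relation.Unary.All using (All)
open import Data.List.Relation.Unary.AllPairs using (AllPairs)
open import Data.Nat.Base as ℕ using (ℕ)
open import Data.Nat.GeneralisedArithmetic using (fold)
open import Data.Nat.Logarithm using (⌈log₂_⌉)
open import Data.Product.Base using (∃; _×_; _,_)
open import Data.Rational.Base
  using (ℚ; 0ℚ; 1ℚ; _+_; _*_; _-_; _/_; _≤_; ↥_; ↧ₙ_; +-*-rawSemiring)
open import Data.Sum.Base using (_⊎_)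
open import Data.Vec.Base using (Vec)
open import Relation.Binary.PropositionalEquality using (_≡_; _≢_)
open import Relation.Nullary.Negation using (¬_)

fromℕ : ℕ → ℚ
fromℕ k = + k / 1

record Edge (n : ℕ) : Set where
  constructor edge
  field
    source target : Fin n
    weight        : ℚ

open Edge public

endpoints : ∀ {n} → Edge n → Fin n × Fin n
endpoints e = source e , target e

-- Edges are undirected: the order of the endpoints carries no information.
SamePair : ∀ {n} → Fin n × Fin n → Fin n × Fin n → Set
SamePair (u , v) (x , y) = (u ≡ x × v ≡ y) ⊎ (u ≡ y × v ≡ x)

VertexDisjoint : ∀ {n} → Edge n → Edge n → Set
VertexDisjoint e f =
  source e ≢ source f × source e ≢ target f ×
  target e ≢ source f × target e ≢ target f

-- A graph on the vertex set Fin n is given by a list of its edges.  Quantifying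
-- over all such lists quantifies over all graphs and all orders of their edges
-- (and both presentations uv, vu of each edge).
Stream : ℕ → Set
Stream n = List (Edge n)

-- The bipartition is only required to exist; the algorithm is not told it.
record IsBipartiteGraph {n : ℕ} (W : ℕ) (G : Stream n) : Set where
  field
    simple    : AllPairs (λ e f → ¬ SamePair (endpoints e) (endpoints f)) G
    bipartite : ∃ λ (side : Fin n → Bool) →
                  All (λ e → side (source e) ≢ side (target e)) G
    weights   : All (λ e → 1ℚ ≤ weight e × weight e ≤ fromℕ W) G

record IsMatching {n : ℕ} (G : Stream n) (M : List (Edge n)) : Set where
  field
    inGraph  : All (_∈ G) M
    disjoint : AllPairs VertexDisjoint M

totalWeight : ∀ {n} → List (Edge n) → ℚ
totalWeight M = foldr _+_ 0ℚ (map weight M)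

IsApproxMaxWeightMatching : ∀ {n} → ℚ → Stream n → List (Edge n) → Set
IsApproxMaxWeightMatching ε G M =
  IsMatching G M ×
  (∀ M′ → IsMatching G M′ → (1ℚ - ε) * totalWeight M′ ≤ totalWeight M)

-- Space is measured in words of ⌈log₂ n⌉ bits.
Word : ℕ → Set
Word n = Vec Bool ⌈log₂ n ⌉

-- Multi-pass streaming algorithms on n-vertex graphs.  The memory is everything
-- that survives from one stream element to the next, between passes, and up to
-- the output; there is no clock or pass counter outside it.  An arriving
-- rational weight is read exactly, but what is retained must fit the memory.
-- The output lists only vertex pairs: it need not reproduce exact weights.
record StreamingAlgorithm (n words : ℕ) : Set where
  Memory : Set
  Memory = Vec (Word n) words
  field
    init    : Memory
    step    : Memory → Edge n → Memory
    endPass : Memory → Memory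
    output  : Memory → List (Fin n × Fin n)

  pass : Stream n → Memory → Memory
  pass G m = endPass (foldl step m G)

  run : ℕ → Stream n → List (Fin n × Fin n)
  run passes G = output (fold init (pass G) passes)

open StreamingAlgorithm public using (run)

SolvesApproxMWM : ∀ {n words} → ℚ → ℕ → ℕ → StreamingAlgorithm n words → Set
SolvesApproxMWM {n} ε W passes A =
  ∀ (G : Stream n) → IsBipartiteGraph W G →
  ∃ λ M → Pointwise SamePair (run A passes G) (map endpoints M) ×
          IsApproxMaxWeightMatching ε G M

_^ℚ_ : ℚ → ℕ → ℚ
_^ℚ_ = _^_ +-*-rawSemiring

infixr 8 _^ℚ_

-- x ≤ y · ε^{-r} for rational r ≥ 0, with denominators cleared: writing r = a/b,
-- it says x^b · ε^a ≤ y^b.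
AtMostTimesInversePower : (x y : ℕ) (ε r : ℚ) → Set
AtMostTimesInversePower x y ε r =
  fromℕ x ^ℚ ↧ₙ r * ε ^ℚ ℤ.∣ ↥ r ∣ ≤ fromℕ y ^ℚ ↧ₙ r

{-# OPTIONS --safe #-}
-- Replace every vertex u by the heights 0, 1, 2, ... and an edge uv of integral weight w by the
-- pairs (u , s), (v , t) with s + t = w - 1.  A matching of weight S yields S disjoint pairs, and
-- by LP duality the edges used by any set of disjoint pairs contain a matching of at least that
-- weight.  So it is enough to solve an unweighted problem, with an auction in which bidders give up
-- a 1/k fraction of their value at a time: after k² passes it is within a factor 1 - O(1/k), with
-- no dependence on n, and k is chosen of order 1/ε.
--
-- Doing this in both directions (every vertex is a bidder and an item) makes the bipartition
-- unnecessary for the algorithm.  Merging heights into O(k log (kW)) groups of geometrically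
-- increasing size costs another factor 1 + 1/k and leaves few groups.  An edge that changes the
-- state of the auction exhausts a group of bidders or lifts the prices of a whole group of items,
-- which happens only O(n k³ log (kW)) times.  The memory is the list of these edges, from which
-- the state is recomputed; the output is a best matching among them.
module Submission where

-- There are `n` times `k * W` slots, and slots of one group may differ in price and holder, so the
-- state of the auction does not fit in memory. It is determined by the edges that changed it, and
-- these are few provided that an edge always makes its bidder propose to a whole group of slots;
-- this is why the condition s + t = w - 1 is relaxed to an equality of groups. Weights are measured
-- in units of 1/`k`, so every rounded weight is at least `k`. An additive error of one unit per
-- edge, made once in rounding the weights and once in an integral dual solution, then becomes a
-- relative error 1/`k`. Counted in multiples of 1/`k`, the losses are 2 + 1 in the auction and 1
-- each in grouping, dual and rounding. Their sum 6 is the reason for choosing `k` with 6 ≤ `k` ε ≤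
-- 12. The space obtained in this way is of order n log W times k³ log² k. One factor log k comes
-- from the number of groups, the other from the words that store one weight; both are paid for by
-- the additional exponent c.

module FiniteSums where

  -- Finite sums over lists.

  open import Data.List.Base using (List; []; _∷_; _++_; length; map; cartesianProduct)
  open import Data.List.Membership.Propositional using (_∈_; _∉_)
  open import Data.List.Relation.Unary.All as All using (All; []; _∷_)
  open import Data.List.Relation.Unary.Any using (here; there)
  open import Data.List.Relation.Unary.AllPairs using ([]; _∷_)
  open import Data.List.Relation.Unary.Unique.Propositional using (Unique)
  open import Data.List.Properties using (map-++; map-∘; length-++; length-map)
  open import Data.Nat.Base hiding (_/_)
  open import Data.Nat.ListAction using (sum)
  open import Data.Nat.ListAction.Properties using (sum-++)
  open import Data.Nat.Properties
  open import Data.Product.Base using (_×_; _,_)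
  open import Function.Base using (_∘_)
  open import Relation.Binary.Definitions using (DecidableEquality)
  open import Relation.Binary.PropositionalEquality
  open import Relation.Nullary.Decidable.Core using (Dec; yes; no)
  open import Relation.Nullary.Negation.Core using (¬_; contradiction)
  open import Data.Nat.Tactic.RingSolver using (solve-∀)

  private variable
    A B : Set

  ∑ : List A → (A → ℕ) → ℕ
  ∑ xs f = sum (map f xs)

  infix 5 ∑-syntax
  ∑-syntax : List A → (A → ℕ) → ℕ
  ∑-syntax = ∑
  syntax ∑-syntax xs (λ x → e) = ∑[ x ∈ xs ] e

  [_]? : {P : Set} → Dec P → ℕ
  [ yes _ ]? = 1
  [ no _ ]? = 0

  []?-true : ∀ {P : Set} (P? : Dec P) → P → [ P? ]? ≡ 1
  []?-true (yes _) _ = refl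
  []?-true (no ¬p) p = contradiction p ¬p

  []?-false : ∀ {P : Set} (P? : Dec P) → ¬ P → [ P? ]? ≡ 0
  []?-false (yes p) ¬p = contradiction p ¬p
  []?-false (no _) _ = refl

  []?≤1 : ∀ {P : Set} (P? : Dec P) → [ P? ]? ≤ 1
  []?≤1 (yes _) = ≤-refl
  []?≤1 (no _) = z≤n

  []?-mono : ∀ {P Q : Set} (P? : Dec P) (Q? : Dec Q) → (P → Q) → [ P? ]? ≤ [ Q? ]?
  []?-mono (yes p) Q? f = ≤-reflexive (sym ([]?-true Q? (f p)))
  []?-mono (no _) Q? f = z≤n

  ∑-mono : ∀ (xs : List A) {f g : A → ℕ} → (∀ {x} → x ∈ xs → f x ≤ g x) → ∑ xs f ≤ ∑ xs g
  ∑-mono [] h = z≤n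
  ∑-mono (x ∷ xs) h = +-mono-≤ (h (here refl)) (∑-mono xs (h ∘ there))

  ∑-mono-< : ∀ (xs : List A) {f g : A → ℕ} → (∀ {x} → x ∈ xs → f x ≤ g x) →
             ∀ {x} → x ∈ xs → f x < g x → ∑ xs f < ∑ xs g
  ∑-mono-< (x ∷ xs) h (here refl) lt = +-mono-<-≤ lt (∑-mono xs (h ∘ there))
  ∑-mono-< (x ∷ xs) h (there x∈) lt = +-mono-≤-< (h (here refl)) (∑-mono-< xs (h ∘ there) x∈ lt)

  ∑-cong : ∀ (xs : List A) {f g : A → ℕ} → (∀ {x} → x ∈ xs → f x ≡ g x) → ∑ xs f ≡ ∑ xs g
  ∑-cong xs h = ≤-antisym (∑-mono xs (≤-reflexive ∘ h)) (∑-mono xs (≤-reflexive ∘ sym ∘ h))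

  ∑-+ : ∀ (xs : List A) (f g : A → ℕ) → (∑[ x ∈ xs ] (f x + g x)) ≡ ∑ xs f + ∑ xs g
  ∑-+ [] f g = refl
  ∑-+ (x ∷ xs) f g = trans (cong (f x + g x +_) (∑-+ xs f g)) (solve-∀′ (f x) (g x) _ _)
    where
    solve-∀′ : ∀ a b c d → a + b + (c + d) ≡ a + c + (b + d)
    solve-∀′ = solve-∀

  ∑-*ˡ : ∀ k (xs : List A) (f : A → ℕ) → (∑[ x ∈ xs ] (k * f x)) ≡ k * ∑ xs f
  ∑-*ˡ k [] f = sym (*-zeroʳ k)
  ∑-*ˡ k (x ∷ xs) f = trans (cong (k * f x +_) (∑-*ˡ k xs f)) (sym (*-distribˡ-+ k (f x) _))

  ∑-*ʳ : ∀ k (xs : List A) (f : A → ℕ) → (∑[ x ∈ xs ] (f x * k)) ≡ ∑ xs f * k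
  ∑-*ʳ k [] f = refl
  ∑-*ʳ k (x ∷ xs) f = trans (cong (f x * k +_) (∑-*ʳ k xs f)) (sym (*-distribʳ-+ k (f x) _))

  ∑-const : ∀ (xs : List A) k → (∑[ _ ∈ xs ] k) ≡ length xs * k
  ∑-const [] k = refl
  ∑-const (x ∷ xs) k = cong (k +_) (∑-const xs k)

  ∑-≤-const : ∀ (xs : List A) {f : A → ℕ} k → (∀ {x} → x ∈ xs → f x ≤ k) → ∑ xs f ≤ length xs * k
  ∑-≤-const xs k h = ≤-trans (∑-mono xs h) (≤-reflexive (∑-const xs k))

  ∑-0 : ∀ (xs : List A) → (∑[ _ ∈ xs ] 0) ≡ 0
  ∑-0 xs = trans (∑-const xs 0) (*-zeroʳ (length xs))

  ∑-swap : ∀ (xs : List A) (ys : List B) (f : A → B → ℕ) →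
           (∑[ x ∈ xs ] ∑[ y ∈ ys ] f x y) ≡ (∑[ y ∈ ys ] ∑[ x ∈ xs ] f x y)
  ∑-swap [] ys f = sym (∑-0 ys)
  ∑-swap (x ∷ xs) ys f = trans (cong (∑ ys (f x) +_) (∑-swap xs ys f)) (sym (∑-+ ys (f x) _))

  ∑-++ : ∀ (xs ys : List A) (f : A → ℕ) → ∑ (xs ++ ys) f ≡ ∑ xs f + ∑ ys f
  ∑-++ xs ys f = trans (cong sum (map-++ f xs ys)) (sum-++ (map f xs) (map f ys))

  ∑-map : ∀ (g : A → B) (xs : List A) (f : B → ℕ) → ∑ (map g xs) f ≡ ∑ xs (f ∘ g)
  ∑-map g xs f = cong sum (sym (map-∘ xs))

  ∑-× : ∀ (xs : List A) (ys : List B) (f : A × B → ℕ) →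
        ∑ (cartesianProduct xs ys) f ≡ (∑[ x ∈ xs ] ∑[ y ∈ ys ] f (x , y))
  ∑-× [] ys f = refl
  ∑-× (x ∷ xs) ys f =
    trans (∑-++ (map (x ,_) ys) _ f) (cong₂ _+_ (∑-map (x ,_) ys f) (∑-× xs ys f))

  module Update (_≟_ : DecidableEquality A) where

    update : {C : Set} → A → C → (A → C) → A → C
    update x v f y with y ≟ x
    ... | yes _ = v
    ... | no  _ = f y

    update-≡ : ∀ {C : Set} x {v : C} {f} → update x v f x ≡ v
    update-≡ x with x ≟ x
    ... | yes _ = refl
    ... | no  ¬p = contradiction refl ¬p

    update-≢ : ∀ {C : Set} {x y} {v : C} {f} → y ≢ x → update x v f y ≡ f y
    update-≢ {x = x} {y} y≢x with y ≟ x
    ... | yes p = contradiction p y≢x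
    ... | no _ = refl

    ∑-update-∉ : ∀ xs {x v f} → x ∉ xs → ∑ xs (update x v f) ≡ ∑ xs f
    ∑-update-∉ xs x∉ = ∑-cong xs λ y∈ → update-≢ λ { refl → x∉ y∈ }

    -- The old value stands on the left because subtraction of naturals truncates.
    ∑-update : ∀ {xs} → Unique xs → ∀ {x v f} → x ∈ xs →
               ∑ xs (update x v f) + f x ≡ ∑ xs f + v
    ∑-update {y ∷ xs} (y# ∷ uxs) {v = v} {f} (here refl) = begin
      update y v f y + ∑ xs (update y v f) + f y
        ≡⟨ cong₂ (λ a b → a + b + f y) (update-≡ y) (∑-update-∉ xs λ y∈ → All.lookup y# y∈ refl) ⟩
      v + ∑ xs f + f y ≡⟨ rearrange v _ (f y) ⟩
      f y + ∑ xs f + v ∎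
      where
      open ≡-Reasoning
      rearrange : ∀ a b c → a + b + c ≡ c + b + a
      rearrange = solve-∀
    ∑-update {y ∷ xs} (y# ∷ uxs) {x} {v} {f} (there x∈) = begin
      update x v f y + ∑ xs (update x v f) + f x
        ≡⟨ cong (λ a → a + _ + f x) (update-≢ λ { refl → All.lookup y# x∈ refl }) ⟩
      f y + ∑ xs (update x v f) + f x ≡⟨ +-assoc (f y) _ _ ⟩
      f y + (∑ xs (update x v f) + f x) ≡⟨ cong (f y +_) (∑-update uxs x∈) ⟩
      f y + (∑ xs f + v) ≡⟨ +-assoc (f y) _ _ ⟨
      f y + ∑ xs f + v ∎
      where open ≡-Reasoning

    ∑-indicator : ∀ {xs} → Unique xs → ∀ {x} (f : A → ℕ) → x ∈ xs → (∑[ y ∈ xs ] [ x ≟ y ]? * f y) ≡ f x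
    ∑-indicator {xs} uxs {x} f x∈ = begin
      (∑[ y ∈ xs ] [ x ≟ y ]? * f y) ≡⟨ ∑-cong xs (λ {y} _ → pointwise y) ⟩
      ∑ xs (update x (f x) (λ _ → 0)) ≡⟨ +-identityʳ _ ⟨
      ∑ xs (update x (f x) (λ _ → 0)) + 0 ≡⟨ ∑-update uxs x∈ ⟩
      (∑[ _ ∈ xs ] 0) + f x ≡⟨ cong (_+ f x) (∑-0 xs) ⟩
      f x ∎
      where
      open ≡-Reasoning
      pointwise : ∀ y → [ x ≟ y ]? * f y ≡ update x (f x) (λ _ → 0) y
      pointwise y with x ≟ y
      ... | yes refl = trans (+-identityʳ _) (sym (update-≡ y))
      ... | no  x≢y  = sym (update-≢ (x≢y ∘ sym))

    ∑-indicator-≤ : ∀ {xs} → Unique xs → ∀ x (f : A → ℕ) → (∑[ y ∈ xs ] [ x ≟ y ]? * f y) ≤ f x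
    ∑-indicator-≤ {[]} _ x f = z≤n
    ∑-indicator-≤ {y ∷ xs} (y# ∷ xs!) x f with x ≟ y
    ... | no _ = ∑-indicator-≤ xs! x f
    ... | yes refl = ≤-reflexive (trans (cong₂ _+_ (+-identityʳ (f x)) rest) (+-identityʳ (f x)))
      where
      rest : (∑[ y ∈ xs ] [ x ≟ y ]? * f y) ≡ 0
      rest = trans (∑-cong xs λ {y} y∈ → cong (_* f y) ([]?-false (x ≟ y) (All.lookup y# y∈))) (∑-0 xs)

    -- Each positive term is charged to an occurrence of its index in `ys`. As `xs` has no
    -- repetitions, no occurrence is charged twice, even if `ys` repeats elements.
    ∑-support : ∀ {xs ys} → Unique xs → (f : A → ℕ) →
                (∀ {x} → x ∈ xs → 0 < f x → x ∈ ys) → ∑ xs f ≤ ∑ ys f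
    ∑-support {xs} {ys} xs! f supp = begin
      ∑ xs f ≤⟨ ∑-mono xs hit ⟩
      (∑[ x ∈ xs ] ∑[ y ∈ ys ] [ y ≟ x ]? * f x) ≡⟨ ∑-swap xs ys _ ⟩
      (∑[ y ∈ ys ] ∑[ x ∈ xs ] [ y ≟ x ]? * f x) ≤⟨ ∑-mono ys (λ {y} _ → ∑-indicator-≤ xs! y f) ⟩
      ∑ ys f ∎
      where
      open ≤-Reasoning
      one : ∀ {zs} {x} → x ∈ zs → f x ≤ (∑[ y ∈ zs ] [ y ≟ x ]? * f x)
      one {x = x} (here refl) rewrite []?-true (x ≟ x) refl = ≤-trans (m≤m+n (f x) 0) (m≤m+n _ _)
      one (there x∈) = ≤-trans (one x∈) (m≤n+m _ _)
      hit : ∀ {x} → x ∈ xs → f x ≤ (∑[ y ∈ ys ] [ y ≟ x ]? * f x)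
      hit {x} x∈ with 0 <? f x
      ... | yes 0<f = one (supp x∈ 0<f)
      ... | no 0≮f  = ≤-trans (≮⇒≥ 0≮f) z≤n

  length-cartesianProduct : ∀ (xs : List A) (ys : List B) →
    length (cartesianProduct xs ys) ≡ length xs * length ys
  length-cartesianProduct [] ys = refl
  length-cartesianProduct (x ∷ xs) ys =
    trans (length-++ (map (x ,_) ys)) (cong₂ _+_ (length-map (x ,_) ys) (length-cartesianProduct xs ys))

-- An auction with capacitated bidders, and the log that reproduces it.

module CapacitatedAuction where

  open import Data.List.Base using (List; []; _∷_; length; map; cartesianProduct; upTo; foldl)
  open import Data.List.Membership.Propositional using (_∈_)
  open import Data.List.Relation.Unary.All as All using (All; []; _∷_)
  open import Data.List.Relation.Unary.Any as Any using (Any; here; there)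
  open import Data.List.Relation.Unary.Unique.Propositional using (Unique)
  open import Data.Nat.Base hiding (_/_)
  open import Data.Nat.Properties
  open import Data.Product.Base using (_×_; _,_; proj₁; proj₂; ∃)
  open import Data.Sum.Base using (_⊎_; inj₁; inj₂)
  open import Data.Nat.GeneralisedArithmetic using (fold)
  open import Function.Base using (_∘_; case_of_)
  open import Relation.Binary.Definitions using (DecidableEquality)
  open import Relation.Binary.PropositionalEquality
  open import Relation.Nullary.Decidable.Core using (Dec; yes; no; _×-dec_)
  open import Relation.Nullary.Negation.Core using (¬_; contradiction)
  open import Data.List.Properties using (length-upTo)
  open import Data.Maybe.Base using (Maybe; just; nothing)
  open import Data.List.Membership.Propositional using (find)
  open import Data.List.Membership.Propositional.Properties using (∈-cartesianProduct⁺; ∈-upTo⁺)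
  open import Relation.Nullary.Decidable using (_→-dec_)
  open import Data.Nat.Tactic.RingSolver using (solve-∀)
  open FiniteSums

  module Auction
    {A B E : Set} (_≟A_ : DecidableEquality A) (_≟B_ : DecidableEquality B)
    {as : List A} {bs : List B} (as! : Unique as) (bs! : Unique bs)
    (k : ℕ) (cap : A → ℕ) (ops : E → List (A × B)) (holder₀ : B → A)
    (ops-in : ∀ e {a b} → (a , b) ∈ ops e → a ∈ as × b ∈ bs)
    where

    module UA = Update _≟A_
    module UB = Update _≟B_

    -- Every slot is worth 1 to every bidder, and levels and prices count multiples of 1/k: a slot
    -- available to a costs at least level a, the holder of b pays price b, and a retires at level k.
    -- The quota is what a bidder may still buy in the current round.
    record State : Set where
      constructor mkState
      field
        quota level : A → ℕ
        price       : B → ℕ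
        holder      : B → A

    open State public

    holds? : ∀ σ a b → Dec (0 < price σ b × holder σ b ≡ a)
    holds? σ a b = (0 <? price σ b) ×-dec (holder σ b ≟A a)

    held : State → A → ℕ
    held σ a = ∑[ b ∈ bs ] [ holds? σ a b ]?

    sold : State → ℕ
    sold σ = ∑[ b ∈ bs ] [ 0 <? price σ b ]?

    Active : State → A × B → Set
    Active σ (a , b) = 0 < quota σ a × price σ b ≤ level σ a

    active? : ∀ σ ab → Dec (Active σ ab)
    active? σ (a , b) = (0 <? quota σ a) ×-dec (price σ b ≤? level σ a)

    -- The price jumps just past the level of the new holder instead of rising by one, so a bidder
    -- takes a given slot at most once per level. The former holder gets its quota back only when
    -- the round ends.
    push : State → A × B → State
    push σ (a , b) = mkState
      (UA.update a (pred (quota σ a)) (quota σ)) (level σ)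
      (UB.update b (suc (level σ a)) (price σ)) (UB.update b a (holder σ))

    fire : State → A × B → State
    fire σ ab with active? σ ab
    ... | yes _ = push σ ab
    ... | no  _ = σ

    step : State → E → State
    step σ e = foldl fire σ (ops e)

    refill : ℕ → ℕ → ℕ
    refill l r with l <? k
    ... | yes _ = r
    ... | no  _ = 0

    -- Quota left over means that every slot proposed to the bidder in this round now costs more
    -- than its level, so raising the level by one preserves `Stable`.
    endRound : State → State
    endRound σ = record σ { quota = quota′ ; level = level′ }
      where
      level′ : A → ℕ
      level′ a = [ 0 <? quota σ a ]? + level σ a
      quota′ : A → ℕ
      quota′ a = refill (level′ a) (cap a ∸ held σ a)

    start : State
    start = mkState (λ a → refill 0 (cap a)) (λ _ → 0) (λ _ → 0) holder₀

    fire-elim : ∀ (P : State → Set) σ ab → P σ → (Active σ ab → P (push σ ab)) → P (fire σ ab)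
    fire-elim P σ ab pσ ppush with active? σ ab
    ... | yes act = ppush act
    ... | no  _   = pσ

    infix 4 _⊑_
    -- The order in which states evolve within a round. `potential` records that every unit of quota
    -- spent raises the prices by at least one.
    record _⊑_ (σ τ : State) : Set where
      field
        quota≥    : ∀ a → quota τ a ≤ quota σ a
        level≡    : ∀ a → level τ a ≡ level σ a
        price≤    : ∀ b → price σ b ≤ price τ b
        potential : ∑ as (quota σ) + ∑ bs (price σ) ≤ ∑ as (quota τ) + ∑ bs (price τ)

    open _⊑_ public

    ⊑-refl : ∀ {σ} → σ ⊑ σ
    ⊑-refl = record { quota≥ = λ _ → ≤-refl ; level≡ = λ _ → refl ; price≤ = λ _ → ≤-refl ; potential = ≤-refl }

    ⊑-trans : ∀ {σ τ υ} → σ ⊑ τ → τ ⊑ υ → σ ⊑ υ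
    ⊑-trans p q = record
      { quota≥ = λ a → ≤-trans (quota≥ q a) (quota≥ p a)
      ; level≡ = λ a → trans (level≡ q a) (level≡ p a)
      ; price≤ = λ b → ≤-trans (price≤ p b) (price≤ q b)
      ; potential = ≤-trans (potential p) (potential q) }

    push-⊑ : ∀ σ {a b} → a ∈ as → b ∈ bs → Active σ (a , b) → σ ⊑ push σ (a , b)
    push-⊑ σ {a} {b} a∈ b∈ (0<q , p≤l) = record
      { quota≥ = quota≥′ ; level≡ = λ _ → refl ; price≤ = price≤′ ; potential = potential′ }
      where
      τ = push σ (a , b)
      quota≥′ : ∀ a′ → quota τ a′ ≤ quota σ a′
      quota≥′ a′ with a′ ≟A a
      ... | yes refl = pred[n]≤n
      ... | no _ = ≤-refl
      price≤′ : ∀ b′ → price σ b′ ≤ price τ b′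
      price≤′ b′ with b′ ≟B b
      ... | yes refl = m≤n⇒m≤1+n p≤l
      ... | no _ = ≤-refl
      quotas : ∑ as (quota τ) + 1 ≡ ∑ as (quota σ)
      quotas = +-cancelʳ-≡ (pred (quota σ a)) _ _ (begin
        ∑ as (quota τ) + 1 + pred (quota σ a) ≡⟨ +-assoc (∑ as (quota τ)) 1 _ ⟩
        ∑ as (quota τ) + suc (pred (quota σ a))
          ≡⟨ cong (∑ as (quota τ) +_) (suc-pred (quota σ a) {{>-nonZero 0<q}}) ⟩
        ∑ as (quota τ) + quota σ a ≡⟨ UA.∑-update as! a∈ ⟩
        ∑ as (quota σ) + pred (quota σ a) ∎)
        where open ≡-Reasoning
      prices : ∑ bs (price σ) + 1 ≤ ∑ bs (price τ)
      prices = +-cancelʳ-≤ (price σ b) _ _ (begin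
        ∑ bs (price σ) + 1 + price σ b ≡⟨ +-assoc (∑ bs (price σ)) 1 _ ⟩
        ∑ bs (price σ) + suc (price σ b) ≤⟨ +-monoʳ-≤ (∑ bs (price σ)) (s≤s p≤l) ⟩
        ∑ bs (price σ) + suc (level σ a) ≡⟨ UB.∑-update bs! b∈ ⟨
        ∑ bs (price τ) + price σ b ∎)
        where open ≤-Reasoning
      potential′ : ∑ as (quota σ) + ∑ bs (price σ) ≤ ∑ as (quota τ) + ∑ bs (price τ)
      potential′ = begin
        ∑ as (quota σ) + ∑ bs (price σ) ≡⟨ cong (_+ ∑ bs (price σ)) quotas ⟨
        ∑ as (quota τ) + 1 + ∑ bs (price σ) ≡⟨ rearrange (∑ as (quota τ)) (∑ bs (price σ)) ⟩
        ∑ as (quota τ) + (∑ bs (price σ) + 1) ≤⟨ +-monoʳ-≤ (∑ as (quota τ)) prices ⟩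
        ∑ as (quota τ) + ∑ bs (price τ) ∎
        where
        open ≤-Reasoning
        rearrange : ∀ x y → x + 1 + y ≡ x + (y + 1)
        rearrange = solve-∀

    Valid : List (A × B) → Set
    Valid l = ∀ {a b} → (a , b) ∈ l → a ∈ as × b ∈ bs

    fire-⊑ : ∀ σ {a b} → a ∈ as → b ∈ bs → σ ⊑ fire σ (a , b)
    fire-⊑ σ a∈ b∈ = fire-elim (σ ⊑_) σ _ ⊑-refl (push-⊑ σ a∈ b∈)

    fires-⊑ : ∀ σ l → Valid l → σ ⊑ foldl fire σ l
    fires-⊑ σ [] v = ⊑-refl
    fires-⊑ σ (_ ∷ l) v =
      ⊑-trans (fire-⊑ σ (proj₁ (v (here refl))) (proj₂ (v (here refl)))) (fires-⊑ _ l (v ∘ there))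

    step-⊑ : ∀ σ e → σ ⊑ step σ e
    step-⊑ σ e = fires-⊑ σ (ops e) (ops-in e)

    steps-⊑ : ∀ σ G → σ ⊑ foldl step σ G
    steps-⊑ σ [] = ⊑-refl
    steps-⊑ σ (e ∷ G) = ⊑-trans (step-⊑ σ e) (steps-⊑ _ G)

    -- `price≤level` is an inequality because a holder may rise in level after its purchase.
    -- Together with the dual value `k ∸ level` it bounds what a sold slot contributes in
    -- `held-value`.
    record Inv (σ : State) : Set where
      field
        held≤cap    : ∀ a → held σ a + quota σ a ≤ cap a
        quota⇒level : ∀ a → 0 < quota σ a → level σ a < k
        level≤k     : ∀ a → level σ a ≤ k
        price≤k     : ∀ b → price σ b ≤ k
        price≤level : ∀ b → 0 < price σ b → price σ b ≤ suc (level σ (holder σ b))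

    open Inv public

    inv-push : ∀ σ {a b} → b ∈ bs → Active σ (a , b) → Inv σ → Inv (push σ (a , b))
    inv-push σ {a} {b} b∈ (0<q , p≤l) inv = record
      { held≤cap = heldcap ; quota⇒level = quotalevel ; level≤k = level≤k inv
      ; price≤k = pk ; price≤level = pl }
      where
      τ = push σ (a , b)
      l<k : level σ a < k
      l<k = quota⇒level inv a 0<q
      holds-τ : ∀ a′ b′ → [ holds? τ a′ b′ ]? ≡ UB.update b [ a ≟A a′ ]? (λ b″ → [ holds? σ a′ b″ ]?) b′
      holds-τ a′ b′ with b′ ≟B b
      holds-τ a′ b′ | no _ = refl
      holds-τ a′ b′ | yes refl with a ≟A a′
      ... | yes _ = refl
      ... | no _ = refl
      held-τ : ∀ a′ → held τ a′ ≤ held σ a′ + [ a ≟A a′ ]?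
      held-τ a′ = begin
        held τ a′ ≡⟨ ∑-cong bs (λ {b′} _ → holds-τ a′ b′) ⟩
        ∑ bs (UB.update b [ a ≟A a′ ]? (λ b″ → [ holds? σ a′ b″ ]?)) ≤⟨ m≤m+n _ [ holds? σ a′ b ]? ⟩
        ∑ bs (UB.update b [ a ≟A a′ ]? (λ b″ → [ holds? σ a′ b″ ]?)) + [ holds? σ a′ b ]?
          ≡⟨ UB.∑-update bs! b∈ ⟩
        held σ a′ + [ a ≟A a′ ]? ∎
        where open ≤-Reasoning
      quota-τ : ∀ a′ → [ a ≟A a′ ]? + quota τ a′ ≤ quota σ a′
      quota-τ a′ with a ≟A a′ | a′ ≟A a
      ... | yes refl | yes _ = ≤-reflexive (suc-pred (quota σ a) {{>-nonZero 0<q}})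
      ... | yes refl | no ¬p = contradiction refl ¬p
      ... | no ¬p | yes refl = contradiction refl ¬p
      ... | no _ | no _ = ≤-refl
      heldcap : ∀ a′ → held τ a′ + quota τ a′ ≤ cap a′
      heldcap a′ = begin
        held τ a′ + quota τ a′ ≤⟨ +-monoˡ-≤ _ (held-τ a′) ⟩
        held σ a′ + [ a ≟A a′ ]? + quota τ a′ ≡⟨ +-assoc (held σ a′) _ _ ⟩
        held σ a′ + ([ a ≟A a′ ]? + quota τ a′) ≤⟨ +-monoʳ-≤ (held σ a′) (quota-τ a′) ⟩
        held σ a′ + quota σ a′ ≤⟨ held≤cap inv a′ ⟩
        cap a′ ∎
        where open ≤-Reasoning
      quotalevel : ∀ a′ → 0 < quota τ a′ → level σ a′ < k
      quotalevel a′ 0<q′ with a′ ≟A a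
      ... | yes refl = l<k
      ... | no _ = quota⇒level inv a′ 0<q′
      pk : ∀ b′ → price τ b′ ≤ k
      pk b′ with b′ ≟B b
      ... | yes _ = l<k
      ... | no _ = price≤k inv b′
      pl : ∀ b′ → 0 < price τ b′ → price τ b′ ≤ suc (level σ (holder τ b′))
      pl b′ h with b′ ≟B b
      ... | yes _ = ≤-refl
      ... | no _ = price≤level inv b′ h

    inv-fires : ∀ σ l → Valid l → Inv σ → Inv (foldl fire σ l)
    inv-fires σ [] v inv = inv
    inv-fires σ (ab ∷ l) v inv =
      inv-fires _ l (v ∘ there) (fire-elim Inv σ ab inv λ act → inv-push σ (proj₂ (v (here refl))) act inv)

    inv-step : ∀ σ e → Inv σ → Inv (step σ e)
    inv-step σ e = inv-fires σ (ops e) (ops-in e)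

    inv-steps : ∀ σ G → Inv σ → Inv (foldl step σ G)
    inv-steps σ [] inv = inv
    inv-steps σ (e ∷ G) inv = inv-steps _ G (inv-step σ e inv)

    refill≤ : ∀ l r → refill l r ≤ r
    refill≤ l r with l <? k
    ... | yes _ = ≤-refl
    ... | no _ = z≤n

    refill>0 : ∀ l r → 0 < refill l r → l < k
    refill>0 l r h with l <? k
    ... | yes l<k = l<k

    refill-< : ∀ {l} r → l < k → refill l r ≡ r
    refill-< {l} r l<k with l <? k
    ... | yes _ = refl
    ... | no ¬p = contradiction l<k ¬p

    level-endRound≤ : ∀ σ a → Inv σ → level (endRound σ) a ≤ k
    level-endRound≤ σ a inv with 0 <? quota σ a
    ... | yes 0<q = quota⇒level inv a 0<q
    ... | no  _   = level≤k inv a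

    inv-endRound : ∀ σ → Inv σ → Inv (endRound σ)
    inv-endRound σ inv = record
      { held≤cap = λ a → ≤-trans (+-monoʳ-≤ (held σ a) (refill≤ (level (endRound σ) a) _))
          (≤-reflexive (m+[n∸m]≡n (≤-trans (m≤m+n (held σ a) _) (held≤cap inv a))))
      ; quota⇒level = λ a → refill>0 (level (endRound σ) a) (cap a ∸ held σ a)
      ; level≤k = λ a → level-endRound≤ σ a inv
      ; price≤k = price≤k inv
      ; price≤level = λ b h → ≤-trans (price≤level inv b h) (s≤s (m≤n+m _ _)) }

    held-start : ∀ a → held start a ≡ 0
    held-start a = trans (∑-cong bs (λ {b} _ → []?-false (holds? start a b) λ ())) (∑-0 bs)

    inv-start : Inv start
    inv-start = record
      { held≤cap = λ a → subst (λ h → h + quota start a ≤ cap a) (sym (held-start a)) (refill≤ 0 (cap a))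
      ; quota⇒level = λ a → refill>0 0 (cap a)
      ; level≤k = λ _ → z≤n
      ; price≤k = λ _ → z≤n
      ; price≤level = λ _ () }

    -- The converse of `held≤cap`. It holds when a round begins and may fail later, since a bidder
    -- that loses a slot regains quota only in the next round.
    Fresh : State → Set
    Fresh σ = ∀ a → level σ a < k → cap a ≤ held σ a + quota σ a

    fresh-start : Fresh start
    fresh-start a 0<k = ≤-trans (≤-reflexive (sym (refill-< (cap a) 0<k))) (m≤n+m _ (held start a))

    fresh-endRound : ∀ σ → Fresh (endRound σ)
    fresh-endRound σ a l<k = ≤-trans (m≤n+m∸n (cap a) (held σ a))
      (+-monoʳ-≤ (held σ a) (≤-reflexive (sym (refill-< _ l<k))))

    -- The failure of `Active`, written so that its persistence during a round is visible: quotas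
    -- only fall, prices only rise, levels stay.
    Settled : State → A × B → Set
    Settled σ (a , b) = quota σ a ≡ 0 ⊎ level σ a < price σ b

    settled-⊑ : ∀ {σ τ} → σ ⊑ τ → ∀ {ab} → Settled σ ab → Settled τ ab
    settled-⊑ le {a , b} (inj₁ q≡0) = inj₁ (n≤0⇒n≡0 (≤-trans (quota≥ le a) (≤-reflexive q≡0)))
    settled-⊑ le {a , b} (inj₂ l<p) =
      inj₂ (≤-trans (s≤s (≤-reflexive (level≡ le a))) (≤-trans l<p (price≤ le b)))

    settled-fire : ∀ σ ab → Settled (fire σ ab) ab
    settled-fire σ (a , b) with active? σ (a , b)
    ... | yes _ = inj₂ (≤-reflexive (sym (UB.update-≡ b {f = price σ})))
    ... | no ¬act with quota σ a in eq
    ...   | zero = inj₁ refl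
    ...   | suc q = inj₂ (≰⇒> λ p≤l → ¬act (s≤s z≤n , p≤l))

    settled-fires : ∀ σ l → Valid l → ∀ {ab} → ab ∈ l → Settled (foldl fire σ l) ab
    settled-fires σ (ab ∷ l) v (here refl) = settled-⊑ (fires-⊑ _ l (v ∘ there)) (settled-fire σ ab)
    settled-fires σ (_ ∷ l) v (there ab∈) = settled-fires _ l (v ∘ there) ab∈

    settled-steps : ∀ σ G {e} → e ∈ G → ∀ {ab} → ab ∈ ops e → Settled (foldl step σ G) ab
    settled-steps σ (e ∷ G) (here refl) ab∈ =
      settled-⊑ (steps-⊑ _ G) (settled-fires σ (ops e) (ops-in e) ab∈)
    settled-steps σ (_ ∷ G) (there e∈) ab∈ = settled-steps _ G e∈ ab∈

    round : List E → State → State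
    round G σ = endRound (foldl step σ G)

    -- Feasibility of the dual solution: along every proposal, `k ∸ level` and `price` add up to at
    -- least `k`.
    Stable : List E → State → Set
    Stable G σ = ∀ {e} → e ∈ G → ∀ {a b} → (a , b) ∈ ops e → level σ a ≤ price σ b

    stable-round : ∀ G σ → Stable G σ → Stable G (round G σ)
    stable-round G σ st e∈ {a} {b} ab∈ with steps-⊑ σ G | settled-steps σ G e∈ ab∈
    ... | le | s with 0 <? quota (foldl step σ G) a
    ...   | no _ = ≤-trans (≤-reflexive (level≡ le a)) (≤-trans (st e∈ ab∈) (price≤ le b))
    stable-round G σ st e∈ {a} {b} ab∈ | le | inj₁ q≡0 | yes 0<q = contradiction (subst (0 <_) q≡0 0<q) λ ()
    stable-round G σ st e∈ {a} {b} ab∈ | le | inj₂ l<p | yes _ = l<p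

    sold-round : ∀ G σ → sold σ ≤ sold (round G σ)
    sold-round G σ = ∑-mono bs λ {b} _ →
      []?-mono (0 <? price σ b) (0 <? price (foldl step σ G) b) λ h → ≤-trans h (price≤ (steps-⊑ σ G) b)

    -- `demand` is the amount each bidder gets in the assignment the auction is compared with.
    module Compare (demand : A → ℕ) (demand≤cap : ∀ a → demand a ≤ cap a) where

      Φ : State → ℕ
      Φ σ = (∑[ a ∈ as ] demand a * level σ a) + ∑ bs (price σ)

      unmet : State → ℕ
      unmet σ = ∑[ a ∈ as ] (quota σ a ⊓ demand a)

      -- A bidder that spends its whole quota turns each unit of it into a rise of prices; one that
      -- keeps some gains a level, worth `demand a` in `Φ`. Either gain is at least the minimum of
      -- quota and demand.
      unmet-round : ∀ G σ → unmet σ + Φ σ ≤ Φ (round G σ)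
      unmet-round G σ = +-cancelʳ-≤ Q′ _ _ (begin
        unmet σ + (L + ∑ bs (price σ)) + Q′ ≡⟨ rearrange₁ (unmet σ) L (∑ bs (price σ)) Q′ ⟩
        (unmet σ + L + Q′) + ∑ bs (price σ) ≤⟨ +-monoˡ-≤ _ summed ⟩
        (L′ + Q) + ∑ bs (price σ) ≡⟨ +-assoc L′ Q _ ⟩
        L′ + (Q + ∑ bs (price σ)) ≤⟨ +-monoʳ-≤ L′ (potential le) ⟩
        L′ + (Q′ + ∑ bs (price τ)) ≡⟨ rearrange₂ L′ Q′ _ ⟩
        L′ + ∑ bs (price τ) + Q′ ∎)
        where
        open ≤-Reasoning
        τ = foldl step σ G
        le = steps-⊑ σ G
        Q = ∑ as (quota σ)
        Q′ = ∑ as (quota τ)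
        L = ∑[ a ∈ as ] demand a * level σ a
        L′ = ∑[ a ∈ as ] demand a * level (endRound τ) a
        rearrange₁ : ∀ x y z w → x + (y + z) + w ≡ (x + y + w) + z
        rearrange₁ = solve-∀
        rearrange₂ : ∀ x y z → x + (y + z) ≡ x + z + y
        rearrange₂ = solve-∀
        rearrange₃ : ∀ f l q → f + f * l + q ≡ f * (1 + l) + q
        rearrange₃ = solve-∀
        pointwise : ∀ a → quota σ a ⊓ demand a + demand a * level σ a + quota τ a
                        ≤ demand a * level (endRound τ) a + quota σ a
        pointwise a with 0 <? quota τ a
        ... | yes _ = begin
          quota σ a ⊓ demand a + demand a * level σ a + quota τ a
            ≤⟨ +-mono-≤ (+-monoˡ-≤ _ (m⊓n≤n (quota σ a) (demand a))) (quota≥ le a) ⟩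
          demand a + demand a * level σ a + quota σ a ≡⟨ rearrange₃ (demand a) (level σ a) (quota σ a) ⟩
          demand a * (1 + level σ a) + quota σ a
            ≡⟨ cong (λ l → demand a * (1 + l) + quota σ a) (level≡ le a) ⟨
          demand a * (1 + level τ a) + quota σ a ∎
        ... | no 0≮q = begin
          quota σ a ⊓ demand a + demand a * level σ a + quota τ a
            ≤⟨ +-mono-≤ (+-monoˡ-≤ _ (m⊓n≤m (quota σ a) (demand a))) (≮⇒≥ 0≮q) ⟩
          quota σ a + demand a * level σ a + 0 ≡⟨ +-identityʳ _ ⟩
          quota σ a + demand a * level σ a ≡⟨ +-comm (quota σ a) _ ⟩
          demand a * level σ a + quota σ a ≡⟨ cong (λ l → demand a * l + quota σ a) (level≡ le a) ⟨
          demand a * level τ a + quota σ a ∎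
        summed : unmet σ + L + Q′ ≤ L′ + Q
        summed = begin
          unmet σ + L + Q′ ≡⟨ cong (_+ Q′) (∑-+ as _ _) ⟨
          (∑[ a ∈ as ] (quota σ a ⊓ demand a + demand a * level σ a)) + Q′ ≡⟨ ∑-+ as _ _ ⟨
          (∑[ a ∈ as ] (quota σ a ⊓ demand a + demand a * level σ a + quota τ a))
            ≤⟨ ∑-mono as (λ {a} _ → pointwise a) ⟩
          (∑[ a ∈ as ] (demand a * level (endRound τ) a + quota σ a)) ≡⟨ ∑-+ as _ _ ⟩
          L′ + Q ∎

      -- Counted slot by slot: the holder at level `l` contributes `k ∸ l` and the price at most
      -- `suc l`. The unit by which a price may exceed the level turns `k` into `suc k`.
      held-value : ∀ σ → Inv σ → (∑[ a ∈ as ] held σ a * (k ∸ level σ a)) + ∑ bs (price σ) ≤ suc k * sold σ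
      held-value σ inv = begin
        (∑[ a ∈ as ] held σ a * (k ∸ level σ a)) + ∑ bs (price σ)
          ≡⟨ cong (_+ ∑ bs (price σ)) (∑-cong as λ {a} _ → sym (∑-*ʳ (k ∸ level σ a) bs _)) ⟩
        (∑[ a ∈ as ] ∑[ b ∈ bs ] [ holds? σ a b ]? * (k ∸ level σ a)) + ∑ bs (price σ)
          ≡⟨ cong (_+ ∑ bs (price σ)) (∑-swap as bs _) ⟩
        (∑[ b ∈ bs ] ∑[ a ∈ as ] [ holds? σ a b ]? * (k ∸ level σ a)) + ∑ bs (price σ) ≡⟨ ∑-+ bs _ _ ⟨
        (∑[ b ∈ bs ] ((∑[ a ∈ as ] [ holds? σ a b ]? * (k ∸ level σ a)) + price σ b))
          ≤⟨ ∑-mono bs (λ {b} _ → slot b) ⟩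
        (∑[ b ∈ bs ] suc k * [ 0 <? price σ b ]?) ≡⟨ ∑-*ˡ (suc k) bs _ ⟩
        suc k * sold σ ∎
        where
        open ≤-Reasoning
        slot : ∀ b →
          (∑[ a ∈ as ] [ holds? σ a b ]? * (k ∸ level σ a)) + price σ b ≤ suc k * [ 0 <? price σ b ]?
        slot b with 0 <? price σ b
        ... | no 0≮p = begin
          (∑[ a ∈ as ] 0) + price σ b ≡⟨ cong₂ _+_ (∑-0 as) (n≤0⇒n≡0 (≮⇒≥ 0≮p)) ⟩
          0 ≤⟨ z≤n ⟩
          suc k * 0 ∎
        ... | yes 0<p = begin
          (∑[ a ∈ as ] [ yes 0<p ×-dec (holder σ b ≟A a) ]? * (k ∸ level σ a)) + price σ b
            ≡⟨ cong (_+ price σ b)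
              (∑-cong as λ {a} _ → cong (_* (k ∸ level σ a)) (drop-yes (holder σ b ≟A a))) ⟩
          (∑[ a ∈ as ] [ holder σ b ≟A a ]? * (k ∸ level σ a)) + price σ b
            ≤⟨ +-mono-≤ (UA.∑-indicator-≤ as! (holder σ b) (λ a → k ∸ level σ a)) (price≤level inv b 0<p) ⟩
          k ∸ l + suc l ≡⟨ +-suc (k ∸ l) l ⟩
          suc (k ∸ l + l) ≡⟨ cong suc (m∸n+n≡m (level≤k inv (holder σ b))) ⟩
          suc k ≡⟨ *-identityʳ (suc k) ⟨
          suc k * 1 ∎
          where
          l = level σ (holder σ b)
          drop-yes : ∀ {P : Set} (P? : Dec P) → [ yes 0<p ×-dec P? ]? ≡ [ P? ]?
          drop-yes (yes _) = refl
          drop-yes (no _) = refl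

      F* : ℕ
      F* = ∑ as demand

      -- Approximate LP duality, with the duals k ∸ level and price.
      duality : ∀ σ → Inv σ → Fresh σ → (∑[ a ∈ as ] demand a * level σ a) ≤ ∑ bs (price σ) →
                k * F* ≤ suc k * sold σ + k * unmet σ
      duality σ inv fresh cover = begin
        k * F* ≡⟨ ∑-*ˡ k as demand ⟨
        (∑[ a ∈ as ] k * demand a) ≡⟨ ∑-cong as (λ {a} _ → split a) ⟩
        (∑[ a ∈ as ] (demand a * (k ∸ level σ a) + demand a * level σ a)) ≡⟨ ∑-+ as _ _ ⟩
        (∑[ a ∈ as ] demand a * (k ∸ level σ a)) + (∑[ a ∈ as ] demand a * level σ a)
          ≤⟨ +-mono-≤ (∑-mono as (λ {a} _ → bidder a)) cover ⟩
        (∑[ a ∈ as ] (held σ a * (k ∸ level σ a) + k * (quota σ a ⊓ demand a))) + ∑ bs (price σ)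
          ≡⟨ cong (_+ ∑ bs (price σ)) (trans (∑-+ as _ _) (cong (H +_) (∑-*ˡ k as _))) ⟩
        H + k * unmet σ + ∑ bs (price σ) ≡⟨ rearrange H (k * unmet σ) _ ⟩
        H + ∑ bs (price σ) + k * unmet σ ≤⟨ +-monoˡ-≤ _ (held-value σ inv) ⟩
        suc k * sold σ + k * unmet σ ∎
        where
        open ≤-Reasoning
        H = ∑[ a ∈ as ] held σ a * (k ∸ level σ a)
        rearrange : ∀ x y z → x + y + z ≡ x + z + y
        rearrange = solve-∀
        split : ∀ a → k * demand a ≡ demand a * (k ∸ level σ a) + demand a * level σ a
        split a =
          trans (*-comm k _) (trans (cong (demand a *_) (sym (m∸n+n≡m (level≤k inv a))))
            (*-distribˡ-+ (demand a) _ _))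
        bidder : ∀ a → demand a * (k ∸ level σ a) ≤ held σ a * (k ∸ level σ a) + k * (quota σ a ⊓ demand a)
        bidder a with level σ a <? k
        ... | no l≮k rewrite m≤n⇒m∸n≡0 (≮⇒≥ l≮k) | *-zeroʳ (demand a) = z≤n
        ... | yes l<k = begin
          demand a * (k ∸ level σ a) ≤⟨ *-monoˡ-≤ (k ∸ level σ a) f≤ ⟩
          (held σ a + (quota σ a ⊓ demand a)) * (k ∸ level σ a)
            ≡⟨ *-distribʳ-+ (k ∸ level σ a) (held σ a) _ ⟩
          held σ a * (k ∸ level σ a) + (quota σ a ⊓ demand a) * (k ∸ level σ a)
            ≤⟨ +-monoʳ-≤ (held σ a * (k ∸ level σ a))
              (*-monoʳ-≤ (quota σ a ⊓ demand a) (m∸n≤m k (level σ a))) ⟩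
          held σ a * (k ∸ level σ a) + (quota σ a ⊓ demand a) * k
            ≡⟨ cong (held σ a * (k ∸ level σ a) +_) (*-comm _ k) ⟩
          held σ a * (k ∸ level σ a) + k * (quota σ a ⊓ demand a) ∎
          where
          f≤ : demand a ≤ held σ a + (quota σ a ⊓ demand a)
          f≤ = ≤-trans (⊓-glb (≤-trans (demand≤cap a) (fresh a l<k)) (m≤n+m (demand a) (held σ a)))
                 (≤-reflexive (sym (+-distribˡ-⊓ (held σ a) (quota σ a) (demand a))))

      rounds : List E → ℕ → State
      rounds G i = fold start (round G) i

      module _ (G : List E)
        (cover : ∀ σ → Stable G σ → (∑[ a ∈ as ] demand a * level σ a) ≤ ∑ bs (price σ)) where

        inv-rounds : ∀ i → Inv (rounds G i)
        inv-rounds zero = inv-start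
        inv-rounds (suc i) = inv-endRound (foldl step (rounds G i) G) (inv-steps _ G (inv-rounds i))

        stable-rounds : ∀ i → Stable G (rounds G i)
        stable-rounds zero _ _ = z≤n
        stable-rounds (suc i) = stable-round G (rounds G i) (stable-rounds i)

        fresh-rounds : ∀ i → Fresh (rounds G i)
        fresh-rounds zero = fresh-start
        fresh-rounds (suc i) = fresh-endRound (foldl step (rounds G i) G)

        -- `duality` summed over the rounds. The unmet demands telescope into `Φ`, and since a sold
        -- slot stays sold, earlier counts of sold slots may be replaced by the last one.
        accumulate : ∀ i → i * (k * F*) ≤ i * (suc k * sold (rounds G i)) + k * Φ (rounds G i)
        accumulate zero = z≤n
        accumulate (suc i) = begin
          k * F* + i * (k * F*)
            ≤⟨ +-mono-≤ (duality σ (inv-rounds i) (fresh-rounds i) (cover σ (stable-rounds i)))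
              (accumulate i) ⟩
          suc k * sold σ + k * unmet σ + (i * (suc k * sold σ) + k * Φ σ)
            ≡⟨ rearrange (suc k * sold σ) k (unmet σ) _ (Φ σ) ⟩
          suc i * (suc k * sold σ) + k * (unmet σ + Φ σ)
            ≤⟨ +-mono-≤ (*-monoʳ-≤ (suc i) (*-monoʳ-≤ (suc k) (sold-round G σ)))
              (*-monoʳ-≤ k (unmet-round G σ)) ⟩
          suc i * (suc k * sold (rounds G (suc i))) + k * Φ (rounds G (suc i)) ∎
          where
          open ≤-Reasoning
          σ = rounds G i
          rearrange : ∀ s k u t p → s + k * u + (t + k * p) ≡ (s + t) + k * (u + p)
          rearrange = solve-∀

        Φ≤ : ∀ i → Φ (rounds G i) ≤ k * F* + k * sold (rounds G i)
        Φ≤ i = +-mono-≤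
          (≤-trans (∑-mono as λ {a} _ → ≤-trans (*-monoʳ-≤ (demand a) (level≤k inv a))
            (≤-reflexive (*-comm (demand a) k)))
                   (≤-reflexive (∑-*ˡ k as demand)))
          (≤-trans (∑-mono bs λ {b} _ → bound b) (≤-reflexive (∑-*ˡ k bs _)))
          where
          inv = inv-rounds i
          bound : ∀ b → price (rounds G i) b ≤ k * [ 0 <? price (rounds G i) b ]?
          bound b with 0 <? price (rounds G i) b
          ... | yes _ = ≤-trans (price≤k inv b) (≤-reflexive (sym (*-identityʳ k)))
          ... | no 0≮p = ≤-trans (≮⇒≥ 0≮p) z≤n

        -- `Φ` never exceeds `k * (F* + S)`, where `S` is the number of sold slots. Hence `k * Φ`,
        -- averaged over `k * k` rounds, costs only one additional `F* + S`: this is where the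
        -- number of passes comes from.
        auction-approximation : 0 < k → k * F* ≤ (k + 2) * sold (rounds G (k * k)) + F*
        auction-approximation 0<k =
          *-cancelˡ-≤ (k * k) {{m*n≢0 k k {{>-nonZero 0<k}} {{>-nonZero 0<k}}}} (begin
          k * k * (k * F*) ≤⟨ accumulate (k * k) ⟩
          k * k * (suc k * S) + k * Φ (rounds G (k * k))
            ≤⟨ +-monoʳ-≤ (k * k * (suc k * S)) (*-monoʳ-≤ k (Φ≤ (k * k))) ⟩
          k * k * (suc k * S) + k * (k * F* + k * S) ≡⟨ rearrange k S F* ⟩
          k * k * ((k + 2) * S + F*) ∎)
          where
          open ≤-Reasoning
          S = sold (rounds G (k * k))
          rearrange : ∀ k s f → k * k * ((1 + k) * s) + k * (k * f + k * s) ≡ k * k * ((k + 2) * s + f)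
          rearrange = solve-∀

    effective? : ∀ σ e → Dec (Any (Active σ) (ops e))
    effective? σ e = Any.any? (active? σ) (ops e)

    fires-ineffective : ∀ σ l → ¬ Any (Active σ) l → foldl fire σ l ≡ σ
    fires-ineffective σ [] _ = refl
    fires-ineffective σ (ab ∷ l) ¬act with active? σ ab
    ... | yes act = contradiction (here act) ¬act
    ... | no  _   = fires-ineffective σ l (¬act ∘ there)

    -- `nothing` marks the end of a round; the latest event comes first.
    Log : Set
    Log = List (Maybe E)

    replay : Log → State
    replay [] = start
    replay (just e ∷ L) = step (replay L) e
    replay (nothing ∷ L) = endRound (replay L)

    recordEdge : Log → E → Log
    recordEdge L e with effective? (replay L) e
    ... | yes _ = just e ∷ L
    ... | no  _ = L

    recordRound : List E → Log → Log
    recordRound G L = nothing ∷ foldl recordEdge L G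

    replay-recordEdge : ∀ L e → replay (recordEdge L e) ≡ step (replay L) e
    replay-recordEdge L e with effective? (replay L) e
    ... | yes _ = refl
    ... | no ineff = sym (fires-ineffective (replay L) (ops e) ineff)

    replay-recordEdges : ∀ L G → replay (foldl recordEdge L G) ≡ foldl step (replay L) G
    replay-recordEdges L [] = refl
    replay-recordEdges L (e ∷ G) =
      trans (replay-recordEdges (recordEdge L e) G) (cong (λ σ → foldl step σ G) (replay-recordEdge L e))

    replay-rounds : ∀ G i → replay (fold [] (recordRound G) i) ≡ fold start (round G) i
    replay-rounds G zero = refl
    replay-rounds G (suc i) =
      cong endRound (trans (replay-recordEdges _ G) (cong (λ σ → foldl step σ G) (replay-rounds G i)))

    inv-replay : ∀ L → Inv (replay L)
    inv-replay [] = inv-start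
    inv-replay (just e ∷ L) = inv-step (replay L) e (inv-replay L)
    inv-replay (nothing ∷ L) = inv-endRound (replay L) (inv-replay L)

    Sourced : (A × B → Set) → State → Set
    Sourced P σ = ∀ b → 0 < price σ b → P (holder σ b , b)

    sourced-fires : ∀ P σ l → (∀ {ab} → ab ∈ l → P ab) → Sourced P σ → Sourced P (foldl fire σ l)
    sourced-fires P σ [] _ src = src
    sourced-fires P σ ((a , b) ∷ l) pl src = sourced-fires P _ l (pl ∘ there)
      (fire-elim (Sourced P) σ (a , b) src λ _ → src-push)
      where
      src-push : Sourced P (push σ (a , b))
      src-push b′ h with b′ ≟B b
      ... | yes refl = pl (here refl)
      ... | no _ = src b′ h

    LoggedOp : Log → A × B → Set
    LoggedOp L ab = ∃ λ e → just e ∈ L × ab ∈ ops e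

    -- Every sale is accounted for by a logged edge. A dual solution that covers just the logged
    -- edges can therefore bound the number of sold slots.
    sourced-replay : ∀ L → Sourced (LoggedOp L) (replay L)
    sourced-replay [] b ()
    sourced-replay (just e ∷ L) = sourced-fires (LoggedOp (just e ∷ L)) (replay L) (ops e)
      (λ ab∈ → e , here refl , ab∈)
      (λ b h → let (e′ , e′∈ , ab∈) = sourced-replay L b h in e′ , there e′∈ , ab∈)
    sourced-replay (nothing ∷ L) b h =
      let (e , e∈ , ab∈) = sourced-replay L b h in e , there e∈ , ab∈

    logged⊆ : ∀ {G : List E} L H → (∀ {e} → e ∈ H → e ∈ G) → (∀ {e} → just e ∈ L → e ∈ G) →
              ∀ {e} → just e ∈ foldl recordEdge L H → e ∈ G
    logged⊆ L [] H⊆ L⊆ = L⊆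
    logged⊆ {G} L (e ∷ H) H⊆ L⊆ = logged⊆ (recordEdge L e) H (H⊆ ∘ there) rec⊆
      where
      rec⊆ : ∀ {e′} → just e′ ∈ recordEdge L e → e′ ∈ G
      rec⊆ e′∈ with effective? (replay L) e
      rec⊆ (here refl) | yes _ = H⊆ (here refl)
      rec⊆ (there e′∈) | yes _ = L⊆ e′∈
      rec⊆ e′∈ | no _ = L⊆ e′∈

    logged⊆-rounds : ∀ G i {e} → just e ∈ fold [] (recordRound G) i → e ∈ G
    logged⊆-rounds G (suc i) (there e∈) = logged⊆ _ G (λ e∈ → e∈) (logged⊆-rounds G i) e∈

    #rounds : Log → ℕ
    #rounds [] = 0
    #rounds (just _ ∷ L) = #rounds L
    #rounds (nothing ∷ L) = suc (#rounds L)

    #rounds-recordEdge : ∀ L e → #rounds (recordEdge L e) ≡ #rounds L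
    #rounds-recordEdge L e with effective? (replay L) e
    ... | yes _ = refl
    ... | no  _ = refl

    #rounds-recordEdges : ∀ L G → #rounds (foldl recordEdge L G) ≡ #rounds L
    #rounds-recordEdges L [] = refl
    #rounds-recordEdges L (e ∷ G) = trans (#rounds-recordEdges (recordEdge L e) G) (#rounds-recordEdge L e)

    -- An effective edge either exhausts the quota of a bidder or lifts all slots of a block above
    -- some level; neither can be undone within a round, which bounds the length of the log.
    module LogLength {J : Set} (_≟J_ : DecidableEquality J) {js : List J} (block : B → J)
      (block-in : ∀ {b} → b ∈ bs → block b ∈ js)
      (ops-block : ∀ e {a b b′} → (a , b) ∈ ops e → b′ ∈ bs → block b′ ≡ block b → (a , b′) ∈ ops e)
      where

      Above : State → J × ℕ → Set
      Above σ (j , l) = All (λ b → block b ≡ j → l < price σ b) bs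

      above? : ∀ σ jl → Dec (Above σ jl)
      above? σ (j , l) = All.all? (λ b → (block b ≟J j) →-dec (l <? price σ b)) bs

      blocks : List (J × ℕ)
      blocks = cartesianProduct js (upTo k)

      exhausted : State → ℕ
      exhausted σ = ∑[ a ∈ as ] [ quota σ a ≟ 0 ]?

      lifted : State → ℕ
      lifted σ = ∑[ jl ∈ blocks ] [ above? σ jl ]?

      exhausted-mono : ∀ {σ τ} → σ ⊑ τ → ∀ a → [ quota σ a ≟ 0 ]? ≤ [ quota τ a ≟ 0 ]?
      exhausted-mono {σ} {τ} le a = []?-mono (quota σ a ≟ 0) (quota τ a ≟ 0) λ q≡0 →
        n≤0⇒n≡0 (≤-trans (quota≥ le a) (≤-reflexive q≡0))

      lifted-mono : ∀ {σ τ} → (∀ b → price σ b ≤ price τ b) → ∀ jl → [ above? σ jl ]? ≤ [ above? τ jl ]?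
      lifted-mono {σ} {τ} p≤ jl = []?-mono (above? σ jl) (above? τ jl)
        (All.map λ {b} h eq → ≤-trans (h eq) (p≤ b))

      -- By `ops-block` the bidder `a` of an active proposal proposes to all slots in the block of
      -- `b`. If it has quota left afterwards, all of them were settled by price and lie above
      -- `level σ a`, where `b` did not lie before.
      progress-step : ∀ σ e → Inv σ → Any (Active σ) (ops e) →
                      exhausted σ + lifted σ < exhausted (step σ e) + lifted (step σ e)
      progress-step σ e inv eff with find eff
      ... | (a , b) , ab∈ , (0<q , p≤l) = strict
        where
        τ = step σ e
        le = step-⊑ σ e
        a∈ = proj₁ (ops-in e ab∈)
        b∈ = proj₂ (ops-in e ab∈)
        strict : exhausted σ + lifted σ < exhausted τ + lifted τ
        strict with quota τ a ≟ 0
        ... | yes q≡0 = +-mono-<-≤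
          (∑-mono-< as (λ {a} _ → exhausted-mono le a) a∈
            (≤-reflexive (trans (cong suc ([]?-false (quota σ a ≟ 0) (>⇒≢ 0<q)))
              (sym ([]?-true (quota τ a ≟ 0) q≡0)))))
          (∑-mono blocks λ {jl} _ → lifted-mono {σ} {τ} (price≤ le) jl)
        ... | no q≢0 = +-mono-≤-<
          (∑-mono as λ {a} _ → exhausted-mono le a)
          (∑-mono-< blocks (λ {jl} _ → lifted-mono {σ} {τ} (price≤ le) jl) jl∈
            (≤-reflexive (trans (cong suc ([]?-false (above? σ jl) below))
              (sym ([]?-true (above? τ jl) above)))))
          where
          jl = block b , level σ a
          jl∈ : jl ∈ blocks
          jl∈ = ∈-cartesianProduct⁺ (block-in b∈) (∈-upTo⁺ (quota⇒level inv a 0<q))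
          below : ¬ Above σ jl
          below ab = <⇒≱ (All.lookup ab b∈ refl) p≤l
          above : Above τ jl
          above = All.tabulate λ {b′} b′∈ eq → case settled-fires σ (ops e) (ops-in e) (ops-block e ab∈ b′∈ eq) of λ
            { (inj₁ q≡0) → contradiction q≡0 q≢0
            ; (inj₂ l<p) → subst (_< price τ b′) (level≡ le a) l<p }

      exhausted≤ : ∀ σ → exhausted σ ≤ length as
      exhausted≤ σ = ≤-trans (∑-≤-const as 1 λ {a} _ → []?≤1 (quota σ a ≟ 0)) (≤-reflexive (*-identityʳ _))

      lifted≤ : ∀ σ → lifted σ ≤ length js * k
      lifted≤ σ = ≤-trans (∑-≤-const blocks 1 λ {jl} _ → []?≤1 (above? σ jl)) (≤-reflexive
        (trans (*-identityʳ _)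
          (trans (length-cartesianProduct js (upTo k)) (cong (length js *_) (length-upTo k)))))

      -- The last summand pays for finished rounds. The end of a round adds a marker and may refill
      -- every exhausted bidder, whereas `lifted` is kept because prices never fall.
      record Bounded (L : Log) : Set where
        constructor bounded
        field
          length≤ : length L ≤ exhausted (replay L) + lifted (replay L) + #rounds L * suc (length as)

      bounded-[] : Bounded []
      bounded-[] = bounded z≤n

      bounded-recordEdge : ∀ L e → Bounded L → Bounded (recordEdge L e)
      bounded-recordEdge L e (bounded le) with effective? (replay L) e
      ... | yes eff =
        bounded (≤-trans (s≤s le) (+-monoˡ-≤ _ (progress-step (replay L) e (inv-replay L) eff)))
      ... | no _ = bounded le

      bounded-nothing : ∀ L → Bounded L → Bounded (nothing ∷ L)
      bounded-nothing L (bounded le) = bounded (begin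
        suc (length L) ≤⟨ s≤s le ⟩
        suc (exhausted σ + lifted σ + R) ≤⟨ s≤s (+-monoˡ-≤ R (+-monoˡ-≤ (lifted σ) (exhausted≤ σ))) ⟩
        suc (length as + lifted σ + R) ≡⟨ rearrange (length as) (lifted σ) R ⟩
        lifted σ + (suc (length as) + R) ≤⟨ +-monoˡ-≤ _ (m≤n+m (lifted σ) _) ⟩
        exhausted (endRound σ) + lifted σ + (suc (length as) + R) ∎)
        where
        open ≤-Reasoning
        σ = replay L
        R = #rounds L * suc (length as)
        rearrange : ∀ a l r → 1 + (a + l + r) ≡ l + (1 + a + r)
        rearrange = solve-∀

      logBound : ℕ → ℕ
      logBound T = length as + length js * k + T * suc (length as)

      bounded⇒length : ∀ L T → Bounded L → #rounds L ≤ T → length L ≤ logBound T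
      bounded⇒length L T (bounded le) r≤T =
        ≤-trans le (+-mono-≤ (+-mono-≤ (exhausted≤ (replay L)) (lifted≤ (replay L)))
          (*-monoˡ-≤ (suc (length as)) r≤T))

-- Weighted matching duality with an integral dual, up to one unit per edge.

module WeightedDuality where

  open import Data.Fin.Base using (Fin)
  open import Data.Fin.Properties using (any?) renaming (_≟_ to _≟ᶠ_)
  open import Data.List.Base using (List; []; _∷_; map; filter; allFin)
  open import Data.List.Membership.Propositional using (_∈_; _∉_; find; lose)
  open import Data.List.Membership.Propositional.Properties
    using (∈-map⁺; ∈-map⁻; ∈-filter⁺; ∈-filter⁻; ∈-allFin)
  open import Data.List.Relation.Unary.All as All using (All; []; _∷_)
  import Data.List.Relation.Unary.All.Properties as All
  open import Data.List.Relation.Unary.Any as Any using (Any; here; there)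
  open import Data.List.Relation.Unary.AllPairs as AllPairs using (AllPairs; []; _∷_)
  import Data.List.Relation.Unary.AllPairs.Properties as AllPairs
  open import Data.List.Relation.Unary.Unique.Propositional.Properties using (allFin⁺)
  open import Data.Nat.Base hiding (_/_)
  open import Data.Nat.Induction using (<-wellFounded)
  open import Data.Nat.Properties
  open import Data.Product.Base using (_×_; _,_; proj₁; proj₂; ∃)
  open import Function.Base using (_∘_)
  open import Induction.WellFounded using (Acc; acc)
  open import Relation.Binary.PropositionalEquality
  open import Relation.Nullary.Decidable.Core using (Dec; yes; no; _×-dec_; ¬?)
  open import Relation.Nullary.Negation.Core using (¬_; contradiction)
  open FiniteSums

  ∈⇒≤∑ : ∀ {A : Set} {xs : List A} (f : A → ℕ) {x} → x ∈ xs → f x ≤ ∑ xs f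
  ∈⇒≤∑ f (here refl) = m≤m+n _ _
  ∈⇒≤∑ f (there x∈) = ≤-trans (∈⇒≤∑ f x∈) (m≤n+m _ _)

  module Egerváry {n : ℕ} {E : Set} (bid item : E → Fin n) (wt : E → ℕ) (es : List E) where

    module U = Update (_≟ᶠ_ {n})

    V : List (Fin n)
    V = allFin n

    Disjoint : E → E → Set
    Disjoint e f = bid e ≢ bid f × item e ≢ item f

    -- The sum is a crude bound for each single weight. It serves as the initial profit, which
    -- covers every edge, and as a ceiling for the prices in `measure`.
    maxWeight : ℕ
    maxWeight = ∑ es wt

    Covers : (x π : Fin n → ℕ) → Set
    Covers x π = ∀ {e} → e ∈ es → wt e ≤ x (bid e) + π (item e)

    -- A partial matching with dual values. Prices rise by whole units, which is why `tight` allows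
    -- an excess of one. `priced` is complementary slackness for the items; for the bidders it is
    -- reached when nobody is `Free`.
    record Auctioned (x π : Fin n → ℕ) (M : List E) : Set where
      field
        covers   : Covers x π
        tight    : ∀ {e} → e ∈ M → x (bid e) + π (item e) ≤ suc (wt e)
        sub      : ∀ {e} → e ∈ M → e ∈ es
        disjoint : AllPairs Disjoint M
        priced   : ∀ v → 0 < π v → v ∈ map item M

    open Auctioned

    measure : (x π : Fin n → ℕ) → ℕ
    measure x π = ∑ V x + (∑[ v ∈ V ] (maxWeight ∸ π v))

    Free : (x : Fin n → ℕ) → List E → Fin n → Set
    Free x M u = 0 < x u × u ∉ map bid M

    free? : ∀ x M u → Dec (Free x M u)
    free? x M u = (0 <? x u) ×-dec ¬? (Any.any? (u ≟ᶠ_) (map bid M))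

    record Result : Set where
      field
        x π   : Fin n → ℕ
        M     : List E
        state : Auctioned x π M
        done  : ∀ u → ¬ Free x M u

    ∑-update< : ∀ (f : Fin n → ℕ) u v → v < f u → ∑ V (U.update u v f) < ∑ V f
    ∑-update< f u v v<fu = +-cancelʳ-< (f u) _ _ (begin-strict
      ∑ V (U.update u v f) + f u ≡⟨ U.∑-update (allFin⁺ n) (∈-allFin u) ⟩
      ∑ V f + v <⟨ +-monoʳ-< (∑ V f) v<fu ⟩
      ∑ V f + f u ∎)
      where open ≤-Reasoning

    -- All edges at `u` have a unit to spare, and tightness concerns matched bidders only, of which
    -- `u` is none.
    lower : ∀ {x π M u} → Auctioned x π M → Free x M u →
            (∀ {e} → e ∈ es → bid e ≡ u → wt e < x u + π (item e)) →
            Auctioned (U.update u (pred (x u)) x) π M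
    lower {x} {π} {M} {u} a (0<xu , u∉) loose = record
      { covers = cov ; tight = tig ; sub = sub a ; disjoint = disjoint a ; priced = priced a }
      where
      cov : Covers (U.update u (pred (x u)) x) π
      cov {e} e∈ with bid e ≟ᶠ u
      ... | no _ = covers a e∈
      ... | yes eq = +-cancelˡ-≤ 1 _ _ (≤-trans (loose e∈ eq)
                       (≤-reflexive (cong (_+ π (item e)) (sym (suc-pred (x u) {{>-nonZero 0<xu}})))))
      tig : ∀ {e} → e ∈ M → U.update u (pred (x u)) x (bid e) + π (item e) ≤ suc (wt e)
      tig {e} e∈ with bid e ≟ᶠ u
      ... | no _ = tight a e∈
      ... | yes refl = contradiction (∈-map⁺ bid e∈) u∉

    module _ (e : E) where

      keep? : ∀ f → Dec (item f ≢ item e)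
      keep? f = ¬? (item f ≟ᶠ item e)

      assign : List E → List E
      assign M = e ∷ filter keep? M

      module _ {x π M} (a : Auctioned x π M) (free : Free x M (bid e)) (e∈ : e ∈ es)
               (bids : x (bid e) + π (item e) ≤ wt e) where

        π′ : Fin n → ℕ
        π′ = U.update (item e) (suc (π (item e))) π

        π≤π′ : ∀ v → π v ≤ π′ v
        π≤π′ v with v ≟ᶠ item e
        ... | yes refl = n≤1+n _
        ... | no _ = ≤-refl

        bid-auctioned : Auctioned x π′ (assign M)
        bid-auctioned = record
          { covers = λ {f} f∈ → ≤-trans (covers a f∈) (+-monoʳ-≤ (x (bid f)) (π≤π′ (item f)))
          ; tight = tig ; sub = sb ; disjoint = dis ∷ AllPairs.filter⁺ keep? (disjoint a) ; priced = pr }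
          where
          tig : ∀ {f} → f ∈ assign M → x (bid f) + π′ (item f) ≤ suc (wt f)
          tig (here refl) =
            ≤-trans (≤-reflexive (trans (cong (x (bid e) +_) (U.update-≡ (item e) {f = π})) (+-suc _ _)))
              (s≤s bids)
          tig {f} (there f∈) with ∈-filter⁻ keep? {xs = M} f∈
          ... | f∈M , ≢ = ≤-trans (≤-reflexive (cong (x (bid f) +_) (U.update-≢ {f = π} ≢))) (tight a f∈M)
          sb : ∀ {f} → f ∈ assign M → f ∈ es
          sb (here refl) = e∈
          sb (there f∈) = sub a (proj₁ (∈-filter⁻ keep? {xs = M} f∈))
          dis : All (Disjoint e) (filter keep? M)
          dis = All.tabulate λ {f} f∈ → let (f∈M , ≢) = ∈-filter⁻ keep? {xs = M} f∈ in
            (λ eq → proj₂ free (subst (_∈ map bid M) (sym eq) (∈-map⁺ bid f∈M))) , (≢ ∘ sym)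
          pr : ∀ v → 0 < π′ v → v ∈ map item (assign M)
          pr v h with v ≟ᶠ item e
          ... | yes refl = here refl
          ... | no v≢ with ∈-map⁻ item (priced a v h)
          ...   | f , f∈ , refl = there (∈-map⁺ item (∈-filter⁺ keep? f∈ v≢))

        bid-measure : measure x π′ < measure x π
        bid-measure =
          +-monoʳ-< (∑ V x) (∑-mono-< V (λ {v} _ → ∸-monoʳ-≤ maxWeight (π≤π′ v)) (∈-allFin (item e))
          (≤-trans (≤-reflexive (cong (λ p → suc (maxWeight ∸ p)) (U.update-≡ (item e) {f = π})))
                   (∸-monoʳ-< (n<1+n (π (item e))) π<max)))
          where
          -- The bidder still has positive profit, so the price lies strictly below the ceiling and
          -- the truncated difference in `measure` really drops.
          π<max : π (item e) < maxWeight
          π<max = ≤-trans (+-monoˡ-≤ (π (item e)) (proj₁ free)) (≤-trans bids (∈⇒≤∑ wt e∈))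

    run : ∀ x π M → Auctioned x π M → Acc _<_ (measure x π) → Result
    run x π M a (acc rs) with any? (free? x M)
    ... | no none = record { state = a ; done = λ u free → none (u , free) }
    ... | yes (u , free) with Any.any? (λ e → (bid e ≟ᶠ u) ×-dec (x u + π (item e) ≤? wt e)) es
    ...   | no none = run (U.update u (pred (x u)) x) π M
              (lower a free λ {e} e∈ eq → ≰⇒> λ le → none (lose e∈ (eq , le)))
              (rs (+-monoˡ-< _ (∑-update< x u (pred (x u))
                (≤-reflexive (suc-pred (x u) {{>-nonZero (proj₁ free)}})))))
    ...   | yes some with find some
    ...     | e , e∈ , refl , le = run x (π′ e a free e∈ le) (assign e M)
                (bid-auctioned e a free e∈ le) (rs (bid-measure e a free e∈ le))

    result : Result
    result = run (λ _ → maxWeight) (λ _ → 0) [] (record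
      { covers = λ {e} e∈ → ≤-trans (∈⇒≤∑ wt e∈) (m≤m+n maxWeight 0)
      ; tight = λ () ; sub = λ () ; disjoint = [] ; priced = λ _ () }) (<-wellFounded _)

    -- At the end every vertex with positive `x` or `π` is matched on the corresponding side. Both
    -- sums may thus be taken along `M`, where tightness bounds them edge by edge.
    approx-egerváry : ∃ λ M → ∃ λ x → ∃ λ π →
      All (_∈ es) M × AllPairs Disjoint M × Covers x π × ∑ V x + ∑ V π ≤ ∑[ e ∈ M ] suc (wt e)
    approx-egerváry = M , x , π , All.tabulate (sub state) , disjoint state , covers state , (begin
        ∑ V x + ∑ V π ≤⟨ +-mono-≤
          (U.∑-support (allFin⁺ n) x λ {u} _ 0<x → matched u 0<x)
          (U.∑-support (allFin⁺ n) π λ {v} _ → priced state v) ⟩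
        ∑ (map bid M) x + ∑ (map item M) π ≡⟨ cong₂ _+_ (∑-map bid M x) (∑-map item M π) ⟩
        ∑ M (x ∘ bid) + ∑ M (π ∘ item) ≡⟨ ∑-+ M (x ∘ bid) (π ∘ item) ⟨
        (∑[ e ∈ M ] (x (bid e) + π (item e))) ≤⟨ ∑-mono M (tight state) ⟩
        (∑[ e ∈ M ] suc (wt e)) ∎)
      where
      open Result result
      open ≤-Reasoning
      matched : ∀ u → 0 < x u → u ∈ map bid M
      matched u 0<x with Any.any? (u ≟ᶠ_) (map bid M)
      ... | yes u∈ = u∈
      ... | no u∉ = contradiction (0<x , u∉) (done u)

-- Unfolding weighted edges into heights and groups of heights.

module Unfold where

  open import Data.Fin.Base using (Fin; toℕ)
  open import Data.Fin.Properties using (toℕ<n) renaming (_≟_ to _≟ᶠ_)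
  open import Data.List.Base using (List; []; _∷_; _++_; map; filter; allFin; upTo; cartesianProduct)
  open import Data.List.Properties using (map-applyUpTo; length-upTo)
  open import Data.List.Membership.Propositional using (_∈_)
  open import Data.List.Membership.Propositional.Properties
  open import Data.List.Relation.Unary.All as All using (All; []; _∷_)
  open import Data.List.Relation.Unary.AllPairs as AllPairs using (AllPairs; []; _∷_)
  open import Data.List.Relation.Unary.Unique.Propositional using (Unique)
  open import Data.List.Relation.Unary.Unique.Propositional.Properties
    using (allFin⁺; upTo⁺; cartesianProduct⁺)
  open import Data.Maybe.Base using (just)
  open import Data.Nat.Base
  open import Data.Nat.DivMod
  open import Data.Nat.Properties
  open import Data.Product.Base using (_×_; _,_; proj₁; proj₂)
  open import Data.Product.Properties using (≡-dec)
  open import Data.Sum.Base using (_⊎_; inj₁; inj₂; [_,_]′)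
  open import Function.Base using (_∘_; id)
  open import Relation.Binary.Definitions using (DecidableEquality)
  open import Relation.Binary.PropositionalEquality
  open import Relation.Nullary.Decidable.Core using (Dec; yes; no; _×-dec_)
  open import Relation.Nullary.Negation.Core using (contradiction)
  open import Data.Nat.Tactic.RingSolver using (solve-∀)
  open FiniteSums
  open CapacitatedAuction
  open WeightedDuality using (∈⇒≤∑)

  ∑-upTo-suc : ∀ m (f : ℕ → ℕ) → ∑ (upTo (suc m)) f ≡ f 0 + ∑ (upTo m) (f ∘ suc)
  ∑-upTo-suc m f =
    cong (f 0 +_) (trans (cong (λ l → ∑ l f) (sym (map-applyUpTo id suc m))) (∑-map suc (upTo m) f))

  ∑-upTo-reverse : ∀ m (f : ℕ → ℕ) → (∑[ s ∈ upTo m ] f (m ∸ suc s)) ≡ ∑ (upTo m) f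
  ∑-upTo-reverse m f = trans (reversed m f) (sym (forward m f))
    where
    fromLast : ℕ → (ℕ → ℕ) → ℕ
    fromLast zero f = 0
    fromLast (suc m) f = f m + fromLast m f
    reversed : ∀ m f → (∑[ s ∈ upTo m ] f (m ∸ suc s)) ≡ fromLast m f
    reversed zero f = refl
    reversed (suc m) f = trans (∑-upTo-suc m (λ s → f (m ∸ s))) (cong (f m +_) (reversed m f))
    shift : ∀ m f → f 0 + fromLast m (f ∘ suc) ≡ fromLast (suc m) f
    shift zero f = refl
    shift (suc m) f = trans (swap (f 0) (f (suc m)) _) (cong (f (suc m) +_) (shift m f))
      where
      swap : ∀ a b c → a + (b + c) ≡ b + (a + c)
      swap = solve-∀
    forward : ∀ m f → ∑ (upTo m) f ≡ fromLast m f
    forward zero f = refl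
    forward (suc m) f = trans (∑-upTo-suc m f) (trans (cong (f 0 +_) (forward m (f ∘ suc))) (shift m f))

  ∑-upTo-mono : ∀ {m l} (f : ℕ → ℕ) → m ≤ l → ∑ (upTo m) f ≤ ∑ (upTo l) f
  ∑-upTo-mono f z≤n = z≤n
  ∑-upTo-mono {suc m} {suc l} f (s≤s m≤l) = begin
    ∑ (upTo (suc m)) f ≡⟨ ∑-upTo-suc m f ⟩
    f 0 + ∑ (upTo m) (f ∘ suc) ≤⟨ +-monoʳ-≤ (f 0) (∑-upTo-mono (f ∘ suc) m≤l) ⟩
    f 0 + ∑ (upTo l) (f ∘ suc) ≡⟨ ∑-upTo-suc l f ⟨
    ∑ (upTo (suc l)) f ∎
    where open ≤-Reasoning

  ∑-upTo-count : ∀ H N {P : ℕ → Set} (P? : ∀ t → Dec (P t)) → (∀ t → P t → t < N) →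
    (∑[ t ∈ upTo H ] [ P? t ]?) ≤ N
  ∑-upTo-count zero N P? h = z≤n
  ∑-upTo-count (suc H) zero P? h =
    ≤-trans (∑-mono (upTo (suc H)) λ {t} _ → ≤-reflexive
      ([]?-false (P? t) λ p → contradiction (h t p) λ ()))
    (≤-reflexive (∑-0 (upTo (suc H))))
  ∑-upTo-count (suc H) (suc N) P? h = ≤-trans (≤-reflexive (∑-upTo-suc H _))
    (+-mono-≤ ([]?≤1 (P? 0)) (∑-upTo-count H N (P? ∘ suc) λ t p → s<s⁻¹ (h (suc t) p)))

  module Grouping (k : ℕ) {{_ : NonZero k}} where

    -- Group `i` runs from `bnd i` to just below `bnd (suc i)`. Its size is 1 plus a 1/`k` fraction
    -- of its lower end: singletons at first, then growth at a rate of about 1 + 1/`k`.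
    bnd : ℕ → ℕ
    bnd zero    = 0
    bnd (suc i) = suc (bnd i + bnd i / k)

    grp : ℕ → ℕ
    grp zero = 0
    grp (suc s) with bnd (suc (grp s)) ≤? suc s
    ... | yes _ = suc (grp s)
    ... | no  _ = grp s

    bnd<bnd-suc : ∀ i → bnd i < bnd (suc i)
    bnd<bnd-suc i = s≤s (m≤m+n (bnd i) (bnd i / k))

    bnd-grp : ∀ s → bnd (grp s) ≤ s × s < bnd (suc (grp s))
    bnd-grp zero = z≤n , bnd<bnd-suc 0
    bnd-grp (suc s) with bnd (suc (grp s)) ≤? suc s | bnd-grp s
    ... | yes le | _ , lt = le , ≤-<-trans lt (bnd<bnd-suc (suc (grp s)))
    ... | no nle | le , _ = m≤n⇒m≤1+n le , ≰⇒> nle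

    bnd-mono : ∀ {i j} → i ≤ j → bnd i ≤ bnd j
    bnd-mono {i} {zero} z≤n = z≤n
    bnd-mono {i} {suc j} i≤1+j with m≤n⇒m<n∨m≡n i≤1+j
    ... | inj₁ (s≤s i≤j) = ≤-trans (bnd-mono i≤j) (<⇒≤ (bnd<bnd-suc j))
    ... | inj₂ refl = ≤-refl

    grp< : ∀ {s Q} → s < bnd Q → grp s < Q
    grp< {s} {Q} s<Q with grp s <? Q
    ... | yes lt = lt
    ... | no nlt = contradiction (≤-trans (bnd-mono (≮⇒≥ nlt)) (proj₁ (bnd-grp s))) (<⇒≱ s<Q)

    bnd-growth : ∀ i j → bnd i + j * suc (bnd i / k) ≤ bnd (j + i)
    bnd-growth i zero = ≤-reflexive (+-identityʳ _)
    bnd-growth i (suc j) = begin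
      bnd i + (suc (bnd i / k) + j * suc (bnd i / k)) ≡⟨ rearrange (bnd i) (bnd i / k) _ ⟩
      suc (bnd i + j * suc (bnd i / k) + bnd i / k)
        ≤⟨ s≤s (+-mono-≤ (bnd-growth i j) (/-monoˡ-≤ k (bnd-mono (m≤n+m i j)))) ⟩
      bnd (suc (j + i)) ∎
      where
      open ≤-Reasoning
      rearrange : ∀ a b c → a + (1 + b + c) ≡ 1 + (a + c + b)
      rearrange = solve-∀

    -- Any `k` consecutive groups starting at `b` contain at least `k * suc (b / k)` heights, which
    -- is more than `b`. So `suc (bnd i)` at least doubles every `k` groups.
    bnd-exponential : ∀ J → 2 ^ J ≤ suc (bnd (J * k))
    bnd-exponential zero = ≤-refl
    bnd-exponential (suc J) = begin
      2 * 2 ^ J ≤⟨ *-monoʳ-≤ 2 (bnd-exponential J) ⟩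
      2 * suc b ≡⟨ rearrange b ⟩
      suc (b + suc b) ≤⟨ s≤s (+-monoʳ-≤ b b<) ⟩
      suc (b + suc (b / k) * k) ≡⟨ cong (λ x → suc (b + x)) (*-comm (suc (b / k)) k) ⟩
      suc (b + k * suc (b / k)) ≤⟨ s≤s (bnd-growth (J * k) k) ⟩
      suc (bnd (k + J * k)) ∎
      where
      open ≤-Reasoning
      b = bnd (J * k)
      b< : b < suc (b / k) * k
      b< = ≤-trans (s≤s (≤-reflexive (m≡m%n+[m/n]*n b k))) (+-monoˡ-≤ (b / k * k) (m%n<n b k))
      rearrange : ∀ b → 2 * (1 + b) ≡ 1 + (b + (1 + b))
      rearrange = solve-∀

    -- A group whose lower end is below y reaches up to at most (1 + 1/k) y.
    groups-below : ∀ H y → k * (∑[ t ∈ upTo H ] [ bnd (grp t) <? y ]?) ≤ suc k * y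
    groups-below H y = begin
      k * (∑[ t ∈ upTo H ] [ bnd (grp t) <? y ]?)
        ≤⟨ *-monoʳ-≤ k (∑-upTo-count H (y + y / k) (λ t → bnd (grp t) <? y) below) ⟩
      k * (y + y / k) ≡⟨ *-distribˡ-+ k y _ ⟩
      k * y + k * (y / k) ≤⟨ +-monoʳ-≤ (k * y) (≤-trans (≤-reflexive (*-comm k _)) (m/n*n≤m y k)) ⟩
      k * y + y ≡⟨ +-comm (k * y) y ⟩
      suc k * y ∎
      where
      open ≤-Reasoning
      below : ∀ t → bnd (grp t) < y → t < y + y / k
      below t lt = ≤-trans (proj₂ (bnd-grp t)) (+-mono-≤ lt (/-monoˡ-≤ k (<⇒≤ lt)))

  REdge : ℕ → ℕ → Set
  REdge n H = Fin n × Fin n × Fin (suc H)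

  module Unfolding (n k H Q : ℕ) {{_ : NonZero k}} (H≤bnd : H ≤ Grouping.bnd k Q) where

    open Grouping k

    Node : Set
    Node = Fin n × ℕ

    _≟ᴺ_ : DecidableEquality Node
    _≟ᴺ_ = ≡-dec _≟ᶠ_ _≟_

    V : List (Fin n)
    V = allFin n

    bidders slots : List Node
    bidders = cartesianProduct V (upTo Q)
    slots   = cartesianProduct V (upTo H)

    wtᴿ : REdge n H → ℕ
    wtᴿ (_ , _ , w) = toℕ w

    cap : Node → ℕ
    cap (u , p) = ∑[ s ∈ upTo H ] [ grp s ≟ p ]?

    partners : ℕ → List (ℕ × ℕ)
    partners w = filter (λ (s , t) → grp t ≟ grp (w ∸ suc s)) (cartesianProduct (upTo w) (upTo H))

    opsFrom : Fin n → Fin n → ℕ → List (Node × Node)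
    opsFrom u v w = map (λ (s , t) → (u , grp s) , (v , t)) (partners w)

    ops : REdge n H → List (Node × Node)
    ops (u , v , w) = opsFrom u v (toℕ w) ++ opsFrom v u (toℕ w)

    data OpFrom (u v : Fin n) (w : ℕ) : Node × Node → Set where
      opFrom : ∀ {s t} → s < w → t < H → grp t ≡ grp (w ∸ suc s) → OpFrom u v w ((u , grp s) , (v , t))

    ∈-opsFrom⁻ : ∀ {u v w ab} → ab ∈ opsFrom u v w → OpFrom u v w ab
    ∈-opsFrom⁻ {w = w} ab∈ with ∈-map⁻ _ ab∈
    ... | (s , t) , st∈ , refl with ∈-filter⁻ _ {xs = cartesianProduct (upTo w) (upTo H)} st∈
    ...   | st∈′ , eq with ∈-cartesianProduct⁻ (upTo w) (upTo H) st∈′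
    ...     | s∈ , t∈ = opFrom (∈-upTo⁻ s∈) (∈-upTo⁻ t∈) eq

    ∈-opsFrom⁺ : ∀ {u v w ab} → OpFrom u v w ab → ab ∈ opsFrom u v w
    ∈-opsFrom⁺ (opFrom s<w t<H eq) =
      ∈-map⁺ _ (∈-filter⁺ _ (∈-cartesianProduct⁺ (∈-upTo⁺ s<w) (∈-upTo⁺ t<H)) eq)

    OpOf : REdge n H → Node × Node → Set
    OpOf (u , v , w) ab = OpFrom u v (toℕ w) ab ⊎ OpFrom v u (toℕ w) ab

    ∈-ops⁻ : ∀ e {ab} → ab ∈ ops e → OpOf e ab
    ∈-ops⁻ (u , v , w) ab∈ with ∈-++⁻ (opsFrom u v (toℕ w)) ab∈
    ... | inj₁ m = inj₁ (∈-opsFrom⁻ m)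
    ... | inj₂ m = inj₂ (∈-opsFrom⁻ m)

    ∈-ops⁺ : ∀ e {ab} → OpOf e ab → ab ∈ ops e
    ∈-ops⁺ _ (inj₁ o) = ∈-++⁺ˡ (∈-opsFrom⁺ o)
    ∈-ops⁺ (u , v , w) (inj₂ o) = ∈-++⁺ʳ (opsFrom u v (toℕ w)) (∈-opsFrom⁺ o)

    toℕ≤H : (w : Fin (suc H)) → toℕ w ≤ H
    toℕ≤H w = s≤s⁻¹ (toℕ<n w)

    grp<Q : ∀ {s} → s < H → grp s < Q
    grp<Q s<H = grp< (<-≤-trans s<H H≤bnd)

    opFrom-in : ∀ {u v w ab} → w ≤ H → OpFrom u v w ab → proj₁ ab ∈ bidders × proj₂ ab ∈ slots
    opFrom-in w≤H (opFrom s<w t<H _) =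
      ∈-cartesianProduct⁺ (∈-allFin _) (∈-upTo⁺ (grp<Q (<-≤-trans s<w w≤H))) ,
      ∈-cartesianProduct⁺ (∈-allFin _) (∈-upTo⁺ t<H)

    ops-in : ∀ e {a b} → (a , b) ∈ ops e → a ∈ bidders × b ∈ slots
    ops-in (u , v , w) ab∈ with ∈-ops⁻ (u , v , w) ab∈
    ... | inj₁ o = opFrom-in (toℕ≤H w) o
    ... | inj₂ o = opFrom-in (toℕ≤H w) o

    bidders! : Unique bidders
    bidders! = cartesianProduct⁺ (allFin⁺ n) (upTo⁺ Q)

    slots! : Unique slots
    slots! = cartesianProduct⁺ (allFin⁺ n) (upTo⁺ H)

    -- Only a default value: a slot of price zero counts as unsold.
    bottom : Node → Node
    bottom (v , _) = v , 0

    open Auction _≟ᴺ_ _≟ᴺ_ bidders! slots! k cap ops bottom ops-in public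

    block : Node → Node
    block (v , t) = v , grp t

    block-in : ∀ {b} → b ∈ slots → block b ∈ bidders
    block-in {v , t} b∈ = ∈-cartesianProduct⁺ (∈-allFin v)
      (∈-upTo⁺ (grp<Q (∈-upTo⁻ (proj₂ (∈-cartesianProduct⁻ V (upTo H) b∈)))))

    opFrom-block : ∀ {u v w a b b′} → OpFrom u v w (a , b) → b′ ∈ slots → block b′ ≡ block b →
      OpFrom u v w (a , b′)
    opFrom-block {b′ = v , t′} (opFrom s<w t<H eq) b′∈ beq with refl ← cong proj₁ beq =
      opFrom s<w (∈-upTo⁻ (proj₂ (∈-cartesianProduct⁻ V (upTo H) b′∈))) (trans (cong proj₂ beq) eq)

    ops-block : ∀ e {a b b′} → (a , b) ∈ ops e → b′ ∈ slots → block b′ ≡ block b → (a , b′) ∈ ops e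
    ops-block e ab∈ b′∈ beq with ∈-ops⁻ e ab∈
    ... | inj₁ o = ∈-ops⁺ e (inj₁ (opFrom-block o b′∈ beq))
    ... | inj₂ o = ∈-ops⁺ e (inj₂ (opFrom-block o b′∈ beq))

    open LogLength _≟ᴺ_ block block-in ops-block public

    -- Exchanging the sums counts each height below `m` in exactly one group; that group is among
    -- the first `Q` because `m ≤ H`.
    regroup : ∀ m → m ≤ H → (f : ℕ → ℕ) →
      (∑[ p ∈ upTo Q ] (∑[ s ∈ upTo m ] [ grp s ≟ p ]?) * f p) ≡ (∑[ s ∈ upTo m ] f (grp s))
    regroup m m≤H f = begin
      (∑[ p ∈ upTo Q ] (∑[ s ∈ upTo m ] [ grp s ≟ p ]?) * f p)
        ≡⟨ ∑-cong (upTo Q) (λ {p} _ → sym (∑-*ʳ (f p) (upTo m) _)) ⟩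
      (∑[ p ∈ upTo Q ] ∑[ s ∈ upTo m ] [ grp s ≟ p ]? * f p) ≡⟨ ∑-swap (upTo Q) (upTo m) _ ⟩
      (∑[ s ∈ upTo m ] ∑[ p ∈ upTo Q ] [ grp s ≟ p ]? * f p)
        ≡⟨ ∑-cong (upTo m) (λ s∈ → Uℕ.∑-indicator (upTo⁺ Q) f
          (∈-upTo⁺ (grp<Q (<-≤-trans (∈-upTo⁻ s∈) m≤H)))) ⟩
      (∑[ s ∈ upTo m ] f (grp s)) ∎
      where
      open ≡-Reasoning
      module Uℕ = Update _≟_

    VertexDisjointᴿ : REdge n H → REdge n H → Set
    VertexDisjointᴿ (u , v , _) (x , y , _) = u ≢ x × u ≢ y × v ≢ x × v ≢ y

    module UV = Update (_≟ᶠ_ {n})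

    -- The weight of the edge of the matching at a vertex, or 0 if the vertex is unmatched. The
    -- comparison assignment uses the heights below it.
    star : List (REdge n H) → Fin n → ℕ
    star [] = λ _ → 0
    star ((u , v , w) ∷ M) = UV.update u (toℕ w) (UV.update v (toℕ w) (star M))

    star≤H : ∀ M u → star M u ≤ H
    star≤H [] u = z≤n
    star≤H ((x , y , w) ∷ M) u with u ≟ᶠ x
    ... | yes _ = toℕ≤H w
    ... | no _ with u ≟ᶠ y
    ...   | yes _ = toℕ≤H w
    ...   | no _ = star≤H M u

    star-fresh : ∀ M u → All (λ (x , y , _) → u ≢ x × u ≢ y) M → star M u ≡ 0
    star-fresh [] u [] = refl
    star-fresh ((x , y , w) ∷ M) u ((u≢x , u≢y) ∷ fr) =
      trans (UV.update-≢ {f = UV.update y (toℕ w) (star M)} u≢x)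
        (trans (UV.update-≢ {f = star M} u≢y) (star-fresh M u fr))

    Loopless : REdge n H → Set
    Loopless (u , v , _) = u ≢ v

    -- Disjointness and the absence of loops guarantee that each update meets a vertex whose value
    -- is still 0, where `g` contributes nothing.
    ∑-star : ∀ (g : Fin n → ℕ → ℕ) → (∀ u → g u 0 ≡ 0) → ∀ {M} → AllPairs VertexDisjointᴿ M →
      All Loopless M →
             (∑[ u ∈ V ] g u (star M u)) ≡ (∑[ (u , v , w) ∈ M ] (g u (toℕ w) + g v (toℕ w)))
    ∑-star g g0 {[]} _ _ = trans (∑-cong V λ {u} _ → g0 u) (∑-0 V)
    ∑-star g g0 {(u , v , w) ∷ M} (d ∷ ds) (u≢v ∷ ls) = begin
      ∑ V (λ x → g x (UV.update u m f x))
        ≡⟨ insert u f (trans (UV.update-≢ {f = star M} u≢v)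
          (star-fresh M u (All.map (λ (p , q , _ , _) → p , q) d))) ⟩
      g u m + ∑ V (λ x → g x (f x))
        ≡⟨ cong (g u m +_) (insert v (star M) (star-fresh M v (All.map (λ (_ , _ , p , q) → p , q) d))) ⟩
      g u m + (g v m + ∑ V (λ x → g x (star M x))) ≡⟨ +-assoc (g u m) (g v m) _ ⟨
      g u m + g v m + ∑ V (λ x → g x (star M x)) ≡⟨ cong (g u m + g v m +_) (∑-star g g0 ds ls) ⟩
      g u m + g v m + (∑[ (u , v , w) ∈ M ] (g u (toℕ w) + g v (toℕ w))) ∎
      where
      open ≡-Reasoning
      m = toℕ w
      f = UV.update v m (star M)
      insert : ∀ y h → h y ≡ 0 → ∑ V (λ x → g x (UV.update y m h x)) ≡ g y m + ∑ V (λ x → g x (h x))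
      insert y h hy = begin
        ∑ V (λ x → g x (UV.update y m h x)) ≡⟨ ∑-cong V (λ {x} _ → pointwise x) ⟩
        ∑ V (UV.update y (g y m) (λ x → g x (h x))) ≡⟨ +-identityʳ _ ⟨
        ∑ V (UV.update y (g y m) (λ x → g x (h x))) + 0
          ≡⟨ cong (∑ V (UV.update y (g y m) (λ x → g x (h x))) +_) (trans (cong (g y) hy) (g0 y)) ⟨
        ∑ V (UV.update y (g y m) (λ x → g x (h x))) + g y (h y) ≡⟨ UV.∑-update (allFin⁺ n) (∈-allFin y) ⟩
        ∑ V (λ x → g x (h x)) + g y m ≡⟨ +-comm (∑ V (λ x → g x (h x))) (g y m) ⟩
        g y m + ∑ V (λ x → g x (h x)) ∎
        where
        pointwise : ∀ x → g x (UV.update y m h x) ≡ UV.update y (g y m) (λ x → g x (h x)) x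
        pointwise x with x ≟ᶠ y
        ... | yes refl = refl
        ... | no _ = refl

    module _ (Γ M : List (REdge n H)) (M⊆Γ : All (_∈ Γ) M)
             (disjoint : AllPairs VertexDisjointᴿ M) (loopless : All Loopless M) where

      demand : Node → ℕ
      demand (u , p) = ∑[ s ∈ upTo (star M u) ] [ grp s ≟ p ]?

      demand≤cap : ∀ a → demand a ≤ cap a
      demand≤cap (u , p) = ∑-upTo-mono _ (star≤H M u)

      open Compare demand demand≤cap

      -- Both endpoints of a matching edge act as bidders for its full weight, hence the factor 2.
      total-demand : F* ≡ 2 * ∑ M wtᴿ
      total-demand = begin
        ∑ bidders demand ≡⟨ ∑-× V (upTo Q) demand ⟩
        (∑[ u ∈ V ] ∑[ p ∈ upTo Q ] demand (u , p))
          ≡⟨ ∑-cong V (λ {u} _ → ∑-cong (upTo Q) λ {p} _ → sym (*-identityʳ (demand (u , p)))) ⟩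
        (∑[ u ∈ V ] ∑[ p ∈ upTo Q ] demand (u , p) * 1)
          ≡⟨ ∑-cong V (λ {u} _ → regroup (star M u) (star≤H M u) (λ _ → 1)) ⟩
        (∑[ u ∈ V ] ∑[ s ∈ upTo (star M u) ] 1)
          ≡⟨ ∑-star (λ _ m → ∑[ s ∈ upTo m ] 1) (λ _ → refl) disjoint loopless ⟩
        (∑[ (u , v , w) ∈ M ] (∑[ s ∈ upTo (toℕ w) ] 1) + (∑[ s ∈ upTo (toℕ w) ] 1))
          ≡⟨ ∑-cong M (λ {(_ , _ , w)} _ → twice (toℕ w)) ⟩
        (∑[ e ∈ M ] 2 * wtᴿ e) ≡⟨ ∑-*ˡ 2 M wtᴿ ⟩
        2 * ∑ M wtᴿ ∎
        where
        open ≡-Reasoning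
        ones : ∀ m → (∑[ s ∈ upTo m ] 1) ≡ m
        ones m = trans (∑-const (upTo m) 1) (trans (*-identityʳ _) (length-upTo m))
        twice : ∀ m → (∑[ s ∈ upTo m ] 1) + (∑[ s ∈ upTo m ] 1) ≡ 2 * m
        twice m = trans (cong₂ _+_ (ones m) (ones m)) (cong (m +_) (sym (+-identityʳ m)))

      -- Stability is used for the exact partners `s` and `w ∸ suc s` only. Reversal permutes the
      -- heights below `w`, so the levels at one end of a matching edge are dominated by the prices
      -- at the other end, and both directions together are symmetric.
      cover : ∀ σ → Stable Γ σ → (∑[ a ∈ bidders ] demand a * level σ a) ≤ ∑ slots (price σ)
      cover σ stable = begin
        (∑[ a ∈ bidders ] demand a * level σ a) ≡⟨ ∑-× V (upTo Q) _ ⟩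
        (∑[ u ∈ V ] ∑[ p ∈ upTo Q ] demand (u , p) * level σ (u , p))
          ≡⟨ ∑-cong V (λ {u} _ → regroup (star M u) (star≤H M u) (λ p → level σ (u , p))) ⟩
        (∑[ u ∈ V ] levels u (star M u)) ≡⟨ ∑-star levels (λ _ → refl) disjoint loopless ⟩
        (∑[ (u , v , w) ∈ M ] levels u (toℕ w) + levels v (toℕ w))
          ≤⟨ ∑-mono M (λ {e} e∈ → edge (All.lookup M⊆Γ e∈)) ⟩
        (∑[ (u , v , w) ∈ M ] prices u (toℕ w) + prices v (toℕ w))
          ≡⟨ ∑-star prices (λ _ → refl) disjoint loopless ⟨
        (∑[ u ∈ V ] prices u (star M u))
          ≤⟨ ∑-mono V (λ {u} _ → ∑-upTo-mono (λ t → price σ (u , t)) (star≤H M u)) ⟩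
        (∑[ u ∈ V ] prices u H) ≡⟨ ∑-× V (upTo H) (price σ) ⟨
        ∑ slots (price σ) ∎
        where
        open ≤-Reasoning
        levels prices : Fin n → ℕ → ℕ
        levels u m = ∑[ s ∈ upTo m ] level σ (u , grp s)
        prices u m = ∑[ t ∈ upTo m ] price σ (u , t)
        complement : ∀ {s w} → s < w → w ≤ H → w ∸ suc s < H
        complement {s} {w} s<w w≤H = <-≤-trans (∸-monoʳ-< z<s s<w) w≤H
        direction : ∀ {u v w} → w ≤ H → (∀ {a b} → OpFrom u v w (a , b) → level σ a ≤ price σ b) →
          levels u w ≤ prices v w
        direction {u} {v} {w} w≤H le = ≤-trans
          (∑-mono (upTo w) λ s∈ → le (opFrom (∈-upTo⁻ s∈) (complement (∈-upTo⁻ s∈) w≤H) refl))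
          (≤-reflexive (∑-upTo-reverse w (λ t → price σ (v , t))))
        edge : ∀ {e} → e ∈ Γ → let (u , v , w) = e in levels u (toℕ w) + levels v (toℕ w) ≤ prices u (toℕ w) + prices v (toℕ w)
        edge {e@(u , v , w)} e∈ = ≤-trans
          (+-mono-≤ (direction {u} {v} (toℕ≤H w) λ o → stable e∈ (∈-ops⁺ e (inj₁ o)))
                    (direction {v} {u} (toℕ≤H w) λ o → stable e∈ (∈-ops⁺ e (inj₂ o))))
          (≤-reflexive (+-comm (prices v (toℕ w)) _))

      matching-vs-sold : 0 < k → k * (2 * ∑ M wtᴿ) ≤ (k + 2) * sold (rounds Γ (k * k)) + 2 * ∑ M wtᴿ
      matching-vs-sold 0<k = subst (λ F → k * F ≤ (k + 2) * sold (rounds Γ (k * k)) + F) total-demand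
        (auction-approximation Γ cover 0<k)

    -- A sold slot (v , t) held by (u , p) comes from heights s + t′ < w with s, t′ in the groups of
    -- the two nodes, so at least one of the groups starts below the dual value of its vertex.
    sold-vs-dual : ∀ σ L → Inv σ → Sourced (LoggedOp L) σ → (y : Fin n → ℕ) →
      (∀ {u v w} → just (u , v , w) ∈ L → toℕ w ≤ y u + y v) → k * sold σ ≤ suc k * (2 * ∑ V y)
    sold-vs-dual σ L inv src y covers = begin
      k * sold σ ≤⟨ *-monoʳ-≤ k (∑-mono slots (λ {b} _ → slot b)) ⟩
      k * (∑[ b ∈ slots ] ([ low? b ]? + (∑[ a ∈ bidders ] [ holds? σ a b ]? * [ bidLow? a ]?)))
        ≡⟨ cong (k *_) (trans (∑-+ slots _ _)
          (cong (∑ slots (λ b → [ low? b ]?) +_) (∑-swap slots bidders _))) ⟩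
      k * (∑ slots (λ b → [ low? b ]?) +
        (∑[ a ∈ bidders ] ∑[ b ∈ slots ] [ holds? σ a b ]? * [ bidLow? a ]?))
        ≡⟨ cong (λ z → k * (∑ slots (λ b → [ low? b ]?) + z))
          (∑-cong bidders λ {a} _ → ∑-*ʳ [ bidLow? a ]? slots _) ⟩
      k * (∑ slots (λ b → [ low? b ]?) + (∑[ a ∈ bidders ] held σ a * [ bidLow? a ]?))
        -- A slot explained by its holder is charged to the group of that holder; the capacity,
        -- which is the number of heights in the group, bounds the slots charged.
        ≤⟨ *-monoʳ-≤ k (+-monoʳ-≤ (∑ slots (λ b → [ low? b ]?)) (∑-mono bidders λ {a} _ →
             *-monoˡ-≤ [ bidLow? a ]? (≤-trans (m≤m+n (held σ a) _) (held≤cap inv a)))) ⟩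
      k * (∑ slots (λ b → [ low? b ]?) + (∑[ a ∈ bidders ] cap a * [ bidLow? a ]?))
        ≡⟨ cong₂ (λ z z′ → k * (z + z′)) (∑-× V (upTo H) _)
             (trans (∑-× V (upTo Q) _) (∑-cong V λ {u} _ → regroup H ≤-refl (λ p → [ bnd p <? y u ]?))) ⟩
      k * (N + N) ≡⟨ rearrange k N ⟩
      2 * (k * N) ≤⟨ *-monoʳ-≤ 2 (≤-trans (≤-reflexive (sym (∑-*ˡ k V _)))
           (≤-trans (∑-mono V λ {u} _ → groups-below H (y u)) (≤-reflexive (∑-*ˡ (suc k) V y)))) ⟩
      2 * (suc k * ∑ V y) ≡⟨ swap 2 (suc k) (∑ V y) ⟩
      suc k * (2 * ∑ V y) ∎
      where
      open ≤-Reasoning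
      N = ∑[ u ∈ V ] ∑[ t ∈ upTo H ] [ bnd (grp t) <? y u ]?
      rearrange : ∀ k n → k * (n + n) ≡ 2 * (k * n)
      rearrange = solve-∀
      swap : ∀ a b c → a * (b * c) ≡ b * (a * c)
      swap = solve-∀
      low? : (b : Node) → Dec _
      low? (v , t) = bnd (grp t) <? y v
      bidLow? : (a : Node) → Dec _
      bidLow? (u , p) = bnd p <? y u
      choose : ∀ {u v w a b} → w ≤ y u + y v → OpFrom u v w (a , b) →
               bnd (proj₂ a) < y (proj₁ a) ⊎ bnd (grp (proj₂ b)) < y (proj₁ b)
      choose {u} {v} {w} w≤ (opFrom {s} {t} s<w t<H eq) with bnd (grp s) <? y u | bnd (grp t) <? y v
      ... | yes p | _ = inj₁ p
      ... | no _ | yes q = inj₂ q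
      ... | no p | no q = contradiction (≤-trans w≤ (+-mono-≤ (≮⇒≥ p) (≮⇒≥ q))) (<⇒≱ (begin-strict
        bnd (grp s) + bnd (grp t) ≡⟨ cong (λ g → bnd (grp s) + bnd g) eq ⟩
        bnd (grp s) + bnd (grp (w ∸ suc s)) ≤⟨ +-mono-≤ (proj₁ (bnd-grp s)) (proj₁ (bnd-grp (w ∸ suc s))) ⟩
        s + (w ∸ suc s) <⟨ n<1+n _ ⟩
        suc s + (w ∸ suc s) ≡⟨ m+[n∸m]≡n s<w ⟩
        w ∎))
      slot : ∀ b → [ 0 <? price σ b ]? ≤ [ low? b ]? + (∑[ a ∈ bidders ] [ holds? σ a b ]? * [ bidLow? a ]?)
      slot b with 0 <? price σ b in sold?
      ... | no _ = z≤n
      ... | yes 0<p with src b 0<p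
      ...   | (u , v , w) , e∈ , ab∈ with [ choose (covers e∈) , choose
        (≤-trans (covers e∈) (≤-reflexive (+-comm (y u) (y v)))) ]′ (∈-ops⁻ (u , v , w) ab∈)
      ...     | inj₂ low = ≤-trans (≤-reflexive (sym ([]?-true (low? b) low))) (m≤m+n _ _)
      ...     | inj₁ low =
        ≤-trans (≤-trans (≤-reflexive (sym one)) (∈⇒≤∑ _ (proj₁ (ops-in (u , v , w) ab∈)))) (m≤n+m _ _)
        where
        h = holder σ b
        one : [ yes 0<p ×-dec (h ≟ᴺ h) ]? * [ bidLow? h ]? ≡ 1
        one rewrite []?-true (bidLow? h) low | []?-true (yes 0<p ×-dec (h ≟ᴺ h)) (0<p , refl) = refl

-- Coding bounded lists in blocks of words.

module Encoding where

  open import Data.Bool.Base using (Bool; true; false; if_then_else_)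
  open import Data.Fin.Base using (Fin; zero; suc; toℕ; fromℕ<; inject≤; combine; funToFin; finToFun)
  open import Data.Fin.Properties using (toℕ-injective; toℕ-fromℕ<; toℕ-inject≤; toℕ<n; funToFin-finToFin)
  open import Data.List.Base as List using (List; []; _∷_)
  open import Data.Maybe.Base using (Maybe; just; nothing)
  open import Data.Nat.Base
  open import Data.Nat.Properties
  open import Data.Product.Base using (_×_; _,_)
  open import Data.Vec.Base as Vec using (Vec; _∷_; []; _++_; take; drop; lookup; tabulate; replicate)
  open import Data.Vec.Properties
    using (lookup∘tabulate; lookup-replicate; take++drop≡id; ++-injectiveˡ; ++-injectiveʳ)
  open import Function.Base using (_∘_)
  open import Relation.Binary.PropositionalEquality
  open import Relation.Nullary.Decidable.Core using (yes; no)
  open import Relation.Nullary.Negation.Core using (contradiction)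

  funToFin-cong : ∀ {m n} {f g : Fin m → Fin n} → (∀ i → f i ≡ g i) → funToFin f ≡ funToFin g
  funToFin-cong {zero} h = refl
  funToFin-cong {suc m} h = cong₂ combine (h zero) (funToFin-cong (h ∘ suc))

  module _ {A : Set} {m n : ℕ} (xs : Vec A m) (ys : Vec A n) where

    take-++ : take m (xs ++ ys) ≡ xs
    take-++ = ++-injectiveˡ _ _ (take++drop≡id m (xs ++ ys))

    drop-++ : drop m (xs ++ ys) ≡ ys
    drop-++ = ++-injectiveʳ (take m (xs ++ ys)) xs (take++drop≡id m (xs ++ ys))

  module Coding (L : ℕ) where

    Block : ℕ → Set
    Block m = Vec (Vec Bool L) m

    record Code (X : Set) (m : ℕ) : Set where
      field
        encode        : X → Block m
        decode        : Block m → X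
        decode-encode : ∀ x → decode (encode x) ≡ x

    open Code public

    toBool : Fin 2 → Bool
    toBool zero       = false
    toBool (suc zero) = true

    fromBool : Bool → Fin 2
    fromBool false = zero
    fromBool true  = suc zero

    from-toBool : ∀ i → fromBool (toBool i) ≡ i
    from-toBool zero       = refl
    from-toBool (suc zero) = refl

    -- Each word stores one digit in base `2 ^ L`. A block that codes no element decodes to a number
    -- out of range, which `clamp` sends to the default `zero`.
    finCode : ∀ {l m} → suc l ≤ (2 ^ L) ^ m → Code (Fin (suc l)) m
    finCode {l} {m} le = record { encode = enc ; decode = clamp ∘ dec ; decode-encode = inverse }
      where
      digits : Fin (suc l) → Fin m → Fin (2 ^ L)
      digits i = finToFun (inject≤ i le)
      enc : Fin (suc l) → Block m
      enc i = tabulate λ j → tabulate λ b → toBool (finToFun (digits i j) b)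
      dec : Block m → Fin ((2 ^ L) ^ m)
      dec ws = funToFin λ j → funToFin λ b → fromBool (lookup (lookup ws j) b)
      clamp : Fin ((2 ^ L) ^ m) → Fin (suc l)
      clamp x with toℕ x <? suc l
      ... | yes lt = fromℕ< lt
      ... | no  _  = zero
      dec-enc : ∀ i → dec (enc i) ≡ inject≤ i le
      dec-enc i = trans (funToFin-cong digit) (funToFin-finToFin {m} {2 ^ L} (inject≤ i le))
        where
        digit : ∀ j → funToFin (λ b → fromBool (lookup (lookup (enc i) j) b)) ≡ digits i j
        digit j = trans (funToFin-cong bit) (funToFin-finToFin {L} {2} (digits i j))
          where
          bit : ∀ b → fromBool (lookup (lookup (enc i) j) b) ≡ finToFun (digits i j) b
          bit b = trans (cong (λ w → fromBool (lookup w b)) (lookup∘tabulate _ j))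
                  (trans (cong fromBool (lookup∘tabulate _ b)) (from-toBool _))
      clamp-inject : ∀ i → clamp (inject≤ i le) ≡ i
      clamp-inject i with toℕ (inject≤ i le) <? suc l
      ... | yes lt = toℕ-injective (trans (toℕ-fromℕ< lt) (toℕ-inject≤ i le))
      ... | no nlt = contradiction (subst (_< suc l) (sym (toℕ-inject≤ i le)) (toℕ<n i)) nlt
      inverse : ∀ i → clamp (dec (enc i)) ≡ i
      inverse i = trans (cong clamp (dec-enc i)) (clamp-inject i)

    pairCode : ∀ {X Y m m′} → Code X m → Code Y m′ → Code (X × Y) (m + m′)
    pairCode {m = m} c d = record
      { encode = λ (x , y) → encode c x ++ encode d y
      ; decode = λ ws → decode c (take m ws) , decode d (drop m ws)
      ; decode-encode = λ (x , y) → cong₂ _,_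
          (trans (cong (decode c) (take-++ (encode c x) (encode d y))) (decode-encode c x))
          (trans (cong (decode d) (drop-++ (encode c x) (encode d y))) (decode-encode d y)) }

    module _ (0<L : 0 < L) where

      isSet : Vec Bool L → Bool
      isSet w = lookup w (fromℕ< 0<L)

      isSet-replicate : ∀ b → isSet (replicate L b) ≡ b
      isSet-replicate b = lookup-replicate (fromℕ< 0<L) b

      -- A full word is spent on the tag, of which one bit is read; `0<L` provides that bit.
      maybeCode : ∀ {X m} → Code X m → Code (Maybe X) (suc m)
      maybeCode {X} {m} c = record { encode = enc ; decode = dec ; decode-encode = inverse }
        where
        enc : Maybe X → Block (suc m)
        enc (just x) = replicate L true ∷ encode c x
        enc nothing  = replicate (suc m) (replicate L false)
        dec : Block (suc m) → Maybe X
        dec (w ∷ ws) = if isSet w then just (decode c ws) else nothing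
        inverse : ∀ x → dec (enc x) ≡ x
        inverse (just x) rewrite isSet-replicate true = cong just (decode-encode c x)
        inverse nothing  rewrite isSet-replicate false = refl

    module BoundedList {X : Set} {m : ℕ} (c : Code (Maybe X) m) where

      -- Short lists are padded with `nothing` and long ones are cut off, so decoding is faithful
      -- only under a bound on the length. For logs this bound is `bounded⇒length`.
      encodeList : ∀ N → List X → Block (N * m)
      encodeList zero    _        = []
      encodeList (suc N) []       = encode c nothing ++ encodeList N []
      encodeList (suc N) (x ∷ xs) = encode c (just x) ++ encodeList N xs

      next : Maybe X → List X → List X
      next nothing  _  = []
      next (just x) xs = x ∷ xs

      decodeList : ∀ N → Block (N * m) → List X
      decodeList zero    _  = []
      decodeList (suc N) ws = next (decode c (take m ws)) (decodeList N (drop m ws))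

      decode-encodeList : ∀ N xs → List.length xs ≤ N → decodeList N (encodeList N xs) ≡ xs
      decode-encodeList zero [] _ = refl
      decode-encodeList (suc N) [] _ = cong (λ z → next z (decodeList N (drop m (encodeList (suc N) []))))
        (trans (cong (decode c) (take-++ (encode c nothing) (encodeList N []))) (decode-encode c nothing))
      decode-encodeList (suc N) (x ∷ xs) (s≤s le) = cong₂ next
        (trans (cong (decode c) (take-++ (encode c (just x)) (encodeList N xs))) (decode-encode c (just x)))
        (trans (cong (decodeList N) (drop-++ (encode c (just x)) (encodeList N xs)))
          (decode-encodeList N xs le))

-- The best matching among the logged edges.

module LoggedMatchings where

  open import Data.Bool.Base using (Bool; true; false; if_then_else_)
  open import Data.Fin.Base using (Fin; toℕ)
  open import Data.Fin.Properties using () renaming (_≟_ to _≟ᶠ_)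
  open import Data.List.Base as List
    using (List; []; _∷_; map; filter; allFin; length; cartesianProductWith; catMaybes)
  open import Data.List.Extrema.Nat using (argmax; argmax-all; f[xs]≤f[argmax])
  open import Data.List.Membership.Propositional using (_∈_)
  open import Data.List.Membership.Propositional.Properties
  open import Data.List.Properties using (length-map; length-tabulate)
  open import Data.List.Relation.Unary.All as All using (All; []; _∷_)
  import Data.List.Relation.Unary.All.Properties as All
  open import Data.List.Relation.Unary.Any as Any using (here; there)
  open import Data.List.Relation.Unary.AllPairs as AllPairs using (AllPairs; []; _∷_; allPairs?)
  import Data.List.Relation.Unary.AllPairs.Properties as AllPairs
  open import Data.List.Relation.Unary.Unique.Propositional using (Unique)
  open import Data.Maybe.Base using (just; nothing)
  open import Data.Nat.Base
  open import Data.Nat.GeneralisedArithmetic using (fold)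
  open import Data.Nat.Properties
  open import Data.Product.Base using (_×_; _,_; proj₁; proj₂; ∃)
  open import Function.Base using (_∘_; id)
  open import Relation.Binary.PropositionalEquality
  open import Relation.Nullary.Decidable.Core using (Dec; _×-dec_; ¬?)
  open import Relation.Nullary.Negation.Core using (contradiction)
  open import Data.Nat.Tactic.RingSolver using (solve-∀)
  open FiniteSums
  open CapacitatedAuction
  open WeightedDuality
  open Unfold
  open Encoding

  ∈-catMaybes⁺ : ∀ {A : Set} {x : A} {xs} → just x ∈ xs → x ∈ catMaybes xs
  ∈-catMaybes⁺ {xs = just _ ∷ _} (here refl) = here refl
  ∈-catMaybes⁺ {xs = just _ ∷ _} (there x∈)  = there (∈-catMaybes⁺ x∈)
  ∈-catMaybes⁺ {xs = nothing ∷ _} (there x∈) = ∈-catMaybes⁺ x∈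

  ∈-catMaybes⁻ : ∀ {A : Set} {x : A} {xs} → x ∈ catMaybes xs → just x ∈ xs
  ∈-catMaybes⁻ {xs = just _ ∷ _} (here refl) = here refl
  ∈-catMaybes⁻ {xs = just _ ∷ _} (there x∈)  = there (∈-catMaybes⁻ x∈)
  ∈-catMaybes⁻ {xs = nothing ∷ _} x∈ = there (∈-catMaybes⁻ x∈)

  listsUpTo : ∀ {A : Set} → ℕ → List A → List (List A)
  listsUpTo zero    xs = [] ∷ []
  listsUpTo (suc m) xs = [] ∷ cartesianProductWith _∷_ xs (listsUpTo m xs)

  ∈-listsUpTo⁺ : ∀ {A : Set} m {xs ys : List A} → length ys ≤ m → All (_∈ xs) ys → ys ∈ listsUpTo m xs
  ∈-listsUpTo⁺ zero    {ys = []} _ _ = here refl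
  ∈-listsUpTo⁺ (suc m) {ys = []} _ _ = here refl
  ∈-listsUpTo⁺ (suc m) {ys = y ∷ ys} (s≤s le) (y∈ ∷ ys⊆) =
    there (∈-cartesianProductWith⁺ _∷_ y∈ (∈-listsUpTo⁺ m le ys⊆))

  ∈-listsUpTo⁻ : ∀ {A : Set} m {xs ys : List A} → ys ∈ listsUpTo m xs → All (_∈ xs) ys
  ∈-listsUpTo⁻ zero    (here refl) = []
  ∈-listsUpTo⁻ (suc m) (here refl) = []
  ∈-listsUpTo⁻ (suc m) {xs} (there ys∈) with ∈-cartesianProductWith⁻ _∷_ xs (listsUpTo m xs) ys∈
  ... | y , ys , y∈ , ys∈′ , refl = y∈ ∷ ∈-listsUpTo⁻ m ys∈′

  Unique-length≤ : ∀ {n} {xs : List (Fin n)} → Unique xs → length xs ≤ n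
  Unique-length≤ {n} {xs} xs! = begin
    length xs ≡⟨ *-identityʳ _ ⟨
    length xs * 1 ≡⟨ ∑-const xs 1 ⟨
    (∑[ _ ∈ xs ] 1) ≤⟨ Update.∑-support _≟ᶠ_ xs! (λ _ → 1) (λ {x} _ _ → ∈-allFin x) ⟩
    (∑[ _ ∈ allFin n ] 1) ≡⟨ ∑-const (allFin n) 1 ⟩
    length (allFin n) * 1 ≡⟨ *-identityʳ _ ⟩
    length (allFin n) ≡⟨ length-tabulate id ⟩
    n ∎
    where open ≤-Reasoning

  module Matchings {n k H Q : ℕ} {{_ : NonZero k}} (H≤bnd : H ≤ Grouping.bnd k Q) where

    open Unfolding n k H Q H≤bnd

    vertexDisjoint? : ∀ e f → Dec (VertexDisjointᴿ e f)
    vertexDisjoint? (u , v , _) (x , y , _) =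
      ¬? (u ≟ᶠ x) ×-dec ¬? (u ≟ᶠ y) ×-dec ¬? (v ≟ᶠ x) ×-dec ¬? (v ≟ᶠ y)

    weight* : List (REdge n H) → ℕ
    weight* M = ∑ M wtᴿ

    matchings : List (REdge n H) → List (List (REdge n H))
    matchings es = filter (allPairs? vertexDisjoint?) (listsUpTo n es)

    -- Exhaustive search is legitimate since the model charges memory and passes, not time. It also
    -- avoids any reference to the bipartition.
    bestMatching : List (REdge n H) → List (REdge n H)
    bestMatching es = argmax weight* [] (matchings es)

    bestMatching-valid : ∀ es → All (_∈ es) (bestMatching es) × AllPairs VertexDisjointᴿ (bestMatching es)
    bestMatching-valid es =
      argmax-all weight* {P = λ M → All (_∈ es) M × AllPairs VertexDisjointᴿ M} ([] , [])
      (All.tabulate λ M∈ → let (M∈′ , d) = ∈-filter⁻ (allPairs? vertexDisjoint?) {xs = listsUpTo n es} M∈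
                           in ∈-listsUpTo⁻ n M∈′ , d)

    bestMatching-best : ∀ es {M} → length M ≤ n → All (_∈ es) M → AllPairs VertexDisjointᴿ M →
                        weight* M ≤ weight* (bestMatching es)
    bestMatching-best es len M⊆ d = All.lookup (f[xs]≤f[argmax] {f = weight*} [] (matchings es))
      (∈-filter⁺ (allPairs? vertexDisjoint?) (∈-listsUpTo⁺ n len M⊆) d)

    module Bipartite (side : Fin n → Bool) (es : List (REdge n H))
      (bip : ∀ {u v w} → (u , v , w) ∈ es → side u ≢ side v)
      (heavy : ∀ {e} → e ∈ es → k ≤ wtᴿ e) where

      bid item : REdge n H → Fin n
      bid  (u , v , _) = if side u then u else v
      item (u , v , _) = if side u then v else u

      open Egerváry bid item wtᴿ es using (approx-egerváry; Disjoint; Covers)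

      data Oriented (u v : Fin n) : Set where
        forward  : side u ≡ true → side v ≡ false → Oriented u v
        backward : side u ≡ false → side v ≡ true → Oriented u v

      orient : ∀ {u v} → side u ≢ side v → Oriented u v
      orient {u} {v} ≢ with side u in su | side v in sv
      ... | true  | true  = contradiction refl ≢
      ... | true  | false = forward su sv
      ... | false | true  = backward su sv
      ... | false | false = contradiction refl ≢

      opposite : ∀ {p q} → side p ≡ true → side q ≡ false → p ≢ q
      opposite sp sq refl = contradiction (trans (sym sp) sq) λ ()

      -- `Disjoint` compares bidders with bidders and items with items. The two mixed inequalities
      -- hold because those vertices lie on opposite sides.
      disjoint⇒ : ∀ {e f} → e ∈ es → f ∈ es → Disjoint e f → VertexDisjointᴿ e f
      disjoint⇒ {u , v , w} {x , y , z} e∈ f∈ with orient (bip e∈) | orient (bip f∈)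
      ... | forward su sv | forward sx sy =
        λ d → proj₁ (h d) , opposite su sy , opposite sx sv ∘ sym , proj₂ (h d)
        where
        h : Disjoint (u , v , w) (x , y , z) → u ≢ x × v ≢ y
        h d rewrite su | sx = d
      ... | forward su sv | backward sx sy =
        λ d → opposite su sx , proj₁ (h d) , proj₂ (h d) , opposite sy sv ∘ sym
        where
        h : Disjoint (u , v , w) (x , y , z) → u ≢ y × v ≢ x
        h d rewrite su | sx = d
      ... | backward su sv | forward sx sy =
        λ d → opposite sx su ∘ sym , proj₂ (h d) , proj₁ (h d) , opposite sv sy
        where
        h : Disjoint (u , v , w) (x , y , z) → v ≢ x × u ≢ y
        h d rewrite su | sx = d
      ... | backward su sv | backward sx sy =
        λ d → proj₂ (h d) , opposite sy su ∘ sym , opposite sv sx , proj₁ (h d)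
        where
        h : Disjoint (u , v , w) (x , y , z) → v ≢ y × u ≢ x
        h d rewrite su | sx = d

      allPairs⇒ : ∀ {M} → All (_∈ es) M → AllPairs Disjoint M → AllPairs VertexDisjointᴿ M
      allPairs⇒ [] [] = []
      allPairs⇒ (e∈ ∷ M⊆) (d ∷ ds) =
        All.zipWith (λ (f∈ , dis) → disjoint⇒ e∈ f∈ dis) (M⊆ , d) ∷ allPairs⇒ M⊆ ds

      -- Adding profit and price at every vertex gives a dual solution without orientation. The
      -- excess of one unit per edge becomes the factor 1 + 1/`k` because all weights are at least
      -- `k`.
      dual : ∃ λ y →
        (∀ {u v w} → (u , v , w) ∈ es → toℕ w ≤ y u + y v) × k * ∑ V y ≤ suc k * weight* (bestMatching es)
      dual with approx-egerváry
      ... | M , x , π , M⊆ , ds , covers , total = y , covers′ , (begin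
        k * ∑ V y ≡⟨ cong (k *_) (∑-+ V x π) ⟩
        k * (∑ V x + ∑ V π) ≤⟨ *-monoʳ-≤ k total ⟩
        k * (∑[ e ∈ M ] suc (wtᴿ e)) ≡⟨ ∑-*ˡ k M _ ⟨
        (∑[ e ∈ M ] k * suc (wtᴿ e)) ≤⟨ ∑-mono M (λ {e} e∈ → scaled (wtᴿ e) (heavy (All.lookup M⊆ e∈))) ⟩
        (∑[ e ∈ M ] suc k * wtᴿ e) ≡⟨ ∑-*ˡ (suc k) M wtᴿ ⟩
        suc k * weight* M ≤⟨ *-monoʳ-≤ (suc k) (bestMatching-best es short M⊆ (allPairs⇒ M⊆ ds)) ⟩
        suc k * weight* (bestMatching es) ∎)
        where
        open ≤-Reasoning
        y : Fin n → ℕ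
        y u = x u + π u
        scaled : ∀ w → k ≤ w → k * suc w ≤ suc k * w
        scaled w k≤w = ≤-trans (≤-reflexive (*-suc k w)) (+-monoˡ-≤ (k * w) k≤w)
        short : length M ≤ n
        short = subst (_≤ n) (length-map bid M) (Unique-length≤ (AllPairs.map⁺ (AllPairs.map proj₁ ds)))
        either : ∀ {u v w} → Oriented u v → (u , v , w) ∈ es → toℕ w ≤ y u + y v
        either {u} {v} (forward su sv) e∈ with covers e∈
        ... | c rewrite su = ≤-trans c (+-mono-≤ (m≤m+n (x u) (π u)) (m≤n+m (π v) (x v)))
        either {u} {v} (backward su sv) e∈ with covers e∈
        ... | c rewrite su =
          ≤-trans c (≤-trans (≤-reflexive (+-comm (x v) (π u)))
            (+-mono-≤ (m≤n+m (π u) (x u)) (m≤m+n (x v) (π v))))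
        covers′ : ∀ {u v w} → (u , v , w) ∈ es → toℕ w ≤ y u + y v
        covers′ e∈ = either (orient (bip e∈)) e∈

    finalLog : List (REdge n H) → Log
    finalLog Γ = fold [] (recordRound Γ) (k * k)

    logged : List (REdge n H) → List (REdge n H)
    logged Γ = catMaybes (finalLog Γ)

    logged⊆Γ : ∀ Γ {e} → e ∈ logged Γ → e ∈ Γ
    logged⊆Γ Γ e∈ = logged⊆-rounds Γ (k * k) (∈-catMaybes⁻ e∈)

    -- The number of sold slots mediates: the auction bounds the optimum by it, `sold-vs-dual`
    -- bounds it by a dual solution of the logged edges, and `dual` returns to a matching. Each link
    -- contributes its power of 1 + O(1/`k`).
    logged-approximates : ∀ (side : Fin n → Bool) Γ →
      (∀ {u v w} → (u , v , w) ∈ Γ → side u ≢ side v) → (∀ {e} → e ∈ Γ → k ≤ wtᴿ e) →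
      ∀ {M} → All (_∈ Γ) M → AllPairs VertexDisjointᴿ M →
      k * k * k * weight* M ≤ (k + 2) * (suc k * suc k) * weight*
        (bestMatching (logged Γ)) + k * k * weight* M
    logged-approximates side Γ bip heavy {M} M⊆ d = *-cancelˡ-≤ 2 (begin
      2 * (k * k * k * S*) ≡⟨ rearrange₁ k S* ⟩
      k * k * (k * (2 * S*)) ≤⟨ *-monoʳ-≤ (k * k) sold-bound ⟩
      k * k * ((k + 2) * F + 2 * S*) ≡⟨ rearrange₂ k F S* ⟩
      k * (k + 2) * (k * F) + 2 * (k * k * S*) ≤⟨ +-monoˡ-≤ _ (*-monoʳ-≤ (k * (k + 2))
          (sold-vs-dual _ (finalLog Γ) (inv-replay (finalLog Γ)) (sourced-replay (finalLog Γ)) y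
            (covers ∘ ∈-catMaybes⁺))) ⟩
      k * (k + 2) * (suc k * (2 * ∑ V y)) + 2 * (k * k * S*)
        ≡⟨ cong (_+ 2 * (k * k * S*)) (rearrange₃ k (∑ V y)) ⟩
      2 * ((k + 2) * suc k * (k * ∑ V y)) + 2 * (k * k * S*)
        ≤⟨ +-monoˡ-≤ _ (*-monoʳ-≤ 2 (*-monoʳ-≤ ((k + 2) * suc k) total)) ⟩
      2 * ((k + 2) * suc k * (suc k * S)) + 2 * (k * k * S*) ≡⟨ rearrange₄ k S S* ⟩
      2 * ((k + 2) * (suc k * suc k) * S + k * k * S*) ∎)
      where
      open ≤-Reasoning
      S* = weight* M
      S = weight* (bestMatching (logged Γ))
      certificate = Bipartite.dual side (logged Γ) (bip ∘ logged⊆Γ Γ) (heavy ∘ logged⊆Γ Γ)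
      y = proj₁ certificate
      covers = proj₁ (proj₂ certificate)
      total = proj₂ (proj₂ certificate)
      F = sold (replay (finalLog Γ))
      sold-bound : k * (2 * S*) ≤ (k + 2) * F + 2 * S*
      sold-bound = subst (λ σ → k * (2 * S*) ≤ (k + 2) * sold σ + 2 * S*) (sym (replay-rounds Γ (k * k)))
        (matching-vs-sold Γ M M⊆ d (All.map (λ e∈ eq → bip e∈ (cong side eq)) M⊆) (>-nonZero⁻¹ k))
      rearrange₁ : ∀ k s → 2 * (k * k * k * s) ≡ k * k * (k * (2 * s))
      rearrange₁ = solve-∀
      rearrange₂ : ∀ k f s → k * k * ((k + 2) * f + 2 * s) ≡ k * (k + 2) * (k * f) + 2 * (k * k * s)
      rearrange₂ = solve-∀
      rearrange₃ : ∀ k y → k * (k + 2) * ((1 + k) * (2 * y)) ≡ 2 * ((k + 2) * (1 + k) * (k * y))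
      rearrange₃ = solve-∀
      rearrange₄ : ∀ k s t →
        2 * ((k + 2) * (1 + k) * ((1 + k) * s)) + 2 * (k * k * t) ≡ 2 *
          ((k + 2) * ((1 + k) * (1 + k)) * s + k * k * t)
      rearrange₄ = solve-∀

-- The streaming algorithm and its approximation guarantee.

module StreamingAuction where

  open import Defs
  open import Data.Fin.Base using (Fin; fromℕ<)
  open import Data.Fin.Properties using (toℕ-fromℕ<)
  open import Data.Integer.Base as ℤ using (+_; ∣_∣; +≤+)
  import Data.Integer.Properties as ℤ
  open import Data.List.Base as List using (List; []; _∷_; map; foldl; foldr)
  open import Data.List.Membership.Propositional using (_∈_)
  open import Data.List.Membership.Propositional.Properties using (∈-map⁺; ∈-map⁻)
  open import Data.List.Relation.Binary.Pointwise as Pointwise using (Pointwise; []; _∷_)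
  open import Data.List.Relation.Unary.All as All using (All; []; _∷_)
  import Data.List.Relation.Unary.All.Properties as All
  open import Data.List.Relation.Unary.Any using (here; there)
  open import Data.List.Relation.Unary.AllPairs as AllPairs using (AllPairs; []; _∷_)
  import Data.List.Relation.Unary.AllPairs.Properties as AllPairs
  open import Data.Maybe.Base using (Maybe; nothing)
  open import Data.Nat.Base hiding (_/_)
  open import Data.Nat.Coprimality using (1-coprimeTo) renaming (sym to coprime-sym)
  open import Data.Nat.DivMod using (_/_; m/n*n≤m; m≡m%n+[m/n]*n; m%n<n; /-monoˡ-≤; m*n/n≡m)
  open import Data.Nat.GeneralisedArithmetic using (fold)
  open import Data.Nat.Logarithm using (⌈log₂_⌉)
  open import Data.Nat.Properties
  open import Data.Nat.Tactic.RingSolver using (solve-∀)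
  open import Data.Product.Base using (_×_; _,_; proj₁; proj₂; ∃; Σ)
  open import Data.Rational.Base as ℚ using (ℚ; mkℚ; 0ℚ; 1ℚ; *≤*; ↧ₙ_; ↥_)
  import Data.Rational.Properties as ℚ
  import Data.Rational.Unnormalised.Base as ℚᵘ
  import Data.Rational.Unnormalised.Properties as ℚᵘ
  open import Data.Rational.Solver using (module +-*-Solver)
  open import Data.Sum.Base using (inj₁)
  open import Function.Base using (_∘_)
  open import Relation.Binary.PropositionalEquality
  open FiniteSums
  open CapacitatedAuction
  open Unfold
  open Encoding
  open LoggedMatchings

  fromℕ-mkℚ : ∀ k → fromℕ k ≡ mkℚ (+ k) 0 (coprime-sym (1-coprimeTo k))
  fromℕ-mkℚ k = ℚ.↥p/↧p≡p (mkℚ (+ k) 0 _)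

  fromℕ-mono-≤ : ∀ {a b} → a ≤ b → fromℕ a ℚ.≤ fromℕ b
  fromℕ-mono-≤ {a} {b} a≤b = subst₂ ℚ._≤_ (sym (fromℕ-mkℚ a)) (sym (fromℕ-mkℚ b))
    (*≤* (ℤ.*-monoʳ-≤-nonNeg (+ 1) (+≤+ a≤b)))

  fromℕ-+ : ∀ a b → fromℕ (a + b) ≡ fromℕ a ℚ.+ fromℕ b
  fromℕ-+ a b = sym (trans (cong₂ ℚ._+_ (fromℕ-mkℚ a) (fromℕ-mkℚ b))
    (cong (ℚ._/ 1) (cong₂ ℤ._+_ (ℤ.*-identityʳ (+ a)) (ℤ.*-identityʳ (+ b)))))

  fromℕ-* : ∀ a b → fromℕ (a * b) ≡ fromℕ a ℚ.* fromℕ b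
  fromℕ-* a b = sym (trans (cong₂ ℚ._*_ (fromℕ-mkℚ a) (fromℕ-mkℚ b)) (cong (ℚ._/ 1) (sym (ℤ.pos-* a b))))

  fromℕ-≥0 : ∀ a → 0ℚ ℚ.≤ fromℕ a
  fromℕ-≥0 a = fromℕ-mono-≤ {0} {a} z≤n

  fromℕ-*-≃ : ∀ k p → ℚ.toℚᵘ (fromℕ k ℚ.* p) ℚᵘ.≃ ℚᵘ.mkℚᵘ (+ k) 0 ℚᵘ.* ℚ.toℚᵘ p
  fromℕ-*-≃ k p rewrite fromℕ-mkℚ k = ℚ.toℚᵘ-homo-* (mkℚ (+ k) 0 _) p

  scale-≤ : ∀ k c p {a} → ↥ p ≡ + a → k * a ≤ c * ↧ₙ p → fromℕ k ℚ.* p ℚ.≤ fromℕ c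
  scale-≤ k c p@(mkℚ (+ a) d _) refl h = ℚ.toℚᵘ-cancel-≤ (ℚᵘ.≤-respˡ-≃ (ℚᵘ.≃-sym (fromℕ-*-≃ k p))
    (subst (λ q → ℚᵘ.mkℚᵘ (+ k) 0 ℚᵘ.* ℚ.toℚᵘ p ℚᵘ.≤ ℚ.toℚᵘ q) (sym (fromℕ-mkℚ c))
    (ℚᵘ.*≤* (subst₂ ℤ._≤_ (trans (ℤ.pos-* k a) (sym (ℤ.*-identityʳ _)))
      (trans (cong (λ x → + (c * x)) (sym (*-identityˡ (suc d)))) (ℤ.pos-* c (1 * suc d))) (+≤+ h)))))

  scale-≥ : ∀ k c p {a} → ↥ p ≡ + a → c * ↧ₙ p ≤ k * a → fromℕ c ℚ.≤ fromℕ k ℚ.* p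
  scale-≥ k c p@(mkℚ (+ a) d _) refl h = ℚ.toℚᵘ-cancel-≤ (ℚᵘ.≤-respʳ-≃ (ℚᵘ.≃-sym (fromℕ-*-≃ k p))
    (subst (λ q → ℚ.toℚᵘ q ℚᵘ.≤ ℚᵘ.mkℚᵘ (+ k) 0 ℚᵘ.* ℚ.toℚᵘ p) (sym (fromℕ-mkℚ c))
    (ℚᵘ.*≤* (subst₂ ℤ._≤_
      (trans (cong (λ x → + (c * x)) (sym (*-identityˡ (suc d)))) (ℤ.pos-* c (1 * suc d)))
      (trans (ℤ.pos-* k a) (sym (ℤ.*-identityʳ _))) (+≤+ h)))))

  fromℕ-pos : ∀ k .{{_ : NonZero k}} → ℚ.Positive (fromℕ k)
  fromℕ-pos (suc k) = subst ℚ.Positive (sym (fromℕ-mkℚ (suc k))) _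

  ∑ℚ : ∀ {A : Set} → List A → (A → ℚ) → ℚ
  ∑ℚ xs f = foldr ℚ._+_ 0ℚ (map f xs)

  ∑ℚ-≤ : ∀ {A : Set} {xs : List A} (κ : ℚ) (f : A → ℚ) (g : A → ℕ) →
         (∀ {x} → x ∈ xs → κ ℚ.* f x ℚ.≤ fromℕ (g x)) → κ ℚ.* ∑ℚ xs f ℚ.≤ fromℕ (∑ xs g)
  ∑ℚ-≤ {xs = []} κ f g h = ℚ.≤-reflexive (ℚ.*-zeroʳ κ)
  ∑ℚ-≤ {xs = x ∷ xs} κ f g h = begin
    κ ℚ.* (f x ℚ.+ ∑ℚ xs f) ≡⟨ ℚ.*-distribˡ-+ κ (f x) _ ⟩
    κ ℚ.* f x ℚ.+ κ ℚ.* ∑ℚ xs f ≤⟨ ℚ.+-mono-≤ (h (here refl)) (∑ℚ-≤ κ f g (h ∘ there)) ⟩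
    fromℕ (g x) ℚ.+ fromℕ (∑ xs g) ≡⟨ fromℕ-+ (g x) _ ⟨
    fromℕ (g x + ∑ xs g) ∎
    where open ℚ.≤-Reasoning

  ∑ℚ-≥ : ∀ {A : Set} {xs : List A} (κ : ℚ) (f : A → ℚ) (g : A → ℕ) →
         (∀ {x} → x ∈ xs → fromℕ (g x) ℚ.≤ κ ℚ.* f x) → fromℕ (∑ xs g) ℚ.≤ κ ℚ.* ∑ℚ xs f
  ∑ℚ-≥ {xs = []} κ f g h = ℚ.≤-reflexive (sym (ℚ.*-zeroʳ κ))
  ∑ℚ-≥ {xs = x ∷ xs} κ f g h = begin
    fromℕ (g x + ∑ xs g) ≡⟨ fromℕ-+ (g x) _ ⟩
    fromℕ (g x) ℚ.+ fromℕ (∑ xs g) ≤⟨ ℚ.+-mono-≤ (h (here refl)) (∑ℚ-≥ κ f g (h ∘ there)) ⟩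
    κ ℚ.* f x ℚ.+ κ ℚ.* ∑ℚ xs f ≡⟨ ℚ.*-distribˡ-+ κ (f x) _ ⟨
    κ ℚ.* (f x ℚ.+ ∑ℚ xs f) ∎
    where open ℚ.≤-Reasoning

  ∑ℚ-≥0 : ∀ {A : Set} {xs : List A} (f : A → ℚ) → (∀ {x} → x ∈ xs → 0ℚ ℚ.≤ f x) → 0ℚ ℚ.≤ ∑ℚ xs f
  ∑ℚ-≥0 {xs = []} f h = ℚ.≤-refl
  ∑ℚ-≥0 {xs = x ∷ xs} f h =
    ℚ.≤-trans (ℚ.≤-reflexive (sym (ℚ.+-identityˡ 0ℚ))) (ℚ.+-mono-≤ (h (here refl)) (∑ℚ-≥0 f (h ∘ there)))

  -- The log holds rounded edges; this recovers edges of the stream, with exact weights, behind the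
  -- output.
  preimage : ∀ {A B : Set} (f : A → B) {xs ys} → All (_∈ map f xs) ys → ∃ λ zs →
    All (_∈ xs) zs × ys ≡ map f zs
  preimage f [] = [] , [] , refl
  preimage f (y∈ ∷ ys⊆) with ∈-map⁻ f y∈ | preimage f ys⊆
  ... | x , x∈ , refl | zs , zs⊆ , refl = x ∷ zs , x∈ ∷ zs⊆ , refl

  -- The integer `r` is `k * w` rounded down. As `k ≤ r`, the loss of at most one unit is a fraction
  -- of at most 1/`k` of `r`.
  record RoundedWeight (k W : ℕ) (w : ℚ) (r : ℕ) : Set where
    field
      lower  : k ≤ r
      upper  : r ≤ k * W
      below  : fromℕ r ℚ.≤ fromℕ k ℚ.* w
      above  : fromℕ k ℚ.* w ℚ.≤ fromℕ (suc r)
      w≥0    : 0ℚ ℚ.≤ w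

  numerator : ∀ W {w} → 1ℚ ℚ.≤ w → w ℚ.≤ fromℕ W → ∃ λ a → ↥ w ≡ + a × ↧ₙ w ≤ a × a ≤ W * ↧ₙ w
  numerator W {mkℚ (ℤ.-[1+ _ ]) d _} (*≤* ()) _
  numerator W {w@(mkℚ (+ a) d _)} (*≤* 1≤w) w≤W with subst (w ℚ.≤_) (fromℕ-mkℚ W) w≤W
  ... | *≤* w≤W′ = a , refl ,
    ℤ.drop‿+≤+ (subst₂ ℤ._≤_ (ℤ.*-identityˡ _) (ℤ.*-identityʳ _) 1≤w) ,
    ℤ.drop‿+≤+ (subst₂ ℤ._≤_ (ℤ.*-identityʳ _) (sym (ℤ.pos-* W (suc d))) w≤W′)

  roundedWeight : ∀ k W {w} → 1ℚ ℚ.≤ w → w ℚ.≤ fromℕ W → RoundedWeight k W w (k * ∣ ↥ w ∣ / ↧ₙ w)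
  roundedWeight k W {w} 1≤w w≤W with numerator W 1≤w w≤W
  ... | a , num , D≤a , a≤WD = record
    { lower = subst (_≤ r) (m*n/n≡m k D) (/-monoˡ-≤ D (≤-trans (*-monoʳ-≤ k D≤a) ka≤))
    ; upper =
      subst (r ≤_) (m*n/n≡m (k * W) D)
        (/-monoˡ-≤ D (≤-trans ≤ka (≤-trans (*-monoʳ-≤ k a≤WD) (≤-reflexive (sym (*-assoc k W D))))))
    ; below = scale-≥ k r w num (≤-trans (m/n*n≤m (k * ∣ ↥ w ∣) D) ≤ka)
    ; above = scale-≤ k (suc r) w num (≤-trans ka≤ (≤-trans (≤-reflexive (m≡m%n+[m/n]*n (k * ∣ ↥ w ∣) D))
                (+-monoˡ-≤ (r * D) (<⇒≤ (m%n<n (k * ∣ ↥ w ∣) D)))))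
    ; w≥0 = ℚ.≤-trans (*≤* (+≤+ z≤n)) 1≤w }
    where
    D = ↧ₙ w
    r = k * ∣ ↥ w ∣ / D
    ≤ka : k * ∣ ↥ w ∣ ≤ k * a
    ≤ka = ≤-reflexive (cong (λ x → k * ∣ x ∣) num)
    ka≤ : k * a ≤ k * ∣ ↥ w ∣
    ka≤ = ≤-reflexive (cong (λ x → k * ∣ x ∣) (sym num))

  -- Rests on (k - 6)(k + 1)³(k + 2) ≤ (k - 1)k⁴.
  collect-losses : ∀ k j → k ≡ 6 + j → ∀ S S* →
    k * k * k * S* ≤ (k + 2) * (suc k * suc k) * S + k * k * S* → j * (suc k * S*) ≤ k * k * S
  collect-losses k@(suc _) j eq S S* h = *-cancelˡ-≤ ((k + 2) * (suc k * suc k)) (begin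
    (k + 2) * (suc k * suc k) * (j * (suc k * S*)) ≤⟨ m≤m+n _ _ ⟩
    -- With `j = k - 6`, the added cubic is exactly the difference of the two sides of the
    -- inequality on which the lemma rests; the terms of degree 5 and 4 cancel.
    (k + 2) * (suc k * suc k) * (j * (suc k * S*)) + (21 * (k * k * k) + 47 * (k * k) + 40 * k + 12) * S*
      ≡⟨ polynomial k j eq S* ⟩
    k * k * ((5 + j) * (k * k) * S*) ≤⟨ *-monoʳ-≤ (k * k) cancelled ⟩
    k * k * ((k + 2) * (suc k * suc k) * S) ≡⟨ swap (k * k) ((k + 2) * (suc k * suc k)) S ⟩
    (k + 2) * (suc k * suc k) * (k * k * S) ∎)
    where
    open ≤-Reasoning
    polynomial′ : ∀ j s → (6 + j + 2) * ((7 + j) * (7 + j)) * (j * ((7 + j) * s))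
      + (21 * ((6 + j) * (6 + j) * (6 + j)) + 47 * ((6 + j) * (6 + j)) + 40 * (6 + j) + 12) * s
      ≡ (6 + j) * (6 + j) * ((5 + j) * ((6 + j) * (6 + j)) * s)
    polynomial′ = solve-∀
    polynomial : ∀ k j → k ≡ 6 + j → ∀ s →
      (k + 2) * (suc k * suc k) * (j * (suc k * s)) + (21 * (k * k * k) + 47 * (k * k) + 40 * k + 12) * s
      ≡ k * k * ((5 + j) * (k * k) * s)
    polynomial _ j refl s = polynomial′ j s
    split′ : ∀ j s →
      (5 + j) * ((6 + j) * (6 + j)) * s + (6 + j) * (6 + j) * s ≡ (6 + j) * (6 + j) * (6 + j) * s
    split′ = solve-∀
    split : ∀ k j → k ≡ 6 + j → ∀ s → (5 + j) * (k * k) * s + k * k * s ≡ k * k * k * s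
    split _ j refl s = split′ j s
    cancelled : (5 + j) * (k * k) * S* ≤ (k + 2) * (suc k * suc k) * S
    cancelled = +-cancelʳ-≤ (k * k * S*) ((5 + j) * (k * k) * S*) ((k + 2) * (suc k * suc k) * S)
      (≤-trans (≤-reflexive (split k j eq S*)) h)
    swap : ∀ a b c → a * (b * c) ≡ b * (a * c)
    swap = solve-∀

  module Streaming (l k W Q m : ℕ) {{_ : NonZero k}}
    (H≤bnd : k * W ≤ Grouping.bnd k Q)
    (0<L : 0 < ⌈log₂ suc l ⌉) (n≤2^L : suc l ≤ 2 ^ ⌈log₂ suc l ⌉)
    (H<2^Lm : suc (k * W) ≤ (2 ^ ⌈log₂ suc l ⌉) ^ m) where

    n H T : ℕ
    n = suc l
    H = k * W
    T = k * k

    open Unfolding n k H Q H≤bnd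
    open Matchings {n} {k} {H} {Q} H≤bnd
    open Coding ⌈log₂ n ⌉

    units : ℚ → ℕ
    units w = k * ∣ ↥ w ∣ / ↧ₙ w

    -- The minimum with `H` makes the function total on arbitrary weights; a weight of at most `W`
    -- is not changed by it.
    roundEdge : Edge n → REdge n H
    roundEdge e = source e , target e , fromℕ< (s≤s (m⊓n≤n (units (weight e)) H))

    vertexCode : Code (Fin n) 1
    vertexCode = finCode (≤-trans n≤2^L (≤-reflexive (sym (*-identityʳ _))))

    -- The inner `Maybe` distinguishes edges from round markers, the outer one marks the end of the
    -- list. Two tags, two vertices and `m` words of weight make `4 + m`.
    entryCode : Code (Maybe (Maybe (REdge n H))) (4 + m)
    entryCode = maybeCode 0<L (maybeCode 0<L (pairCode vertexCode (pairCode vertexCode (finCode H<2^Lm))))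

    open BoundedList entryCode

    N : ℕ
    N = logBound T

    algorithm : StreamingAlgorithm n (N * (4 + m))
    algorithm = record
      { init    = encodeList N []
      ; step    = λ mem e → encodeList N (recordEdge (decodeList N mem) (roundEdge e))
      ; endPass = λ mem → encodeList N (nothing ∷ decodeList N mem)
      ; output  = λ mem → map (λ (u , v , _) → u , v) (bestMatching (List.catMaybes (decodeList N mem)))
      }

    open StreamingAlgorithm algorithm using (init; pass; endPass)

    decode-log : ∀ L → Bounded L → #rounds L ≤ T → decodeList N (encodeList N L) ≡ L
    decode-log L b r = decode-encodeList N L (bounded⇒length L T b r)

    bounded-recordEdges : ∀ L Γ → Bounded L → Bounded (foldl recordEdge L Γ)
    bounded-recordEdges L [] b = b
    bounded-recordEdges L (e ∷ Γ) b = bounded-recordEdges (recordEdge L e) Γ (bounded-recordEdge L e b)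

    steps-simulate : ∀ L G → Bounded L → #rounds L ≤ T →
                     foldl (StreamingAlgorithm.step algorithm) (encodeList N L) G ≡ encodeList N
                       (foldl recordEdge L (map roundEdge G))
    steps-simulate L [] b r = refl
    steps-simulate L (e ∷ G) b r = trans
      (cong (λ L′ → foldl (StreamingAlgorithm.step algorithm)
        (encodeList N (recordEdge L′ (roundEdge e))) G) (decode-log L b r))
      (steps-simulate (recordEdge L (roundEdge e)) G (bounded-recordEdge L (roundEdge e) b)
        (≤-trans (≤-reflexive (#rounds-recordEdge L (roundEdge e))) r))

    module _ (G : Stream n) where

      Γ : List (REdge n H)
      Γ = map roundEdge G

      logAfter : ℕ → Log
      logAfter i = fold [] (recordRound Γ) i

      bounded-logAfter : ∀ i → Bounded (logAfter i)
      bounded-logAfter zero = bounded-[]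
      bounded-logAfter (suc i) =
        bounded-nothing (foldl recordEdge (logAfter i) Γ)
          (bounded-recordEdges (logAfter i) Γ (bounded-logAfter i))

      #rounds-logAfter : ∀ i → #rounds (logAfter i) ≡ i
      #rounds-logAfter zero = refl
      #rounds-logAfter (suc i) = cong suc (trans (#rounds-recordEdges (logAfter i) Γ) (#rounds-logAfter i))

      -- Limited to `i ≤ T` because `N` is dimensioned for logs of at most `T` rounds; a longer log
      -- might be cut off.
      passes-simulate : ∀ i → i ≤ T → fold init (pass G) i ≡ encodeList N (logAfter i)
      passes-simulate zero _ = refl
      passes-simulate (suc i) i<T = begin
        pass G (fold init (pass G) i) ≡⟨ cong (pass G) (passes-simulate i (<⇒≤ i<T)) ⟩
        pass G (encodeList N (logAfter i))
          ≡⟨ cong endPass (steps-simulate (logAfter i) G (bounded-logAfter i) i≤T) ⟩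
        encodeList N (nothing ∷ decodeList N (encodeList N L))
          ≡⟨ cong (λ L′ → encodeList N (nothing ∷ L′)) (decode-log L b r) ⟩
        encodeList N (logAfter (suc i)) ∎
        where
        open ≡-Reasoning
        L = foldl recordEdge (logAfter i) Γ
        i≤T : #rounds (logAfter i) ≤ T
        i≤T = ≤-trans (≤-reflexive (#rounds-logAfter i)) (<⇒≤ i<T)
        b = bounded-recordEdges (logAfter i) Γ (bounded-logAfter i)
        r : #rounds L ≤ T
        r = ≤-trans (≤-reflexive (#rounds-recordEdges (logAfter i) Γ)) i≤T

      run-output : run algorithm T G ≡ map (λ (u , v , _) → u , v) (bestMatching (logged Γ))
      run-output = cong (λ L → map (λ (u , v , _) → u , v) (bestMatching (List.catMaybes L)))
        (trans (cong (decodeList N) (passes-simulate T ≤-refl))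
               (decode-log (logAfter T) (bounded-logAfter T) (≤-reflexive (#rounds-logAfter T))))

    module _ (j : ℕ) (k≡6+j : k ≡ 6 + j) {ε : ℚ} (6≤kε : fromℕ 6 ℚ.≤ fromℕ k ℚ.* ε)
             (G : Stream n) (graph : IsBipartiteGraph W G) where

      open IsBipartiteGraph graph

      wtᴿ-units : ∀ {e} → e ∈ G → RoundedWeight k W (weight e) (wtᴿ (roundEdge e))
      wtᴿ-units {e} e∈ with All.lookup weights e∈
      ... | 1≤w , w≤W = subst (RoundedWeight k W (weight e))
        (sym (trans (toℕ-fromℕ< _) (m≤n⇒m⊓n≡m (RoundedWeight.upper rw)))) rw
        where rw = roundedWeight k W 1≤w w≤W

      side : Fin n → _
      side = proj₁ bipartite

      bip : ∀ {u v w} → (u , v , w) ∈ Γ G → side u ≢ side v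
      bip r∈ with ∈-map⁻ roundEdge r∈
      ... | e , e∈ , refl = All.lookup (proj₂ bipartite) e∈

      heavy : ∀ {r} → r ∈ Γ G → k ≤ wtᴿ r
      heavy r∈ with ∈-map⁻ roundEdge r∈
      ... | e , e∈ , refl = RoundedWeight.lower (wtᴿ-units e∈)

      best : List (REdge n H)
      best = bestMatching (logged (Γ G))

      found : ∃ λ M → All (_∈ G) M × best ≡ map roundEdge M
      found = preimage roundEdge (All.map (logged⊆Γ (Γ G)) (proj₁ (bestMatching-valid (logged (Γ G)))))

      M : List (Edge n)
      M = proj₁ found

      M-matching : IsMatching G M
      M-matching = record { inGraph = proj₁ (proj₂ found)
        ; disjoint =
          AllPairs.map⁻ (subst (AllPairs VertexDisjointᴿ) (proj₂ (proj₂ found))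
            (proj₂ (bestMatching-valid (logged (Γ G))))) }

      total-below : ∀ M R → All (_∈ G) M → R ≡ map roundEdge M →
        fromℕ (weight* R) ℚ.≤ fromℕ k ℚ.* totalWeight M
      total-below M _ M⊆G refl =
        subst (λ s → fromℕ s ℚ.≤ fromℕ k ℚ.* totalWeight M) (sym (∑-map roundEdge M wtᴿ))
        (∑ℚ-≥ {xs = M} (fromℕ k) weight (wtᴿ ∘ roundEdge) λ e∈ → RoundedWeight.below
          (wtᴿ-units (All.lookup M⊆G e∈)))

      output-M : Pointwise SamePair (run algorithm T G) (map endpoints M)
      output-M = subst (λ ps → Pointwise SamePair ps (map endpoints M))
        (sym (trans (run-output G) (cong (map _) (proj₂ (proj₂ found))))) (same M)
        where
        same : ∀ M → Pointwise SamePair (map (λ (u , v , _) → u , v) (map roundEdge M)) (map endpoints M)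
        same [] = []
        same (e ∷ M) = inj₁ (refl , refl) ∷ same M

      -- Of the three factors `κ`, one turns `1ℚ - ε` into at most `j`, one converts the weights
      -- into units, and one pays for rounding the optimum. `collect-losses` then compares the
      -- integral sums.
      approximates : ∀ M* → IsMatching G M* → (1ℚ ℚ.- ε) ℚ.* totalWeight M* ℚ.≤ totalWeight M
      approximates M* matching = ℚ.*-cancelˡ-≤-pos (κ ℚ.* κ ℚ.* κ) {{pos³}} (begin
        κ ℚ.* κ ℚ.* κ ℚ.* ((1ℚ ℚ.- ε) ℚ.* W*) ≡⟨ expand κ ε W* ⟩
        κ ℚ.* κ ℚ.* ((κ ℚ.- κ ℚ.* ε) ℚ.* W*)
          ≤⟨ ℚ.*-monoˡ-≤-nonNeg (κ ℚ.* κ) {{pos²-nonNeg}}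
            (ℚ.*-monoʳ-≤-nonNeg W* {{ℚ.nonNegative W*≥0}} slack) ⟩
        κ ℚ.* κ ℚ.* (fromℕ j ℚ.* W*) ≡⟨ regroupℚ κ (fromℕ j) W* ⟩
        fromℕ j ℚ.* (κ ℚ.* (κ ℚ.* W*))
          ≤⟨ ℚ.*-monoˡ-≤-nonNeg (fromℕ j) {{ℚ.nonNegative (fromℕ-≥0 j)}} optimum ⟩
        fromℕ j ℚ.* fromℕ (suc k * S*) ≡⟨ fromℕ-* j (suc k * S*) ⟨
        fromℕ (j * (suc k * S*)) ≤⟨ fromℕ-mono-≤ losses ⟩
        fromℕ (k * k * S) ≡⟨ trans (fromℕ-* (k * k) S) (cong (ℚ._* fromℕ S) (fromℕ-* k k)) ⟩
        κ ℚ.* κ ℚ.* fromℕ S ≤⟨ ℚ.*-monoˡ-≤-nonNeg (κ ℚ.* κ) {{pos²-nonNeg}} output ⟩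
        κ ℚ.* κ ℚ.* (κ ℚ.* totalWeight M) ≡⟨ ℚ.*-assoc (κ ℚ.* κ) κ _ ⟨
        κ ℚ.* κ ℚ.* κ ℚ.* totalWeight M ∎)
        where
        open ℚ.≤-Reasoning
        κ = fromℕ k
        W* = totalWeight M*
        S* = weight* (map roundEdge M*)
        S = weight* best
        module M* = IsMatching matching
        instance
          κ-pos : ℚ.Positive κ
          κ-pos = fromℕ-pos k
        pos² : ℚ.Positive (κ ℚ.* κ)
        pos² = ℚ.pos*pos⇒pos κ κ
        pos³ : ℚ.Positive (κ ℚ.* κ ℚ.* κ)
        pos³ = ℚ.pos*pos⇒pos (κ ℚ.* κ) {{pos²}} κ
        pos²-nonNeg : ℚ.NonNegative (κ ℚ.* κ)
        pos²-nonNeg = ℚ.pos⇒nonNeg (κ ℚ.* κ) {{pos²}}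
        open +-*-Solver
        expand : ∀ κ ε w → κ ℚ.* κ ℚ.* κ ℚ.* ((1ℚ ℚ.- ε) ℚ.* w) ≡ κ ℚ.* κ ℚ.* ((κ ℚ.- κ ℚ.* ε) ℚ.* w)
        expand =
          solve 3 (λ κ ε w → κ :* κ :* κ :* ((con 1ℚ :- ε) :* w) := κ :* κ :* ((κ :- κ :* ε) :* w)) refl
        regroupℚ : ∀ κ j w → κ ℚ.* κ ℚ.* (j ℚ.* w) ≡ j ℚ.* (κ ℚ.* (κ ℚ.* w))
        regroupℚ = solve 3 (λ κ j w → κ :* κ :* (j :* w) := j :* (κ :* (κ :* w))) refl
        W*≥0 : 0ℚ ℚ.≤ W*
        W*≥0 = ∑ℚ-≥0 weight λ e∈ → RoundedWeight.w≥0 (wtᴿ-units (All.lookup M*.inGraph e∈))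
        slack : κ ℚ.- κ ℚ.* ε ℚ.≤ fromℕ j
        slack = begin
          κ ℚ.- κ ℚ.* ε ≤⟨ ℚ.+-monoʳ-≤ κ (ℚ.neg-antimono-≤ 6≤kε) ⟩
          κ ℚ.- fromℕ 6 ≡⟨ cong (ℚ._- fromℕ 6) (trans (cong fromℕ k≡6+j) (fromℕ-+ 6 j)) ⟩
          fromℕ 6 ℚ.+ fromℕ j ℚ.- fromℕ 6 ≡⟨ cancel (fromℕ 6) (fromℕ j) ⟩
          fromℕ j ∎
          where
          cancel : ∀ a b → a ℚ.+ b ℚ.- a ≡ b
          cancel = solve 2 (λ a b → a :+ b :- a := b) refl
        units-sum : κ ℚ.* W* ℚ.≤ fromℕ (∑[ e ∈ M* ] suc (wtᴿ (roundEdge e)))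
        units-sum = ∑ℚ-≤ κ weight _ λ e∈ → RoundedWeight.above (wtᴿ-units (All.lookup M*.inGraph e∈))
        heavy-sum : k * (∑[ e ∈ M* ] suc (wtᴿ (roundEdge e))) ≤ suc k * S*
        heavy-sum = ≤-trans (≤-reflexive (sym (∑-*ˡ k M* _))) (≤-trans
          (∑-mono M* λ {e} e∈ → ≤-trans (≤-reflexive (*-suc k _))
            (+-monoˡ-≤ (k * wtᴿ (roundEdge e))
              (RoundedWeight.lower (wtᴿ-units (All.lookup M*.inGraph e∈)))))
          (≤-reflexive (trans (∑-*ˡ (suc k) M* _) (cong (suc k *_) (sym (∑-map roundEdge M* wtᴿ))))))
        optimum : κ ℚ.* (κ ℚ.* W*) ℚ.≤ fromℕ (suc k * S*)
        optimum = begin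
          κ ℚ.* (κ ℚ.* W*) ≤⟨ ℚ.*-monoˡ-≤-nonNeg κ {{ℚ.nonNegative (fromℕ-≥0 k)}} units-sum ⟩
          κ ℚ.* fromℕ (∑[ e ∈ M* ] suc (wtᴿ (roundEdge e))) ≡⟨ fromℕ-* k _ ⟨
          fromℕ (k * (∑[ e ∈ M* ] suc (wtᴿ (roundEdge e)))) ≤⟨ fromℕ-mono-≤ heavy-sum ⟩
          fromℕ (suc k * S*) ∎
        output : fromℕ S ℚ.≤ κ ℚ.* totalWeight M
        output = total-below M best (proj₁ (proj₂ found)) (proj₂ (proj₂ found))
        losses : j * (suc k * S*) ≤ k * k * S
        losses = collect-losses k j k≡6+j S S*
          (logged-approximates side (Γ G) bip heavy
            (All.map⁺ (All.map (∈-map⁺ roundEdge) M*.inGraph)) (AllPairs.map⁺ M*.disjoint))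

    abstract
      solution : ∀ ε j → k ≡ 6 + j → fromℕ 6 ℚ.≤ fromℕ k ℚ.* ε →
                 Σ (StreamingAlgorithm n (N * (4 + m))) (SolvesApproxMWM ε W T)
      solution ε j k≡ 6≤kε = algorithm , λ G graph → M j k≡ 6≤kε G graph , output-M j k≡ 6≤kε G graph ,
        M-matching j k≡ 6≤kε G graph , approximates j k≡ 6≤kε G graph

-- Powers, logarithms and the scale of `k`.

module Arithmetic where

  open import Defs
  open import Data.Integer.Base as ℤ using (+_; ∣_∣)
  import Data.Integer.Properties as ℤ
  open import Data.Nat.Base hiding (_/_; _%_)
  open import Data.Nat.DivMod using (_/_; _%_; m/n*n≤m; m≡m%n+[m/n]*n; m%n<n)
  open import Data.Nat.Induction using (<-rec)
  open import Data.Nat.Logarithm using (⌈log₂_⌉; ⌈log₂⌉-mono-≤; ⌈log₂⌈n/2⌉⌉≡⌈log₂n⌉∸1)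
  open import Data.Nat.Properties
  open import Data.Nat.Tactic.RingSolver using (solve-∀)
  open import Data.Product.Base using (_×_; _,_; ∃)
  open import Data.Rational.Base as ℚ using (ℚ; mkℚ; 0ℚ; 1ℚ; *≤*; *<*; ↧ₙ_; ↥_)
  import Data.Rational.Properties as ℚ
  open import Data.Rational.Solver using (module +-*-Solver)
  open import Data.Sum.Base using (_⊎_; inj₁; inj₂)
  open import Relation.Binary.PropositionalEquality
  open import Relation.Nullary.Decidable.Core using (yes; no)
  open import Relation.Nullary.Negation.Core using (contradiction)
  open StreamingAuction using (fromℕ-mkℚ; fromℕ-mono-≤; fromℕ-*; fromℕ-≥0; scale-≥)

  ^-distrib-* : ∀ a b e → (a * b) ^ e ≡ a ^ e * b ^ e
  ^-distrib-* a b zero = refl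
  ^-distrib-* a b (suc e) = trans (cong (a * b *_) (^-distrib-* a b e)) (rearrange a b (a ^ e) (b ^ e))
    where
    rearrange : ∀ a b c d → a * b * (c * d) ≡ a * c * (b * d)
    rearrange = solve-∀

  n<2^n : ∀ n → n < 2 ^ n
  n<2^n zero = z<s
  n<2^n (suc n) = begin-strict
    suc n ≤⟨ n<2^n n ⟩
    2 ^ n <⟨ m<m+n (2 ^ n) (≤-trans (≤-<-trans z≤n (n<2^n n)) (m≤m+n (2 ^ n) 0)) ⟩
    2 * 2 ^ n ∎
    where open ≤-Reasoning

  n≤2^⌈log₂n⌉ : ∀ n → n ≤ 2 ^ ⌈log₂ n ⌉
  n≤2^⌈log₂n⌉ = <-rec _ λ
    { zero _ → z≤n
    ; (suc zero) _ → ≤-refl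
    ; n@(suc (suc n-2)) rec → begin
        n ≡⟨ ⌊n/2⌋+⌈n/2⌉≡n n ⟨
        ⌊ n /2⌋ + ⌈ n /2⌉
          ≤⟨ +-mono-≤ (≤-trans (⌊n/2⌋≤⌈n/2⌉ n) (rec (⌈n/2⌉<n n-2)))
            (≤-trans (rec (⌈n/2⌉<n n-2)) (m≤m+n _ 0)) ⟩
        2 ^ suc ⌈log₂ ⌈ n /2⌉ ⌉ ≡⟨ cong (λ x → 2 ^ suc x) (⌈log₂⌈n/2⌉⌉≡⌈log₂n⌉∸1 n) ⟩
        2 ^ suc (⌈log₂ n ⌉ ∸ 1) ≡⟨ cong (2 ^_) (m+[n∸m]≡n {1} (⌈log₂⌉-mono-≤ {2} {n} (s≤s (s≤s z≤n)))) ⟩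
        2 ^ ⌈log₂ n ⌉ ∎ }
    where open ≤-Reasoning

  -- From q < 2^q for the quotient q of `l` by `m`. With `k = 2 ^ l` it trades any fixed power of
  -- log `k` for a constant and a single factor `k`.
  power≤exponential : ∀ m .{{_ : NonZero m}} l → l ^ m ≤ m ^ m * 2 ^ l
  power≤exponential m l = begin
    l ^ m ≤⟨ ^-monoˡ-≤ m l≤ ⟩
    (m * 2 ^ (l / m)) ^ m ≡⟨ ^-distrib-* m (2 ^ (l / m)) m ⟩
    m ^ m * (2 ^ (l / m)) ^ m ≡⟨ cong (m ^ m *_) (^-*-assoc 2 (l / m) m) ⟩
    m ^ m * 2 ^ (l / m * m) ≤⟨ *-monoʳ-≤ (m ^ m) (^-monoʳ-≤ 2 (m/n*n≤m l m)) ⟩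
    m ^ m * 2 ^ l ∎
    where
    open ≤-Reasoning
    l≤ : l ≤ m * 2 ^ (l / m)
    l≤ = begin
      l ≡⟨ m≡m%n+[m/n]*n l m ⟩
      l % m + l / m * m ≤⟨ +-monoˡ-≤ _ (<⇒≤ (m%n<n l m)) ⟩
      suc (l / m) * m ≤⟨ *-monoˡ-≤ m (n<2^n (l / m)) ⟩
      2 ^ (l / m) * m ≡⟨ *-comm (2 ^ (l / m)) m ⟩
      m * 2 ^ (l / m) ∎

  fromℕ-cancel-≤ : ∀ {a b} → fromℕ a ℚ.≤ fromℕ b → a ≤ b
  fromℕ-cancel-≤ {a} {b} h with subst₂ ℚ._≤_ (fromℕ-mkℚ a) (fromℕ-mkℚ b) h
  ... | *≤* h′ = ℤ.drop‿+≤+ (subst₂ ℤ._≤_ (ℤ.*-identityʳ (+ a)) (ℤ.*-identityʳ (+ b)) h′)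

  fromℕ-^ : ∀ a e → fromℕ a ^ℚ e ≡ fromℕ (a ^ e)
  fromℕ-^ a zero = refl
  fromℕ-^ a (suc e) = trans (cong (fromℕ a ℚ.*_) (fromℕ-^ a e)) (sym (fromℕ-* a (a ^ e)))

  ^ℚ-nonNeg : ∀ x {{_ : ℚ.NonNegative x}} e → ℚ.NonNegative (x ^ℚ e)
  ^ℚ-nonNeg x zero = _
  ^ℚ-nonNeg x (suc e) = ℚ.nonNeg*nonNeg⇒nonNeg x (x ^ℚ e) {{^ℚ-nonNeg x e}}

  ^ℚ-distrib-* : ∀ x y e → (x ℚ.* y) ^ℚ e ≡ x ^ℚ e ℚ.* y ^ℚ e
  ^ℚ-distrib-* x y zero = refl
  ^ℚ-distrib-* x y (suc e) =
    trans (cong (x ℚ.* y ℚ.*_) (^ℚ-distrib-* x y e)) (rearrange x y (x ^ℚ e) (y ^ℚ e))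
    where
    open +-*-Solver
    rearrange : ∀ a b c d → a ℚ.* b ℚ.* (c ℚ.* d) ≡ a ℚ.* c ℚ.* (b ℚ.* d)
    rearrange = solve 4 (λ a b c d → a :* b :* (c :* d) := a :* c :* (b :* d)) refl

  ^ℚ-monoˡ-≤ : ∀ {x y} {{_ : ℚ.NonNegative x}} {{_ : ℚ.NonNegative y}} e → x ℚ.≤ y → x ^ℚ e ℚ.≤ y ^ℚ e
  ^ℚ-monoˡ-≤ zero x≤y = ℚ.≤-refl
  ^ℚ-monoˡ-≤ {x} {y} (suc e) x≤y = ℚ.≤-trans
    (ℚ.*-monoˡ-≤-nonNeg x (^ℚ-monoˡ-≤ e x≤y))
    (ℚ.*-monoʳ-≤-nonNeg (y ^ℚ e) {{^ℚ-nonNeg y e}} x≤y)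

  ^ℚ-antimonoʳ-≤ : ∀ {x} {{_ : ℚ.NonNegative x}} → x ℚ.≤ 1ℚ → ∀ {d e} → d ≤ e → x ^ℚ e ℚ.≤ x ^ℚ d
  ^ℚ-antimonoʳ-≤ {x} x≤1 {zero} {zero} z≤n = ℚ.≤-refl
  ^ℚ-antimonoʳ-≤ {x} x≤1 {zero} {suc e} z≤n = ℚ.≤-trans
    (ℚ.*-monoʳ-≤-nonNeg (x ^ℚ e) {{^ℚ-nonNeg x e}} x≤1)
    (ℚ.≤-trans (ℚ.≤-reflexive (ℚ.*-identityˡ _)) (^ℚ-antimonoʳ-≤ x≤1 {zero} {e} z≤n))
  ^ℚ-antimonoʳ-≤ {x} x≤1 (s≤s d≤e) = ℚ.*-monoˡ-≤-nonNeg x (^ℚ-antimonoʳ-≤ x≤1 d≤e)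

  module _ {ε : ℚ} (0<ε : 0ℚ ℚ.< ε) (ε<1 : ε ℚ.< 1ℚ) where

    private
      ε-nonNeg : ℚ.NonNegative ε
      ε-nonNeg = ℚ.nonNegative (ℚ.<⇒≤ 0<ε)
      nonNeg : ∀ a → ℚ.NonNegative (fromℕ a)
      nonNeg a = ℚ.nonNegative (fromℕ-≥0 a)

    -- Since ε < 1, the exponent of ε may be lowered to that of `k`; then each ε is paired with one
    -- `k`, and each pair is at most 12.
    atMost : ∀ {x y r} k D e → fromℕ k ℚ.* ε ℚ.≤ fromℕ 12 → e ≤ ∣ ↥ r ∣ →
             x ^ ↧ₙ r ≤ D * k ^ e → D * 12 ^ e ≤ y ^ ↧ₙ r → AtMostTimesInversePower x y ε r
    atMost {x} {y} {r} k D e kε≤12 e≤ x≤ ≤y = begin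
      fromℕ x ^ℚ b ℚ.* ε ^ℚ a
        ≤⟨ ℚ.*-monoˡ-≤-nonNeg (fromℕ x ^ℚ b) {{^ℚ-nonNeg (fromℕ x) {{nonNeg x}} b}}
          (^ℚ-antimonoʳ-≤ {{ε-nonNeg}} (ℚ.<⇒≤ ε<1) e≤) ⟩
      fromℕ x ^ℚ b ℚ.* ε ^ℚ e ≡⟨ cong (ℚ._* ε ^ℚ e) (fromℕ-^ x b) ⟩
      fromℕ (x ^ b) ℚ.* ε ^ℚ e
        ≤⟨ ℚ.*-monoʳ-≤-nonNeg (ε ^ℚ e) {{^ℚ-nonNeg ε {{ε-nonNeg}} e}} (fromℕ-mono-≤ x≤) ⟩
      fromℕ (D * k ^ e) ℚ.* ε ^ℚ e
        ≡⟨ cong (ℚ._* ε ^ℚ e) (trans (fromℕ-* D (k ^ e)) (cong (fromℕ D ℚ.*_) (sym (fromℕ-^ k e)))) ⟩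
      fromℕ D ℚ.* fromℕ k ^ℚ e ℚ.* ε ^ℚ e ≡⟨ ℚ.*-assoc (fromℕ D) _ _ ⟩
      fromℕ D ℚ.* (fromℕ k ^ℚ e ℚ.* ε ^ℚ e) ≡⟨ cong (fromℕ D ℚ.*_) (^ℚ-distrib-* (fromℕ k) ε e) ⟨
      fromℕ D ℚ.* (fromℕ k ℚ.* ε) ^ℚ e ≤⟨ ℚ.*-monoˡ-≤-nonNeg (fromℕ D) {{nonNeg D}}
        (^ℚ-monoˡ-≤ {{ℚ.nonNeg*nonNeg⇒nonNeg
          (fromℕ k) {{nonNeg k}} ε {{ε-nonNeg}}}} {{nonNeg 12}} e kε≤12) ⟩
      fromℕ D ℚ.* fromℕ 12 ^ℚ e ≡⟨ trans (cong (fromℕ D ℚ.*_) (fromℕ-^ 12 e)) (sym (fromℕ-* D (12 ^ e))) ⟩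
      fromℕ (D * 12 ^ e) ≤⟨ fromℕ-mono-≤ ≤y ⟩
      fromℕ (y ^ b) ≡⟨ fromℕ-^ y b ⟨
      fromℕ y ^ℚ b ∎
      where
      open ℚ.≤-Reasoning
      a = ∣ ↥ r ∣
      b = ↧ₙ r

    Scale : ℕ → Set
    Scale l = fromℕ 6 ℚ.≤ fromℕ (2 ^ l) ℚ.* ε × fromℕ (2 ^ l) ℚ.* ε ℚ.≤ fromℕ 12

    -- Doubling starts below 6 because ε < 1, and the first value to reach 6 is at most 12. A power
    -- of two is sought so that log `k` is the natural number `l`.
    scale : ∃ Scale
    -- This many doublings suffice: ε is at least the reciprocal of its denominator, and 2^i exceeds
    -- i.
    scale with search (6 * ↧ₙ ε)
      where
      search : ∀ i → ∃ Scale ⊎ fromℕ (2 ^ i) ℚ.* ε ℚ.< fromℕ 6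
      search zero =
        inj₂ (ℚ.<-≤-trans (subst (ℚ._< 1ℚ) (sym (ℚ.*-identityˡ ε)) ε<1) (fromℕ-mono-≤ {1} {6} (s≤s z≤n)))
      search (suc i) with search i
      ... | inj₁ found = inj₁ found
      ... | inj₂ small with fromℕ 6 ℚ.≤? fromℕ (2 ^ suc i) ℚ.* ε
      ...   | no small′ = inj₂ (ℚ.≰⇒> small′)
      ...   | yes big = inj₁ (suc i , big , (begin
          fromℕ (2 ^ suc i) ℚ.* ε
            ≡⟨ trans (cong (ℚ._* ε) (fromℕ-* 2 (2 ^ i))) (ℚ.*-assoc (fromℕ 2) (fromℕ (2 ^ i)) ε) ⟩
          fromℕ 2 ℚ.* (fromℕ (2 ^ i) ℚ.* ε) ≤⟨ ℚ.*-monoˡ-≤-nonNeg (fromℕ 2) {{nonNeg 2}} (ℚ.<⇒≤ small) ⟩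
          fromℕ 2 ℚ.* fromℕ 6 ≡⟨ fromℕ-* 2 6 ⟨
          fromℕ 12 ∎))
        where open ℚ.≤-Reasoning
    ... | inj₁ found = found
    ... | inj₂ small = contradiction (ℚ.<-≤-trans small (large 0<ε)) (ℚ.<-irrefl refl)
      where
      large : ∀ {p} → 0ℚ ℚ.< p → fromℕ 6 ℚ.≤ fromℕ (2 ^ (6 * ↧ₙ p)) ℚ.* p
      large {mkℚ (+ 0) d _} (*<* (ℤ.+<+ ()))
      large {p@(mkℚ (+ suc a) d _)} _ = scale-≥ (2 ^ (6 * suc d)) 6 p {suc a} refl
        (≤-trans (<⇒≤ (n<2^n (6 * suc d))) (m≤m*n (2 ^ (6 * suc d)) (suc a)))
      large {mkℚ (ℤ.-[1+ _ ]) d _} (*<* ())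

  -- A fraction above 3 with denominator b has a numerator of at least 3b + 1. That one unit is the
  -- factor `k` that absorbs the logarithms in `words^≤`.
  exponent>3 : ∀ c → 0ℚ ℚ.< c → suc (3 * ↧ₙ (fromℕ 3 ℚ.+ c)) ≤ ∣ ↥ (fromℕ 3 ℚ.+ c) ∣
  exponent>3 c 0<c =
    bound (fromℕ 3 ℚ.+ c) (subst (ℚ._< fromℕ 3 ℚ.+ c) (ℚ.+-identityʳ (fromℕ 3)) (ℚ.+-monoʳ-< (fromℕ 3) 0<c))
    where
    bound : ∀ r → fromℕ 3 ℚ.< r → suc (3 * ↧ₙ r) ≤ ∣ ↥ r ∣
    bound (mkℚ (+ a) d _) (*<* h) =
      ℤ.drop‿+<+ (subst₂ ℤ._<_ (sym (ℤ.pos-* 3 (suc d))) (ℤ.*-identityʳ (+ a)) h)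
    bound (mkℚ (ℤ.-[1+ _ ]) d _) (*<* ())

-- Choice of the parameters and the bounds on space and passes.

module Choice where

  open import Defs
  open import Data.Fin.Base using (Fin; zero; suc)
  open import Data.List.Base using ([]; _∷_; length; allFin; upTo; cartesianProduct)
  open import Data.List.Properties using (length-tabulate; length-upTo)
  open import Data.List.Relation.Unary.All as All using ([]; _∷_)
  open import Data.List.Relation.Binary.Pointwise using ([])
  open import Data.List.Relation.Unary.AllPairs using ([])
  open import Data.Nat.Base as ℕ hiding (_/_; _%_; _<_; _+_)
  open import Data.Nat.Logarithm using (⌈log₂_⌉; ⌈log₂⌉-mono-≤; ⌈log₂2^n⌉≡n)
  open import Data.Nat.Properties
  open import Data.Nat.Tactic.RingSolver using (solve-∀)
  open import Data.Product.Base using (Σ; ∃-syntax; _×_; _,_; proj₁; proj₂)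
  open import Data.Rational.Base as ℚ using (ℚ; 0ℚ; 1ℚ; _<_; _+_; ↧ₙ_)
  import Data.Rational.Properties as ℚ
  import Data.Vec.Base as Vec
  open import Function.Base using (id; it)
  open import Relation.Binary.PropositionalEquality hiding (J)
  open import Relation.Nullary.Negation.Core using (contradiction)
  open FiniteSums using (length-cartesianProduct)
  open Unfold using (module Grouping)
  open StreamingAuction using (fromℕ-mono-≤; module Streaming)
  open Arithmetic

  -- The bound on the length of the log times the size of an entry, where `A` is the number of
  -- bidders. The three summands of the length are each absorbed into multiples of `A * (k * k)`.
  words≤ : ∀ K d n lw l k .{{_ : NonZero n}} .{{_ : NonZero lw}} .{{_ : NonZero l}} .{{_ : NonZero k}} →
    let A = n * ((lw ℕ.+ l ℕ.+ 1) * k) in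
    (A ℕ.+ A * k ℕ.+ k * k * suc A) * (4 ℕ.+ (K ℕ.+ d ℕ.+ l ℕ.+ 1)) ≤
    12 * (K ℕ.+ d ℕ.+ 6) * (n * lw) * (k * k * k * (l * l))
  words≤ K d n lw@(suc a) l@(suc c) k = begin
    (A ℕ.+ A * k ℕ.+ k * k * suc A) * (4 ℕ.+ (K ℕ.+ d ℕ.+ l ℕ.+ 1)) ≤⟨ *-mono-≤ log≤ entry≤ ⟩
    4 * (n * (3 * (lw * l) * k) * (k * k)) * ((K ℕ.+ d ℕ.+ 6) * l) ≡⟨ rearrange n lw l k (K ℕ.+ d ℕ.+ 6) ⟩
    12 * (K ℕ.+ d ℕ.+ 6) * (n * lw) * (k * k * k * (l * l)) ∎
    where
    open ≤-Reasoning
    A = n * ((lw ℕ.+ l ℕ.+ 1) * k)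
    rearrange : ∀ n lw l k e →
      4 * (n * (3 * (lw * l) * k) * (k * k)) * (e * l) ≡ 12 * e * (n * lw) * (k * k * k * (l * l))
    rearrange = solve-∀
    J≤ : lw ℕ.+ l ℕ.+ 1 ≤ 3 * (lw * l)
    J≤ = ≤-trans (m≤m+n _ (2 * a ℕ.+ 2 * c ℕ.+ 3 * (a * c))) (≤-reflexive (expand a c))
      where
      expand : ∀ a c →
        1 ℕ.+ a ℕ.+ (1 ℕ.+ c) ℕ.+ 1 ℕ.+ (2 * a ℕ.+ 2 * c ℕ.+ 3 * (a * c)) ≡ 3 * ((1 ℕ.+ a) * (1 ℕ.+ c))
      expand = solve-∀
    entry≤ : 4 ℕ.+ (K ℕ.+ d ℕ.+ l ℕ.+ 1) ≤ (K ℕ.+ d ℕ.+ 6) * l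
    entry≤ = ≤-trans (m≤m+n _ ((K ℕ.+ d ℕ.+ 5) * c)) (≤-reflexive (expand (K ℕ.+ d) c))
      where
      expand : ∀ e c → 4 ℕ.+ (e ℕ.+ (1 ℕ.+ c) ℕ.+ 1) ℕ.+ (e ℕ.+ 5) * c ≡ (e ℕ.+ 6) * (1 ℕ.+ c)
      expand = solve-∀
    A≤ : A ≤ n * (3 * (lw * l) * k)
    A≤ = *-monoʳ-≤ n (*-monoˡ-≤ k J≤)
    instance
      A≢0 : NonZero A
      A≢0 = m*n≢0 n ((lw ℕ.+ l ℕ.+ 1) * k) {{it}} {{m*n≢0 (lw ℕ.+ l ℕ.+ 1) k}}
      kk≢0 : NonZero (k * k)
      kk≢0 = m*n≢0 k k
    log≤ : A ℕ.+ A * k ℕ.+ k * k * suc A ≤ 4 * (n * (3 * (lw * l) * k) * (k * k))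
    log≤ = begin
      A ℕ.+ A * k ℕ.+ k * k * suc A ≤⟨ +-mono-≤ (+-mono-≤ (m≤m*n A (k * k)) (*-monoʳ-≤ A (m≤m*n k k)))
          (≤-trans (≤-reflexive (*-suc (k * k) A))
            (+-mono-≤ (m≤n*m (k * k) A) (≤-reflexive (*-comm (k * k) A)))) ⟩
      A * (k * k) ℕ.+ A * (k * k) ℕ.+ (A * (k * k) ℕ.+ A * (k * k)) ≡⟨ four (A * (k * k)) ⟩
      4 * (A * (k * k)) ≤⟨ *-monoʳ-≤ 4 (*-monoˡ-≤ (k * k) A≤) ⟩
      4 * (n * (3 * (lw * l) * k) * (k * k)) ∎
      where
      four : ∀ x → x ℕ.+ x ℕ.+ (x ℕ.+ x) ≡ 4 * x
      four = solve-∀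

  -- The power `b` clears the denominator of the exponent 3 + c. It turns the squared logarithm into
  -- `l ^ (2 * b)`, which costs one further factor `k`.
  words^≤ : ∀ b .{{_ : NonZero b}} {x} X k l → k ≡ 2 ^ l → x ≤ X * (k * k * k * (l * l)) →
            x ^ b ≤ X ^ b * (2 * b) ^ (2 * b) * k ^ suc (3 * b)
  words^≤ b {x} X k l k≡ x≤ = begin
    x ^ b ≤⟨ ^-monoˡ-≤ b x≤ ⟩
    (X * (k * k * k * (l * l))) ^ b
      ≡⟨ trans (^-distrib-* X _ b)
        (cong (X ^ b *_) (trans (^-distrib-* (k * k * k) (l * l) b) (cong₂ _*_ k³ l²))) ⟩
    X ^ b * (k ^ (3 * b) * l ^ (2 * b))
      ≤⟨ *-monoʳ-≤ (X ^ b) (*-monoʳ-≤ (k ^ (3 * b)) (power≤exponential (2 * b) {{m*n≢0 2 b}} l)) ⟩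
    X ^ b * (k ^ (3 * b) * ((2 * b) ^ (2 * b) * 2 ^ l))
      ≡⟨ cong (λ z → X ^ b * (k ^ (3 * b) * ((2 * b) ^ (2 * b) * z))) (sym k≡) ⟩
    X ^ b * (k ^ (3 * b) * ((2 * b) ^ (2 * b) * k))
      ≡⟨ rearrange (X ^ b) (k ^ (3 * b)) ((2 * b) ^ (2 * b)) k ⟩
    X ^ b * (2 * b) ^ (2 * b) * (k * k ^ (3 * b)) ∎
    where
    open ≤-Reasoning
    rearrange : ∀ a b c d → a * (b * (c * d)) ≡ a * c * (d * b)
    rearrange = solve-∀
    k³ : (k * k * k) ^ b ≡ k ^ (3 * b)
    k³ = trans (cong (_^ b) (cube k)) (^-*-assoc k 3 b)
      where
      cube : ∀ k → k * k * k ≡ k * (k * (k * 1))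
      cube = solve-∀
    l² : (l * l) ^ b ≡ l ^ (2 * b)
    l² = trans (cong (_^ b) (cong (l *_) (sym (*-identityʳ l)))) (^-*-assoc l 2 b)

  -- The constants must be collected inside a `b`-th power. The odd 12 of the exponent 3b + 1 is
  -- enlarged to `12 ^ b`, hence `12 ^ 4`.
  constants≤ : ∀ b .{{_ : NonZero b}} C₁ y →
    (C₁ * y) ^ b * (2 * b) ^ (2 * b) * 12 ^ suc (3 * b) ≤ (C₁ * (2 * b) ^ 2 * 12 ^ 4 * y) ^ b
  constants≤ b C₁ y = begin
    (C₁ * y) ^ b * (2 * b) ^ (2 * b) * (12 * 12 ^ (3 * b))
      ≤⟨ *-monoʳ-≤ ((C₁ * y) ^ b * (2 * b) ^ (2 * b))
        (*-monoˡ-≤ (12 ^ (3 * b))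
          (≤-trans (≤-reflexive (sym (^-identityʳ 12))) (^-monoʳ-≤ 12 (>-nonZero⁻¹ b)))) ⟩
    (C₁ * y) ^ b * (2 * b) ^ (2 * b) * (12 ^ b * 12 ^ (3 * b))
      ≡⟨ cong₂ (λ u v → (C₁ * y) ^ b * u * v) (sym (^-*-assoc (2 * b) 2 b))
        (trans (sym (^-distribˡ-+-* 12 b (3 * b))) (sym (^-*-assoc 12 4 b))) ⟩
    (C₁ * y) ^ b * B ^ b * Z ^ b
      ≡⟨ trans (cong (_* Z ^ b) (sym (^-distrib-* (C₁ * y) B b))) (sym (^-distrib-* (C₁ * y * B) Z b)) ⟩
    (C₁ * y * B * Z) ^ b ≡⟨ cong (_^ b) (rearrange C₁ y B Z) ⟩
    (C₁ * B * Z * y) ^ b ∎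
    where
    open ≤-Reasoning
    B = (2 * b) ^ 2
    Z = 12 ^ 4
    rearrange : ∀ a b c d → a * b * c * d ≡ a * c * d * b
    rearrange = solve-∀

  -- With at most one vertex, words have 0 bits and no memory can hold anything; but a bipartite
  -- graph on such a vertex set has no edges.
  module Trivial (n : ℕ) (collapsed : ∀ (i j : Fin n) → i ≡ j) where

    algorithm : StreamingAlgorithm n 0
    algorithm = record { init = Vec.[] ; step = λ m _ → m ; endPass = id ; output = λ _ → [] }

    solves : ∀ ε W → SolvesApproxMWM ε W 0 algorithm
    solves ε W G graph = [] , [] , record { inGraph = [] ; disjoint = [] } , best
      where
      best : ∀ M′ → IsMatching G M′ → (1ℚ ℚ.- ε) ℚ.* totalWeight M′ ℚ.≤ 0ℚ
      best [] _ = ℚ.≤-reflexive (ℚ.*-zeroʳ (1ℚ ℚ.- ε))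
      best (e ∷ _) matching = contradiction (cong side (collapsed (source e) (target e)))
        (All.lookup crossing (All.head (IsMatching.inGraph matching)))
        where
        side = proj₁ (IsBipartiteGraph.bipartite graph)
        crossing = proj₂ (IsBipartiteGraph.bipartite graph)

  module _ {ε : ℚ} (0<ε : 0ℚ < ε) (ε<1 : ε < 1ℚ) where

    -- The bound 144 is the square of 12 ≥ `k` ε.
    passes-atMost : ∀ k C → fromℕ k ℚ.* ε ℚ.≤ fromℕ 12 → 144 ≤ C →
      AtMostTimesInversePower (k * k) C ε (fromℕ 2)
    passes-atMost k C kε≤12 144≤C = atMost 0<ε ε<1 {k * k} {C} {fromℕ 2} k 1 2 kε≤12 ≤-refl
      (≤-reflexive (square k)) (≤-trans 144≤C (≤-reflexive (sym (*-identityʳ C))))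
      where
      square : ∀ k → k * k * 1 ≡ 1 * (k * (k * 1))
      square = solve-∀

    zero-atMost : ∀ y r → AtMostTimesInversePower 0 y ε r
    zero-atMost y r = atMost 0<ε ε<1 {0} {y} {r} 0 0 0
      (ℚ.≤-trans (ℚ.≤-reflexive (ℚ.*-zeroˡ ε)) (fromℕ-mono-≤ {0} {12} z≤n)) z≤n z≤n z≤n

  module Parameters (n-2 W K d : ℕ) (2≤W : 2 ≤ W) (W≤ : W ≤ K * suc (suc n-2) ^ d)
    {ε : ℚ} (ε<1 : ε < 1ℚ) (l : ℕ) (6≤kε : fromℕ 6 ℚ.≤ fromℕ (2 ^ l) ℚ.* ε) where

    -- `J` bits suffice for a rounded weight, and `J * k` groups reach beyond all heights. `m` is
    -- the number of words of `L` bits reserved for those `J` bits.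
    n lw L k J m : ℕ
    n = suc (suc n-2)
    lw = ⌈log₂ W ⌉
    L = ⌈log₂ n ⌉
    k = 2 ^ l
    J = lw ℕ.+ l ℕ.+ 1
    m = K ℕ.+ d ℕ.+ l ℕ.+ 1

    6≤k : 6 ≤ k
    6≤k = fromℕ-cancel-≤ (ℚ.≤-trans 6≤kε (ℚ.≤-trans
      (ℚ.*-monoˡ-≤-nonNeg (fromℕ k) {{ℚ.nonNegative (fromℕ-mono-≤ {0} {k} z≤n)}} (ℚ.<⇒≤ ε<1))
      (ℚ.≤-reflexive (ℚ.*-identityʳ (fromℕ k)))))

    instance
      k≢0 : NonZero k
      k≢0 = m^n≢0 2 l

    0<lw : 0 ℕ.< lw
    0<lw = ⌈log₂⌉-mono-≤ {2} {W} 2≤W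

    0<L : 0 ℕ.< L
    0<L = ⌈log₂⌉-mono-≤ {2} {n} (s≤s (s≤s z≤n))

    0<l : 0 ℕ.< l
    0<l = positive l 6≤k
      where
      positive : ∀ l → 6 ≤ 2 ^ l → 0 ℕ.< l
      positive zero (s≤s ())
      positive (suc l) _ = z<s

    kW<2^J : suc (k * W) ≤ 2 ^ J
    kW<2^J = begin
      suc (k * W) ≤⟨ s≤s (*-monoʳ-≤ k (n≤2^⌈log₂n⌉ W)) ⟩
      suc (k * 2 ^ lw) ≡⟨ cong suc (trans (*-comm k _) (sym (^-distribˡ-+-* 2 lw l))) ⟩
      suc (2 ^ (lw ℕ.+ l)) ≤⟨ ^-monoʳ-< 2 (s≤s (s≤s z≤n)) (≤-reflexive (+-comm 1 (lw ℕ.+ l))) ⟩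
      2 ^ J ∎
      where open ≤-Reasoning

    H≤bnd : k * W ≤ Grouping.bnd k (J * k)
    H≤bnd = ≤-pred (≤-trans kW<2^J (Grouping.bnd-exponential k J))

    -- Here the polynomial bound on `W` enters: log W fits into a number of words that depends only
    -- on `K` and `d`. The remaining words of a weight hold log `k`, which is not bounded in terms
    -- of `n`.
    lw≤ : lw ≤ K ℕ.+ L * d
    lw≤ = begin
      ⌈log₂ W ⌉ ≤⟨ ⌈log₂⌉-mono-≤ W≤′ ⟩
      ⌈log₂ 2 ^ (K ℕ.+ L * d) ⌉ ≡⟨ ⌈log₂2^n⌉≡n (K ℕ.+ L * d) ⟩
      K ℕ.+ L * d ∎
      where
      open ≤-Reasoning
      W≤′ : W ≤ 2 ^ (K ℕ.+ L * d)
      W≤′ = begin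
        W ≤⟨ W≤ ⟩
        K * n ^ d ≤⟨ *-mono-≤ (<⇒≤ (n<2^n K)) (^-monoˡ-≤ d (n≤2^⌈log₂n⌉ n)) ⟩
        2 ^ K * (2 ^ L) ^ d ≡⟨ cong (2 ^ K *_) (^-*-assoc 2 L d) ⟩
        2 ^ K * 2 ^ (L * d) ≡⟨ ^-distribˡ-+-* 2 K (L * d) ⟨
        2 ^ (K ℕ.+ L * d) ∎

    J≤Lm : J ≤ L * m
    J≤Lm = begin
      lw ℕ.+ l ℕ.+ 1 ≤⟨ +-mono-≤ (+-mono-≤ lw≤ (m≤n*m l L)) 0<L ⟩
      K ℕ.+ L * d ℕ.+ L * l ℕ.+ L ≤⟨ +-monoˡ-≤ L (+-monoˡ-≤ (L * l) (+-monoˡ-≤ (L * d) (m≤n*m K L))) ⟩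
      L * K ℕ.+ L * d ℕ.+ L * l ℕ.+ L ≡⟨ rearrange L K d l ⟩
      L * m ∎
      where
      open ≤-Reasoning
      instance
        L≢0 : NonZero L
        L≢0 = >-nonZero 0<L
      rearrange : ∀ L K d l → L * K ℕ.+ L * d ℕ.+ L * l ℕ.+ L ≡ L * (K ℕ.+ d ℕ.+ l ℕ.+ 1)
      rearrange = solve-∀

    H<2^Lm : suc (k * W) ≤ (2 ^ L) ^ m
    H<2^Lm = ≤-trans kW<2^J (≤-trans (^-monoʳ-≤ 2 J≤Lm) (≤-reflexive (sym (^-*-assoc 2 L m))))

    open Streaming (suc n-2) k W (J * k) m H≤bnd 0<L (n≤2^⌈log₂n⌉ n) H<2^Lm using (N; T; solution) public

    length-bidders : length (cartesianProduct (allFin n) (upTo (J * k))) ≡ n * (J * k)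
    length-bidders = trans (length-cartesianProduct (allFin n) (upTo (J * k)))
      (cong₂ _*_ (length-tabulate {n = n} id) (length-upTo (J * k)))

    space : N * (4 ℕ.+ m) ≤ 12 * (K ℕ.+ d ℕ.+ 6) * (n * lw) * (k * k * k * (l * l))
    space =
      subst (λ A → (A ℕ.+ A * k ℕ.+ k * k * suc A) * (4 ℕ.+ m) ≤ 12 * (K ℕ.+ d ℕ.+ 6) * (n * lw) *
        (k * k * k * (l * l)))
      (sym length-bidders) (words≤ K d n lw l k {{_}} {{>-nonZero 0<lw}} {{>-nonZero 0<l}})

  module Construction (c : ℚ) (0<c : 0ℚ < c) (K d : ℕ) where

    r : ℚ
    r = fromℕ 3 + c

    b C₁ C : ℕ
    b = ↧ₙ r
    C₁ = 12 * (K ℕ.+ d ℕ.+ 6)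
    C = C₁ * (2 * b) ^ 2 * 12 ^ 4

    Solution : ℕ → ℕ → ℚ → Set
    Solution n W ε = ∃[ words ] ∃[ passes ] Σ (StreamingAlgorithm n words) λ A →
      AtMostTimesInversePower words (C * (n * ⌈log₂ W ⌉)) ε r
      × AtMostTimesInversePower passes C ε (fromℕ 2)
      × SolvesApproxMWM ε W passes A

    144≤C : 144 ≤ C
    144≤C = ≤-trans (m≤n*m 144 144) (m≤n*m (12 ^ 4) (C₁ * (2 * b) ^ 2)
      {{m*n≢0 C₁ ((2 * b) ^ 2) {{m*n≢0 12
        (K ℕ.+ d ℕ.+ 6) {{_}} {{>-nonZero (≤-trans (s≤s z≤n) (m≤n+m 6 (K ℕ.+ d)))}}}} {{m^n≢0 (2 * b) 2}}}})

    trivial : ∀ n W {ε} → 0ℚ < ε → ε < 1ℚ → (∀ (i j : Fin n) → i ≡ j) → Solution n W ε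
    trivial n W {ε} 0<ε ε<1 collapsed = 0 , 0 , Trivial.algorithm n collapsed ,
      zero-atMost 0<ε ε<1 (C * (n * ⌈log₂ W ⌉)) r , zero-atMost 0<ε ε<1 C (fromℕ 2) ,
      Trivial.solves n collapsed ε W

    construct : ∀ n W → 2 ≤ W → W ≤ K * n ^ d → ∀ ε → 0ℚ < ε → ε < 1ℚ → Solution n W ε
    construct zero W _ _ ε 0<ε ε<1 = trivial 0 W 0<ε ε<1 λ ()
    construct (suc zero) W _ _ ε 0<ε ε<1 = trivial 1 W 0<ε ε<1 λ { zero zero → refl }
    construct n@(suc (suc n-2)) W 2≤W W≤ ε 0<ε ε<1 = choose (scale 0<ε ε<1)
      where
      X : ℕ
      X = C₁ * (n * ⌈log₂ W ⌉)
      choose : (∃[ l ] Scale 0<ε ε<1 l) → Solution n W ε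
      choose (l , 6≤kε , kε≤12) = N * (4 ℕ.+ m) , T , proj₁ A ,
        atMost 0<ε ε<1 {N * (4 ℕ.+ m)} {C * (n * ⌈log₂ W ⌉)} {r} k (X ^ b * (2 * b) ^ (2 * b))
          (suc (3 * b)) kε≤12
          (exponent>3 c 0<c) (words^≤ b X k l refl space) (constants≤ b C₁ (n * ⌈log₂ W ⌉)) ,
        passes-atMost 0<ε ε<1 k C kε≤12 144≤C , proj₂ A
        where
        open Parameters n-2 W K d 2≤W W≤ ε<1 l 6≤kε using (k; m; N; T; solution; space; 6≤k)
        A : Σ (StreamingAlgorithm n (N * (4 ℕ.+ m))) (SolvesApproxMWM ε W T)
        A = solution ε (k ∸ 6) (sym (m+[n∸m]≡n 6≤k)) 6≤kε

open import Defs
open import Data.Nat.Base as ℕ using (ℕ)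
open import Data.Nat.Logarithm using (⌈log₂_⌉)
open import Data.Product.Base using (Σ; ∃-syntax; _×_; _,_)
open import Data.Rational.Base using (ℚ; 0ℚ; 1ℚ; _<_; _+_)

lemma6p13 : ∀ (c : ℚ) → 0ℚ < c →
    ∀ (K d : ℕ) →
    ∃[ C ]
    (∀ (n W : ℕ) → 2 ℕ.≤ W → W ℕ.≤ K ℕ.* n ℕ.^ d →
    ∀ (ε : ℚ) → 0ℚ < ε → ε < 1ℚ →
    ∃[ words ] ∃[ passes ] Σ (StreamingAlgorithm n words) λ A →
    AtMostTimesInversePower words (C ℕ.* (n ℕ.* ⌈log₂ W ⌉)) ε (fromℕ 3 + c)
    × AtMostTimesInversePower passes C ε (fromℕ 2)
    × SolvesApproxMWM ε W passes A)
lemma6p13 c 0<c K d = C , construct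
  where open Choice.Construction c 0<c K d using (C; construct)
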